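{- There is a function $g:\mathbb{N}\to\mathbb{R}$ with $g(n)\to 0$ as $n\to\infty$ such that the following holds. Let $G$ be a $3$-uniform hypergraph on $n$ vertices which contains no $0$-immersion of any closed surface. Then $e(G)\leq n^{2+g(n)}$.
   Context: A $3$-uniform hypergraph $G$ is identified with the $2$-dimensional pure simplicial complex generated by its edges (the edges are the $2$-faces, their $2$-subsets the $1$-faces, their vertices the $0$-faces). For $2$-dimensional simplicial complexes $H,G$, a map $\phi:H\to G$ is a homomorphism if it is induced by a vertex map such that for every $i$-face $\{x_0,\dots,x_i\}$ of $H$ ($i=0,1,2$), $\{\phi(x_0),\dots,\phi(x_i)\}$ is an $i$-face of $G$ (so $\phi$ maps $i$-faces to $i$-faces). $G$ contains a $0$-immersion of a topological space $S$ if there is a simplicial complex $H'$ homeomorphic to $S$ and a homomorphism $\phi:H'\to G$ which is injective on the $1$-faces and on the $2$-faces (but possibly not on vertices). A closed surface is a compact connected $2$-manifold without boundary. -}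

module Defs where

open import Data.Nat using (ℕ; suc; _+_; _*_; _^_; _≤_)
open import Data.Fin using (Fin)
import Data.Fin as F
open import Data.List using (List; length)
open import Data.List.Membership.Propositional using (_∈_)
open import Data.List.Relation.Unary.All using (All)
open import Data.List.Relation.Unary.Unique.Propositional using (Unique)
open import Data.Product using (_×_; _,_; Σ; ∃; ∃-syntax)
open import Data.Sum using (_⊎_)
open import Relation.Binary.PropositionalEquality using (_≡_; _≢_)
open import Relation.Nullary using (¬_)

Triple : ℕ → Set
Triple n = Fin n × Fin n × Fin n

_∈₃_ : ∀ {n} → Fin n → Triple n → Set
v ∈₃ (a , b , c) = v ≡ a ⊎ v ≡ b ⊎ v ≡ c

SameSet : ∀ {n} → Triple n → Triple n → Set
SameSet {n} t u = (v : Fin n) → (v ∈₃ t → v ∈₃ u) × (v ∈₃ u → v ∈₃ t)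

SamePair : ∀ {n} → Fin n → Fin n → Fin n → Fin n → Set
SamePair {n} a b c d =
  (v : Fin n) → ((v ≡ a ⊎ v ≡ b) → (v ≡ c ⊎ v ≡ d)) × ((v ≡ c ⊎ v ≡ d) → (v ≡ a ⊎ v ≡ b))

-- canonical representation of a 3-set {a,b,c} : a < b < c
Sorted : ∀ {n} → Triple n → Set
Sorted (a , b , c) = a F.< b × b F.< c

-- A finite family of 3-subsets of Fin n (each listed once, sorted).
-- Used both for a 3-uniform hypergraph on n vertices and for the set of
-- 2-faces of a pure 2-dimensional simplicial complex on vertex set Fin n.
record TripleSystem (n : ℕ) : Set where
  field
    triples : List (Triple n)
    sorted  : All Sorted triples
    unique  : Unique triples
open TripleSystem public

e : ∀ {n} → TripleSystem n → ℕ
e G = length (triples G)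

mapT : ∀ {m n} → (Fin m → Fin n) → Triple m → Triple n
mapT φ (a , b , c) = φ a , φ b , φ c

Adj : ∀ {m} → TripleSystem m → Fin m → Fin m → Set
Adj H x y = x ≢ y × ∃[ t ] (t ∈ triples H × x ∈₃ t × y ∈₃ t)

Face1 : ∀ {m} → TripleSystem m → Fin m → Fin m → Set
Face1 H x y = x F.< y × ∃[ t ] (t ∈ triples H × x ∈₃ t × y ∈₃ t)

data Reach {m} (H : TripleSystem m) : Fin m → Fin m → Set where
  here : ∀ {u} → Reach H u u
  step : ∀ {u w v} → Adj H u w → Reach H w v → Reach H u v

data LinkReach {m} (H : TripleSystem m) (v : Fin m) : Fin m → Fin m → Set where
  here : ∀ {a} → LinkReach H v a a
  step : ∀ {a c b} →
         v ≢ a → a ≢ c → v ≢ c →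
         ∃[ t ] (t ∈ triples H × v ∈₃ t × a ∈₃ t × c ∈₃ t) →
         LinkReach H v c b → LinkReach H v a b

-- The complex generated by H (on vertex set Fin m, all vertices used) is a
-- triangulated closed surface: nonempty, connected, every 1-face in exactly
-- two 2-faces, and the link of every vertex is connected (hence a cycle).
record ClosedSurface {m} (H : TripleSystem m) : Set where
  field
    nonempty  : ∃[ t ] (t ∈ triples H)
    covers    : (v : Fin m) → ∃[ t ] (t ∈ triples H × v ∈₃ t)
    edgeTwo   : (x y : Fin m) → Face1 H x y →
                ∃[ t₁ ] ∃[ t₂ ] (t₁ ∈ triples H × t₂ ∈ triples H × t₁ ≢ t₂ ×
                  x ∈₃ t₁ × y ∈₃ t₁ × x ∈₃ t₂ × y ∈₃ t₂ ×
                  ((t : Triple m) → t ∈ triples H → x ∈₃ t → y ∈₃ t → t ≡ t₁ ⊎ t ≡ t₂))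
    connected : (u v : Fin m) → Reach H u v
    linkConn  : (v a b : Fin m) → Adj H v a → Adj H v b → LinkReach H v a b

record ZeroImmersion {m n} (H : TripleSystem m) (G : TripleSystem n) (φ : Fin m → Fin n) : Set where
  field
    hom  : (t : Triple m) → t ∈ triples H → ∃[ f ] (f ∈ triples G × SameSet (mapT φ t) f)
    inj2 : (t t' : Triple m) → t ∈ triples H → t' ∈ triples H →
           SameSet (mapT φ t) (mapT φ t') → t ≡ t'
    inj1 : (x y x' y' : Fin m) → Face1 H x y → Face1 H x' y' →
           SamePair (φ x) (φ y) (φ x') (φ y') → x ≡ x' × y ≡ y'

ContainsSurfaceImmersion : ∀ {n} → TripleSystem n → Set
ContainsSurfaceImmersion G =
  ∃[ m ] Σ (TripleSystem m) λ H → ClosedSurface H × ∃[ φ ] ZeroImmersion H G φ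

{-# OPTIONS --safe #-}
module Submission where

-- Let F be a non-empty set of triples of G such that every pair lies in no or in exactly two
-- triples of F.  Splitting each vertex along the components of its link turns a connected
-- component of F into a closed surface 0-immersed in G, so it suffices to find F.
--
-- Two distinct families of pairwise non-conflicting blocks that have the same key pairs differ
-- by such an F.  Greedy choices produce many families, and there are few possible sets of keys,
-- so the pigeonhole principle yields two families as soon as the degrees are balanced.
--
-- Let q be a small power of n.  After passing to a constant fraction of the triples, the three
-- pairs of a triple have codegrees about q^d₁ ≤ q^d₂ ≤ q^d₃.  If d₃ - d₂ is bounded, single
-- triples serve as blocks.  Otherwise the blocks are wheels: short cycles in the link of a hub
-- vertex, chosen greedily so that their spokes are disjoint and no rim pair is overused.  Only
-- the rim pairs, those of level d₃, are keys, and as the spoke pairs are far more numerous than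
-- the rim pairs, there are enough wheels per rim pair to beat the bounded length of the cycles.

open import Defs
open import Data.Nat using (ℕ; zero; suc; _+_; _*_; _^_; _≤_; _<_; _∸_; z≤n; s≤s; _≤?_; _/_; NonZero; >-nonZero)
open import Data.Nat.Properties as ℕ using (≤-trans; ≤-refl; ≤-reflexive; module ≤-Reasoning)
open import Data.Nat.DivMod using (m≥n⇒m/n>0; m/n*n≤m; m≡m%n+[m/n]*n; m%n<n)
open import Data.Nat.Tactic.RingSolver using (solve-∀)
open import Data.Nat.ListAction using (sum)
open import Data.Fin using (Fin)
import Data.Fin as F
import Data.Fin.Properties as F
open import Data.Bool using (Bool; true; false; if_then_else_)
open import Data.List using (List; []; _∷_; _++_; [_]; length; map; concat; concatMap; filter; take; drop; lookup; deduplicate; allFin; upTo; cartesianProduct)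
open import Data.List.Properties using (length-map; map-∘; length-++; length-take; length-drop; filter-accept; filter-reject; ∷-injective; ≡-dec; length-tabulate; length-upTo; filter-++)
open import Data.List.Membership.Propositional using (_∈_; _∉_; find; lose)
open import Data.List.Membership.Propositional.Properties
open import Data.List.Relation.Unary.Any using (Any; here; there; any?; index)
open import Data.List.Relation.Unary.Any.Properties using (lookup-index)
open import Data.List.Relation.Unary.All as All using (All; []; _∷_)
import Data.List.Relation.Unary.All.Properties as All
open import Data.List.Relation.Unary.AllPairs as AllPairs using (AllPairs; []; _∷_)
import Data.List.Relation.Unary.AllPairs.Properties as AllPairs
open import Data.List.Relation.Unary.Unique.Propositional using (Unique)
import Data.List.Relation.Unary.Unique.Propositional.Properties as Unique
import Data.List.Relation.Unary.Unique.DecPropositional.Properties as DecUnique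
open import Data.List.Relation.Binary.Sublist.Propositional as Sublist using () renaming (_⊆_ to _⊑_; ⊆-refl to ⊑-refl; ⊆-trans to ⊑-trans)
import Data.List.Relation.Binary.Sublist.Propositional.Properties as Sublist
open import Data.Product using (_×_; _,_; Σ; ∃-syntax; proj₁; proj₂)
import Data.Product.Properties as Product
open import Data.Sum using (_⊎_; inj₁; inj₂; [_,_]′) renaming (map to ⊎-map; swap to ⊎-swap)
open import Data.Empty using (⊥)
open import Function using (_∘_; id; case_of_)
open import Level using (0ℓ)
open import Relation.Nullary using (¬_; Dec; yes; no; does; contradiction; ¬?; _×-dec_; _⊎-dec_; _→-dec_)
open import Relation.Nullary.Decidable using (decidable-stable)
open import Relation.Unary using (Pred; Decidable)
open import Relation.Binary using (Rel; DecidableEquality; Symmetric) renaming (Decidable to Decidable₂)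
open import Relation.Binary.PropositionalEquality using (_≡_; _≢_; refl; sym; trans; cong; cong₂; subst; ≢-sym; module ≡-Reasoning)
open import Relation.Binary.Construct.Closure.ReflexiveTransitive as Star using (Star; ε; _◅_; _◅◅_)
open import Data.Unit using (⊤; tt)

-- Counting decides which blocks work. If a block conflicts with at most Δ blocks, each of m steps
-- can branch Δ ways at the cost of 2Δ blocks, giving Δ^m families, whereas up to k keys from a
-- universe of 2vk pairs leave at most (8v)^k key sets. For single triples Δ is about q^d₃ and the
-- three kinds of keys cost about q^(d₃-d₁), q^(d₃-d₂) and a bounded power of q per triple, so
-- branching wins once d₁ exceeds d₃-d₂ by a constant. Density only gives d₁ ≥ σ, so a large gap
-- d₃-d₂ is the obstacle. For wheels of at most r triples Δ is about q^(d₃-d₂) and the keys cost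
-- about q^(2r) per wheel, so a large gap is exactly what helps. The cases meet at the gap 2r, which
-- leads to σ = 5 + 2r. This is not circular: the links in use have average degree above 2q^σ, and n
-- is about q^((σ+1)c) when the exponent 2 + 1/c is wanted, so they have cycles of length O(c)
-- whatever σ is. Hence r depends on c alone, and σ is fixed after it.

private variable
  A B C : Set
  n : ℕ

-- Counting

-- The relation `R` between earlier and later entries is handed to the collision, which thus returns
-- evidence of a difference instead of a bare inequality. For families the evidence is a block of
-- one that is missing from the other.
pigeonhole : {R : Rel A 0ℓ} (f : A → B) {xs : List A} {ys : List B} → AllPairs R xs →
  (∀ {x} → x ∈ xs → f x ∈ ys) → length ys < length xs →
  ∃[ x ] ∃[ x' ] (x ∈ xs × x' ∈ xs × R x x' × f x ≡ f x')
pigeonhole {R = R} f {xs} {ys} rs into lt =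
  let g = λ i → index (into (∈-lookup {xs = xs} i))
      i , j , i<j , eq = F.pigeonhole lt g
      val = λ k → lookup-index (into (∈-lookup {xs = xs} k))
  in lookup xs i , lookup xs j , ∈-lookup i , ∈-lookup j , related rs i<j ,
     trans (val i) (trans (cong (lookup ys) eq) (sym (val j)))
  where
  related : ∀ {zs} → AllPairs R zs → {i j : Fin (length zs)} → i F.< j → R (lookup zs i) (lookup zs j)
  related (r ∷ _) {F.zero} {F.suc j} _ = All.lookup r (∈-lookup j)
  related (_ ∷ rs) {F.suc i} {F.suc j} (s≤s i<j) = related rs i<j

unique⇒length≤ : {xs ys : List A} → Unique xs → (∀ {x} → x ∈ xs → x ∈ ys) → length xs ≤ length ys
unique⇒length≤ {xs = xs} {ys} u sub with length xs ≤? length ys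
... | yes le = le
... | no nle = let _ , _ , _ , _ , ne , eq = pigeonhole id u sub (ℕ.≰⇒> nle) in contradiction eq ne

count : {P : Pred A 0ℓ} → Decidable P → List A → ℕ
count P? xs = length (filter P? xs)

module _ {P : Pred A 0ℓ} (P? : Decidable P) where

  count-++ : ∀ xs ys → count P? (xs ++ ys) ≡ count P? xs + count P? ys
  count-++ xs ys = trans (cong length (filter-++ P? xs ys)) (length-++ (filter P? xs))

  count-⊑ : ∀ {xs ys} → xs ⊑ ys → count P? xs ≤ count P? ys
  count-⊑ s = Sublist.length-mono-≤ (Sublist.filter⁺ P? P? (λ { refl p → p }) s)

  count>0⇒∈ : ∀ xs → 0 < count P? xs → ∃[ x ] (x ∈ xs × P x)
  count>0⇒∈ xs pos with filter P? xs in eq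
  ... | x ∷ _ = x , ∈-filter⁻ P? {xs = xs} (subst (x ∈_) (sym eq) (here refl))

  ∈⇒count>0 : ∀ {xs x} → x ∈ xs → P x → 0 < count P? xs
  ∈⇒count>0 x∈ px = ∈-length (∈-filter⁺ P? x∈ px)

  count≡2 : ∀ {xs} → Unique xs → count P? xs ≡ 2 → ∀ {x} → x ∈ xs → P x →
    ∃[ y ] (y ∈ xs × y ≢ x × P y × (∀ {z} → z ∈ xs → P z → z ≡ x ⊎ z ≡ y))
  count≡2 {xs} u two {x} x∈ px = go (filter P? xs) refl two
    where
    go : ∀ fs → filter P? xs ≡ fs → length fs ≡ 2 →
      ∃[ y ] (y ∈ xs × y ≢ x × P y × (∀ {z} → z ∈ xs → P z → z ≡ x ⊎ z ≡ y))
    go (a ∷ b ∷ []) eq refl with subst Unique eq (Unique.filter⁺ P? u) | subst (x ∈_) eq (∈-filter⁺ P? x∈ px)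
    ... | (a≢b ∷ []) ∷ _ | here refl =
      let y∈ , py = ∈-filter⁻ P? {xs = xs} (subst (b ∈_) (sym eq) (there (here refl)))
      in b , y∈ , ≢-sym a≢b , py , λ z∈ pz → case subst (_ ∈_) eq (∈-filter⁺ P? z∈ pz) of λ where
           (here e) → inj₁ e
           (there (here e)) → inj₂ e
    ... | (a≢b ∷ []) ∷ _ | there (here refl) =
      let y∈ , py = ∈-filter⁻ P? {xs = xs} (subst (a ∈_) (sym eq) (here refl))
      in a , y∈ , a≢b , py , λ z∈ pz → case subst (_ ∈_) eq (∈-filter⁺ P? z∈ pz) of λ where
           (here e) → inj₂ e
           (there (here e)) → inj₁ e

count-∷ : {P : Pred A 0ℓ} (P? : Decidable P) → ∀ x xs → count P? (x ∷ xs) ≡ count P? [ x ] + count P? xs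
count-∷ P? x xs = count-++ P? [ x ] xs

count-cong : {P Q : Pred A 0ℓ} (P? : Decidable P) (Q? : Decidable Q) →
  ∀ xs → (∀ {x} → x ∈ xs → P x → Q x) → count P? xs ≤ count Q? xs
count-cong P? Q? [] f = z≤n
count-cong P? Q? (x ∷ xs) f with P? x | Q? x
... | yes p | yes q = s≤s (count-cong P? Q? xs (f ∘ there))
... | yes p | no nq = contradiction (f (here refl) p) nq
... | no np | yes q = ℕ.m≤n⇒m≤1+n (count-cong P? Q? xs (f ∘ there))
... | no np | no nq = count-cong P? Q? xs (f ∘ there)

count-⊎ : {P Q R : Pred A 0ℓ} (P? : Decidable P) (Q? : Decidable Q) (R? : Decidable R) →
  ∀ xs → (∀ {x} → x ∈ xs → P x → Q x ⊎ R x) → count P? xs ≤ count Q? xs + count R? xs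
count-⊎ P? Q? R? [] f = z≤n
count-⊎ P? Q? R? (x ∷ xs) f with P? x | Q? x | R? x | count-⊎ P? Q? R? xs (f ∘ there)
... | no _  | no _  | no _  | ih = ih
... | no _  | no _  | yes _ | ih = ≤-trans ih (ℕ.+-monoʳ-≤ _ (ℕ.n≤1+n _))
... | no _  | yes _ | no _  | ih = ℕ.m≤n⇒m≤1+n ih
... | no _  | yes _ | yes _ | ih = ℕ.m≤n⇒m≤1+n (≤-trans ih (ℕ.+-monoʳ-≤ _ (ℕ.n≤1+n _)))
... | yes _ | yes _ | no _  | ih = s≤s ih
... | yes _ | yes _ | yes _ | ih = s≤s (≤-trans ih (ℕ.+-monoʳ-≤ _ (ℕ.n≤1+n _)))
... | yes _ | no _  | yes _ | ih = ≤-trans (s≤s ih) (≤-reflexive (sym (ℕ.+-suc _ _)))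
... | yes p | no nq | no nr | _ = [ (λ q → contradiction q nq) , (λ r → contradiction r nr) ]′ (f (here refl) p)

count-complement : {P : Pred A 0ℓ} (P? : Decidable P) → ∀ xs →
  length xs ≡ count P? xs + count (¬? ∘ P?) xs
count-complement P? [] = refl
count-complement P? (x ∷ xs) with P? x
... | yes _ = cong suc (count-complement P? xs)
... | no _  = trans (cong suc (count-complement P? xs)) (sym (ℕ.+-suc _ _))

sum-mono : (f g : A → ℕ) → ∀ xs → (∀ {x} → x ∈ xs → f x ≤ g x) → sum (map f xs) ≤ sum (map g xs)
sum-mono f g [] le = z≤n
sum-mono f g (x ∷ xs) le = ℕ.+-mono-≤ (le (here refl)) (sum-mono f g xs (le ∘ there))

sum-≤ : (f : A → ℕ) (c : ℕ) → ∀ xs → (∀ {x} → x ∈ xs → f x ≤ c) → sum (map f xs) ≤ length xs * c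
sum-≤ f c [] le = z≤n
sum-≤ f c (x ∷ xs) le = ℕ.+-mono-≤ (le (here refl)) (sum-≤ f c xs (le ∘ there))

sum-≥ : (f : A → ℕ) (c : ℕ) → ∀ xs → (∀ {x} → x ∈ xs → c ≤ f x) → length xs * c ≤ sum (map f xs)
sum-≥ f c [] le = z≤n
sum-≥ f c (x ∷ xs) le = ℕ.+-mono-≤ (le (here refl)) (sum-≥ f c xs (le ∘ there))

sum-+ : (f g : A → ℕ) → ∀ xs → sum (map (λ x → f x + g x) xs) ≡ sum (map f xs) + sum (map g xs)
sum-+ f g [] = refl
sum-+ f g (x ∷ xs) rewrite sum-+ f g xs = lemma (f x) (g x) (sum (map f xs)) (sum (map g xs))
  where
  lemma : ∀ a b c d → a + b + (c + d) ≡ a + c + (b + d)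
  lemma = solve-∀

sum-cong : (f g : A → ℕ) → ∀ xs → (∀ x → f x ≡ g x) → sum (map f xs) ≡ sum (map g xs)
sum-cong f g [] e = refl
sum-cong f g (x ∷ xs) e = cong₂ _+_ (e x) (sum-cong f g xs e)

length-concat : (xss : List (List A)) → length (concat xss) ≡ sum (map length xss)
length-concat [] = refl
length-concat (xs ∷ xss) = trans (length-++ xs) (cong (length xs +_) (length-concat xss))

module _ {P : A → B → Set} (P? : Decidable₂ P) where

  double-count : ∀ xs ys → sum (map (λ x → count (P? x) ys) xs) ≡ sum (map (λ y → count (λ x → P? x y) xs) ys)
  double-count [] ys = sym (ℕ.n≤0⇒n≡0 (≤-trans (sum-≤ (λ _ → 0) 0 ys (λ _ → z≤n)) (≤-reflexive (ℕ.*-zeroʳ (length ys)))))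
  double-count (x ∷ xs) ys = begin
    count (P? x) ys + sum (map (λ x → count (P? x) ys) xs)
      ≡⟨ cong₂ _+_ (row ys) (double-count xs ys) ⟩
    sum (map (λ y → count (λ x → P? x y) [ x ]) ys) + sum (map (λ y → count (λ x → P? x y) xs) ys)
      ≡⟨ sum-+ _ _ ys ⟨
    sum (map (λ y → count (λ x → P? x y) [ x ] + count (λ x → P? x y) xs) ys)
      ≡⟨ sum-cong _ _ ys (λ y → sym (count-∷ (λ x → P? x y) x xs)) ⟩
    sum (map (λ y → count (λ x → P? x y) (x ∷ xs)) ys) ∎
    where
    open ≡-Reasoning
    row : ∀ ys → count (P? x) ys ≡ sum (map (λ y → count (λ x → P? x y) [ x ]) ys)
    row [] = refl
    row (y ∷ ys) with P? x y
    ... | yes _ = cong suc (row ys)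
    ... | no _  = row ys

  count-any : ∀ xs ys → count (λ x → any? (P? x) ys) xs ≤ sum (map (λ y → count (λ x → P? x y) xs) ys)
  count-any xs ys = ≤-trans (go xs) (≤-reflexive (double-count xs ys))
    where
    go : ∀ xs → count (λ x → any? (P? x) ys) xs ≤ sum (map (λ x → count (P? x) ys) xs)
    go [] = z≤n
    go (x ∷ xs) with any? (P? x) ys
    ... | no _  = ≤-trans (go xs) (ℕ.m≤n+m _ _)
    ... | yes a = let _ , y∈ , py = find a in ℕ.+-mono-≤ (∈⇒count>0 (P? x) y∈ py) (go xs)

argmax : (f : A → ℕ) → ∀ x xs → ∃[ k ] (k ∈ x ∷ xs × (∀ {y} → y ∈ x ∷ xs → f y ≤ f k))
argmax f x [] = x , here refl , λ { (here refl) → ≤-refl }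
argmax f x (y ∷ xs) with argmax f y xs
... | k , k∈ , max with f k ≤? f x
... | yes le = x , here refl , λ { (here refl) → ≤-refl ; (there z∈) → ≤-trans (max z∈) le }
... | no nle = k , there k∈ , λ { (here refl) → ℕ.<⇒≤ (ℕ.≰⇒> nle) ; (there z∈) → max z∈ }

above-average : (f : A → ℕ) → ∀ xs → 0 < length xs → ∃[ k ] (k ∈ xs × sum (map f xs) ≤ length xs * f k)
above-average f (x ∷ xs) _ = let k , k∈ , max = argmax f x xs in k , k∈ , sum-≤ f (f k) (x ∷ xs) max

sum-fibres : (_≟_ : DecidableEquality B) (f : A → B) (ks : List B) (xs : List A) →
  (∀ {x} → x ∈ xs → f x ∈ ks) → length xs ≤ sum (map (λ k → count (λ x → f x ≟ k) xs) ks)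
sum-fibres _≟_ f ks xs into = begin
  length xs ≡⟨ ℕ.*-identityʳ _ ⟨
  length xs * 1 ≤⟨ sum-≥ _ 1 xs (λ x∈ → ∈⇒count>0 (λ k → f _ ≟ k) (into x∈) refl) ⟩
  sum (map (λ x → count (λ k → f x ≟ k) ks) xs) ≡⟨ double-count (λ x k → f x ≟ k) xs ks ⟩
  sum (map (λ k → count (λ x → f x ≟ k) xs) ks) ∎
  where open ≤-Reasoning

large-fibre : (_≟_ : DecidableEquality B) (f : A → B) (ks : List B) (xs : List A) →
  (∀ {x} → x ∈ xs → f x ∈ ks) → 0 < length ks →
  ∃[ k ] (length xs ≤ length ks * count (λ x → f x ≟ k) xs)
large-fibre _≟_ f ks xs into pos =
  let k , _ , le = above-average (λ k → count (λ x → f x ≟ k) xs) ks pos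
  in k , ≤-trans (sum-fibres _≟_ f ks xs into) le

length-cartesianProduct : (xs : List A) (ys : List B) → length (cartesianProduct xs ys) ≡ length xs * length ys
length-cartesianProduct [] ys = refl
length-cartesianProduct (x ∷ xs) ys = trans (length-++ (map (x ,_) ys)) (cong₂ _+_ (length-map (x ,_) ys) (length-cartesianProduct xs ys))

count≤1 : {P : Pred A 0ℓ} (P? : Decidable P) {xs : List A} → Unique xs →
  (∀ {x y} → x ∈ xs → y ∈ xs → P x → P y → x ≡ y) → count P? xs ≤ 1
count≤1 P? {xs} u same = short (Unique.filter⁺ P? u) (∈-filter⁻ P? {xs = xs})
  where
  short : ∀ {zs} → Unique zs → (∀ {z} → z ∈ zs → z ∈ xs × _) → length zs ≤ 1
  short [] _ = z≤n
  short (_ ∷ []) _ = s≤s z≤n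
  short ((x≢y ∷ _) ∷ (_ ∷ _)) from =
    let x∈ , px = from (here refl) ; y∈ , py = from (there (here refl)) in contradiction (same x∈ y∈ px py) x≢y

unique-map : (f : A → B) {xs : List A} → (∀ {x y} → x ∈ xs → y ∈ xs → f x ≡ f y → x ≡ y) → Unique xs → Unique (map f xs)
unique-map f inj [] = []
unique-map f inj (x∉ ∷ u) =
  All.map⁺ (All.tabulate λ y∈ e → All.lookup x∉ y∈ (inj (here refl) (there y∈) e)) ∷ unique-map f (λ x∈ y∈ → inj (there x∈) (there y∈)) u

-- Key sets

-- Bit vectors with at most `k` ones rather than exactly `k`: keys may repeat, and wheels differ in
-- length, so the number of keys of a family is only bounded.
subsets : ℕ → ℕ → List (List Bool)
subsets zero    k       = [ [] ]
subsets (suc N) zero    = map (false ∷_) (subsets N zero)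
subsets (suc N) (suc k) = map (true ∷_) (subsets N k) ++ map (false ∷_) (subsets N (suc k))

^-distribʳ-* : ∀ a b k → (a * b) ^ k ≡ a ^ k * b ^ k
^-distribʳ-* a b zero = refl
^-distribʳ-* a b (suc k) rewrite ^-distribʳ-* a b k = lemma a b (a ^ k) (b ^ k)
  where
  lemma : ∀ a b c d → a * b * (c * d) ≡ a * c * (b * d)
  lemma = solve-∀

-- The binomial theorem for (1 + 1/w)^N, cleared of denominators.
subsets-bound : ∀ w .{{_ : NonZero w}} N k → length (subsets N k) * w ^ N ≤ w ^ k * suc w ^ N
subsets-bound w zero k = ≤-trans (ℕ.m^n>0 w k) (≤-reflexive (sym (ℕ.*-identityʳ _)))
subsets-bound w (suc N) zero = begin
  length (map (false ∷_) (subsets N 0)) * (w * w ^ N) ≡⟨ cong (_* (w * w ^ N)) (length-map _ (subsets N 0)) ⟩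
  length (subsets N 0) * (w * w ^ N) ≡⟨ lemma (length (subsets N 0)) w (w ^ N) ⟩
  w * (length (subsets N 0) * w ^ N) ≤⟨ ℕ.*-mono-≤ (ℕ.n≤1+n w) (subsets-bound w N 0) ⟩
  suc w * (1 * suc w ^ N) ≡⟨ lemma' (suc w) (suc w ^ N) ⟩
  1 * (suc w * suc w ^ N) ∎
  where
  open ≤-Reasoning
  lemma : ∀ a b c → a * (b * c) ≡ b * (a * c)
  lemma = solve-∀
  lemma' : ∀ a b → a * (1 * b) ≡ 1 * (a * b)
  lemma' = solve-∀
subsets-bound w (suc N) (suc k) = begin
  length (map (true ∷_) (subsets N k) ++ map (false ∷_) (subsets N (suc k))) * (w * w ^ N)
    ≡⟨ cong (_* (w * w ^ N)) (trans (length-++ (map (true ∷_) (subsets N k))) (cong₂ _+_ (length-map _ (subsets N k)) (length-map _ (subsets N (suc k))))) ⟩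
  (length (subsets N k) + length (subsets N (suc k))) * (w * w ^ N)
    ≡⟨ lemma (length (subsets N k)) (length (subsets N (suc k))) w (w ^ N) ⟩
  w * (length (subsets N k) * w ^ N + length (subsets N (suc k)) * w ^ N)
    ≤⟨ ℕ.*-monoʳ-≤ w (ℕ.+-mono-≤ (subsets-bound w N k) (subsets-bound w N (suc k))) ⟩
  w * (w ^ k * suc w ^ N + w * w ^ k * suc w ^ N)
    ≡⟨ lemma' w (w ^ k) (suc w ^ N) ⟩
  w * w ^ k * (suc w * suc w ^ N) ∎
  where
  open ≤-Reasoning
  lemma : ∀ a b c d → (a + b) * (c * d) ≡ c * (a * d + b * d)
  lemma = solve-∀
  lemma' : ∀ a b c → a * (b * c + a * b * c) ≡ a * b * (suc a * c)
  lemma' = solve-∀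

-- Bernoulli's inequality (1 - 1/(x+1))^j ≥ 1 - j/(x+1) for x = j + d, cleared of denominators.
-- Using `d` as a parameter avoids truncated subtraction and serves the induction, which trades a
-- unit of `j` for a unit of `d`.
bernoulli : ∀ j d → suc (j + d) ^ j * suc d ≤ (j + d) ^ j * suc (j + d)
bernoulli zero d = ≤-refl
bernoulli (suc j) d = begin
  suc x * suc x ^ j * suc d ≡⟨ lemma (suc x) (suc x ^ j) (suc d) ⟩
  suc x ^ j * (suc x * suc d) ≤⟨ ℕ.*-monoʳ-≤ (suc x ^ j) step' ⟩
  suc x ^ j * (x * suc (suc d)) ≡⟨ lemma' (suc x ^ j) x (suc (suc d)) ⟩
  x * (suc x ^ j * suc (suc d)) ≤⟨ ℕ.*-monoʳ-≤ x (subst (λ y → suc y ^ j * suc (suc d) ≤ y ^ j * suc y) (ℕ.+-suc j d) (bernoulli j (suc d))) ⟩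
  x * (x ^ j * suc x) ≡⟨ ℕ.*-assoc x (x ^ j) (suc x) ⟨
  x * x ^ j * suc x ∎
  where
  open ≤-Reasoning
  x = suc j + d
  lemma : ∀ a b c → a * b * c ≡ b * (a * c)
  lemma = solve-∀
  lemma' : ∀ a b c → a * (b * c) ≡ b * (a * c)
  lemma' = solve-∀
  expand : ∀ j d → (suc j + d) * suc (suc d) ≡ suc (suc j + d) * suc d + j
  expand = solve-∀
  step' : suc x * suc d ≤ x * suc (suc d)
  step' = ≤-trans (ℕ.m≤m+n _ j) (≤-reflexive (sym (expand j d)))

-- The bound (1 + 1/w)^w ≤ 4. Bernoulli is too weak for the full exponent, but loses only a factor 2
-- on half of it; hence the even form of w.
suc-^-≤ : ∀ v → suc (v + v) ^ (v + v) ≤ 4 * (v + v) ^ (v + v)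
suc-^-≤ v = begin
  suc w ^ (v + v) ≡⟨ ℕ.^-distribˡ-+-* (suc w) v v ⟩
  suc w ^ v * suc w ^ v ≤⟨ ℕ.*-mono-≤ half half ⟩
  2 * w ^ v * (2 * w ^ v) ≡⟨ lemma (w ^ v) ⟩
  4 * (w ^ v * w ^ v) ≡⟨ cong (4 *_) (ℕ.^-distribˡ-+-* w v v) ⟨
  4 * w ^ (v + v) ∎
  where
  open ≤-Reasoning
  w = v + v
  lemma : ∀ a → 2 * a * (2 * a) ≡ 4 * (a * a)
  lemma = solve-∀
  lemma' : ∀ a v → a * suc (v + v) + a ≡ 2 * a * suc v
  lemma' = solve-∀
  half : suc w ^ v ≤ 2 * w ^ v
  half = ℕ.*-cancelʳ-≤ _ _ (suc v) (≤-trans (bernoulli v v) (≤-trans (ℕ.m≤m+n _ (w ^ v)) (≤-reflexive (lemma' (w ^ v) v))))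

-- The usual estimate (e N / k)^k for sets of size at most k, with 4 in place of e. Padding `N` up
-- to k w only weakens the factor (1 + 1/w)^N, which then is at most 4^k.
subsets-≤ : ∀ v N k → 0 < v → N ≤ k * (v + v) → length (subsets N k) ≤ (4 * (v + v)) ^ k
subsets-≤ v@(suc _) N k _ N≤ = ℕ.*-cancelʳ-≤ _ _ (w ^ (k * w)) {{ℕ.m^n≢0 w (k * w)}} (begin
  b * w ^ (k * w) ≡⟨ cong (λ z → b * w ^ z) (ℕ.m+[n∸m]≡n N≤) ⟨
  b * w ^ (N + (k * w ∸ N)) ≡⟨ cong (b *_) (ℕ.^-distribˡ-+-* w N _) ⟩
  b * (w ^ N * w ^ (k * w ∸ N)) ≡⟨ ℕ.*-assoc b (w ^ N) _ ⟨
  b * w ^ N * w ^ (k * w ∸ N) ≤⟨ ℕ.*-mono-≤ (subsets-bound w N k) (ℕ.^-monoˡ-≤ (k * w ∸ N) (ℕ.n≤1+n w)) ⟩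
  w ^ k * suc w ^ N * suc w ^ (k * w ∸ N) ≡⟨ ℕ.*-assoc (w ^ k) _ _ ⟩
  w ^ k * (suc w ^ N * suc w ^ (k * w ∸ N)) ≡⟨ cong (w ^ k *_) (ℕ.^-distribˡ-+-* (suc w) N _) ⟨
  w ^ k * suc w ^ (N + (k * w ∸ N)) ≡⟨ cong (λ z → w ^ k * suc w ^ z) (trans (ℕ.m+[n∸m]≡n N≤) (ℕ.*-comm k w)) ⟩
  w ^ k * suc w ^ (w * k) ≡⟨ cong (w ^ k *_) (ℕ.^-*-assoc (suc w) w k) ⟨
  w ^ k * (suc w ^ w) ^ k ≤⟨ ℕ.*-monoʳ-≤ (w ^ k) (ℕ.^-monoˡ-≤ k (suc-^-≤ v)) ⟩
  w ^ k * (4 * w ^ w) ^ k ≡⟨ cong (w ^ k *_) (^-distribʳ-* 4 (w ^ w) k) ⟩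
  w ^ k * (4 ^ k * (w ^ w) ^ k) ≡⟨ cong (λ z → w ^ k * (4 ^ k * z)) (trans (ℕ.^-*-assoc w w k) (cong (w ^_) (ℕ.*-comm w k))) ⟩
  w ^ k * (4 ^ k * w ^ (k * w)) ≡⟨ lemma (w ^ k) (4 ^ k) (w ^ (k * w)) ⟩
  4 ^ k * w ^ k * w ^ (k * w) ≡⟨ cong (_* w ^ (k * w)) (^-distribʳ-* 4 w k) ⟨
  (4 * w) ^ k * w ^ (k * w) ∎)
  where
  open ≤-Reasoning
  w = v + v
  b = length (subsets N k)
  lemma : ∀ a b c → a * (b * c) ≡ b * a * c
  lemma = solve-∀

module _ (_≟_ : DecidableEquality A) where

  open import Data.List.Membership.DecPropositional _≟_ using (_∈?_)

  indicator : List A → List A → List Bool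
  indicator U ks = map (λ u → does (u ∈? ks)) U

  indicator-∈ : ∀ {U} ks k → Unique U → length ks ≤ k → indicator U ks ∈ subsets (length U) k
  indicator-∈ {U} ks k u le = go U k (≤-trans (unique⇒length≤ (Unique.filter⁺ (_∈? ks) u) (proj₂ ∘ ∈-filter⁻ (_∈? ks) {xs = U})) le)
    where
    go : ∀ U k → count (_∈? ks) U ≤ k → indicator U ks ∈ subsets (length U) k
    go [] k le = here refl
    go (x ∷ U) k le with x ∈? ks
    go (x ∷ U) (suc k) (s≤s le) | yes _ = ∈-++⁺ˡ (∈-map⁺ _ (go U k le))
    go (x ∷ U) zero le | no _ = ∈-map⁺ _ (go U zero le)
    go (x ∷ U) (suc k) le | no _ = ∈-++⁺ʳ (map (true ∷_) (subsets (length U) k)) (∈-map⁺ _ (go U (suc k) le))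

  indicator-≡ : ∀ U {ks ks'} → indicator U ks ≡ indicator U ks' → ∀ {x} → x ∈ U → x ∈ ks → x ∈ ks'
  indicator-≡ (u ∷ U) {ks} {ks'} eq (here refl) x∈ with u ∈? ks | u ∈? ks'
  ... | _      | yes y = y
  ... | no nx  | no _ = contradiction x∈ nx
  ... | yes _  | no _ = case proj₁ (∷-injective eq) of λ ()
  indicator-≡ (u ∷ U) eq (there x∈U) = indicator-≡ U (proj₂ (∷-injective eq)) x∈U

-- Families of pairwise compatible blocks

module _ {_#_ : Rel B 0ℓ} (_#?_ : Decidable₂ _#_) where

  -- Each step branches over the first w blocks and then discards all of them,
  -- so that families that part ways at this step stay different.
  families : ℕ → ℕ → List B → List (List B)
  families w zero    L = [ [] ]
  families w (suc j) L = concatMap (λ b → map (b ∷_) (families w j (filter (λ c → ¬? (b #? c)) (drop w L)))) (take w L)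

  remaining : ℕ → B → List B → List B
  remaining w b L = filter (λ c → ¬? (b #? c)) (drop w L)

  remaining-⊑ : ∀ w b L → remaining w b L ⊑ L
  remaining-⊑ w b L = ⊑-trans (Sublist.filter-⊆ _ (drop w L)) (Sublist.drop-⊆ w L)

  families-∈ : ∀ w j L {M} → M ∈ families w (suc j) L →
    ∃[ b ] ∃[ M' ] (b ∈ take w L × M' ∈ families w j (remaining w b L) × M ≡ b ∷ M')
  families-∈ w j L M∈ =
    let b , b∈ , M∈' = find (∈-concatMap⁻ _ {xs = take w L} M∈)
        M' , M'∈ , eq = ∈-map⁻ (b ∷_) M∈'
    in b , M' , b∈ , M'∈ , eq

  families-length : ∀ w j L {M} → M ∈ families w j L → length M ≡ j
  families-length w zero L (here refl) = refl
  families-length w (suc j) L M∈ with families-∈ w j L M∈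
  ... | b , M' , _ , M'∈ , refl = cong suc (families-length w j _ M'∈)

  families-⊆ : ∀ w j L {M} → M ∈ families w j L → All (_∈ L) M
  families-⊆ w zero L (here refl) = []
  families-⊆ w (suc j) L M∈ with families-∈ w j L M∈
  ... | b , M' , b∈ , M'∈ , refl =
    Sublist.lookup (Sublist.take-⊆ w L) b∈ ∷ All.map (Sublist.lookup (remaining-⊑ w b L)) (families-⊆ w j _ M'∈)

  families-compatible : ∀ w j L {M} → M ∈ families w j L → AllPairs (λ b c → ¬ b # c) M
  families-compatible w zero L (here refl) = []
  families-compatible w (suc j) L M∈ with families-∈ w j L M∈
  ... | b , M' , b∈ , M'∈ , refl =
    All.map (λ c∈ → proj₂ (∈-filter⁻ (λ c → ¬? (b #? c)) {xs = drop w L} c∈)) (families-⊆ w j _ M'∈) ∷ families-compatible w j _ M'∈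

  take-drop-disjoint : ∀ w {L : List B} → Unique L → ∀ {b} → b ∈ take w L → b ∉ drop w L
  take-drop-disjoint (suc w) (b∉ ∷ u) (here refl) b∈ = All.lookup b∉ (Sublist.lookup (Sublist.drop-⊆ w _) b∈) refl
  take-drop-disjoint (suc w) (_ ∷ u) (there b∈) = take-drop-disjoint w u b∈

  -- Inequality as lists would not suffice: the symmetric difference of two families is non-empty
  -- only if some block of one is missing from the other.
  families-distinct : ∀ w j {L} → Unique L → AllPairs (λ M M' → ∃[ b ] (b ∈ L × b ∈ M × b ∉ M')) (families w j L)
  families-distinct w zero u = [] ∷ []
  families-distinct w (suc j) {L} u = AllPairs.concat⁺ (All.map⁺ (All.tabulate same)) (AllPairs.map⁺ (pairs (take w L) (Unique.take⁺ w u) id))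
    where
    later : ∀ {b c} → b ∈ take w L → ∀ {M} → M ∈ families w j (remaining w c L) → b ∉ M
    later b∈ M∈ b∈M = take-drop-disjoint w u b∈
      (Sublist.lookup (Sublist.filter-⊆ _ (drop w L)) (All.lookup (families-⊆ w j _ M∈) b∈M))
    same : ∀ {b} → b ∈ take w L → AllPairs (λ M M' → ∃[ b ] (b ∈ L × b ∈ M × b ∉ M')) (map (b ∷_) (families w j (remaining w b L)))
    same {b} b∈ = AllPairs.map⁺ (AllPairs.map
      (λ { (c , c∈L , c∈M , c∉M') → c , Sublist.lookup (remaining-⊑ w b L) c∈L , there c∈M ,
           λ { (here refl) → take-drop-disjoint w u b∈ (Sublist.lookup (Sublist.filter-⊆ _ (drop w L)) c∈L)
             ; (there c∈M') → c∉M' c∈M' } })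
      (families-distinct w j (Unique.filter⁺ _ (Unique.drop⁺ w u))))
    pairs : ∀ bs → Unique bs → (∀ {b} → b ∈ bs → b ∈ take w L) →
      AllPairs (λ b b' → All (λ M → All (λ M' → ∃[ b ] (b ∈ L × b ∈ M × b ∉ M')) (map (b' ∷_) (families w j (remaining w b' L)))) (map (b ∷_) (families w j (remaining w b L)))) bs
    pairs [] _ _ = []
    pairs (b ∷ bs) (b∉ ∷ ubs) sub = All.tabulate (λ {b'} b'∈ →
        All.map⁺ (All.tabulate (λ {M} M∈ → All.map⁺ (All.tabulate (λ {M'} M'∈ →
          b , Sublist.lookup (Sublist.take-⊆ w L) (sub (here refl)) , here refl ,
          λ { (here refl) → All.lookup b∉ b'∈ refl
            ; (there b∈M') → later (sub (here refl)) M'∈ b∈M' })))))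
      ∷ pairs bs ubs (sub ∘ there)

  -- A step removes `w` blocks by dropping and at most `Q` by conflicts, so while `j` steps remain,
  -- at least j (w + Q) blocks are left and all `w` branches exist.
  families-count : ∀ w Q j L → (∀ {b} → b ∈ L → count (b #?_) L ≤ Q) → j * (w + Q) ≤ length L →
    w ^ j ≤ length (families w j L)
  families-count w Q zero L _ _ = ≤-refl
  families-count w Q (suc j) L deg le = begin
    w * w ^ j ≡⟨ cong (_* w ^ j) lt ⟨
    length (take w L) * w ^ j ≤⟨ sum-≥ (λ b → length (branch b)) (w ^ j) (take w L) each ⟩
    sum (map (λ b → length (branch b)) (take w L)) ≡⟨ cong sum (map-∘ {g = length} {f = branch} (take w L)) ⟩
    sum (map length (map branch (take w L))) ≡⟨ length-concat (map branch (take w L)) ⟨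
    length (families w (suc j) L) ∎
    where
    open ≤-Reasoning
    branch = λ b → map (b ∷_) (families w j (remaining w b L))
    lt : length (take w L) ≡ w
    lt = trans (length-take w L) (ℕ.m≤n⇒m⊓n≡m (≤-trans (ℕ.m≤m+n w (Q + j * (w + Q))) (≤-trans (≤-reflexive (sym (ℕ.+-assoc w Q _))) le)))
    each : ∀ {b} → b ∈ take w L → w ^ j ≤ length (branch b)
    each {b} b∈ = ≤-trans (families-count w Q j (remaining w b L)
        (λ c∈ → ≤-trans (count-⊑ _ (remaining-⊑ w b L)) (deg (Sublist.lookup (remaining-⊑ w b L) c∈))) size)
      (≤-reflexive (sym (length-map _ (families w j (remaining w b L)))))
      where
      kept = length (remaining w b L)
      size : j * (w + Q) ≤ kept
      size = ℕ.+-cancelˡ-≤ (w + Q) _ _ (begin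
        w + Q + j * (w + Q) ≤⟨ le ⟩
        length L ≤⟨ ℕ.m≤n+m∸n (length L) w ⟩
        w + (length L ∸ w) ≡⟨ cong (w +_) (length-drop w L) ⟨
        w + length (drop w L) ≡⟨ cong (w +_) (count-complement (b #?_) (drop w L)) ⟩
        w + (count (b #?_) (drop w L) + kept) ≤⟨ ℕ.+-monoʳ-≤ w (ℕ.+-monoˡ-≤ kept (≤-trans (count-⊑ (b #?_) (Sublist.drop-⊆ w L)) (deg (Sublist.lookup (Sublist.take-⊆ w L) b∈)))) ⟩
        w + (Q + kept) ≡⟨ ℕ.+-assoc w Q kept ⟨
        w + Q + kept ∎)

  equal-codes : ∀ w Q m {L} → Unique L → (∀ {b} → b ∈ L → count (b #?_) L ≤ Q) → m * (w + Q) ≤ length L →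
    (code : List B → C) (codes : List C) → (∀ {M} → length M ≡ m → All (_∈ L) M → code M ∈ codes) →
    length codes < w ^ m →
    ∃[ M ] ∃[ M' ] (All (_∈ L) M × All (_∈ L) M' × AllPairs (λ b c → ¬ b # c) M × AllPairs (λ b c → ¬ b # c) M' ×
                    code M ≡ code M' × ∃[ b ] (b ∈ M × b ∉ M'))
  equal-codes w Q m {L} u deg size code codes into few =
    let M , M' , M∈ , M'∈ , (b , _ , b∈M , b∉M') , eq = pigeonhole code (families-distinct w m u)
          (λ M∈ → into (families-length w m L M∈) (families-⊆ w m L M∈))
          (≤-trans few (families-count w Q m L deg size))
    in M , M' , families-⊆ w m L M∈ , families-⊆ w m L M'∈ , families-compatible w m L M∈ ,
       families-compatible w m L M'∈ , eq , b , b∈M , b∉M'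

-- Closed families of triples

Distinct : Triple n → Set
Distinct (a , b , c) = a ≢ b × b ≢ c × a ≢ c

_∈₃?_ : (v : Fin n) (t : Triple n) → Dec (v ∈₃ t)
v ∈₃? (a , b , c) = v F.≟ a ⊎-dec (v F.≟ b ⊎-dec v F.≟ c)

_≟₃_ : DecidableEquality (Triple n)
_≟₃_ = Product.≡-dec F._≟_ (Product.≡-dec F._≟_ F._≟_)

sameSet-refl : (t : Triple n) → SameSet t t
sameSet-refl t v = id , id

sameSet-sym : (t t' : Triple n) → SameSet t t' → SameSet t' t
sameSet-sym t t' s v = proj₂ (s v) , proj₁ (s v)

sameSet-trans : (t t' t'' : Triple n) → SameSet t t' → SameSet t' t'' → SameSet t t''
sameSet-trans t t' t'' s s' v = proj₁ (s' v) ∘ proj₁ (s v) , proj₂ (s v) ∘ proj₂ (s' v)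

-- Sorted representatives of three-element sets

insert₂ : Fin n → Fin n × Fin n → Triple n
insert₂ a (b , c) with a F.≤? b | a F.≤? c
... | yes _ | _     = a , b , c
... | no _  | yes _ = b , a , c
... | no _  | no _  = b , c , a

sort₂ : Fin n → Fin n → Fin n × Fin n
sort₂ b c with b F.≤? c
... | yes _ = b , c
... | no _  = c , b

sort₃ : Triple n → Triple n
sort₃ (a , b , c) = insert₂ a (sort₂ b c)

sort₃-sorted : (t : Triple n) → Distinct t → Sorted (sort₃ t)
sort₃-sorted (a , b , c) (a≢b , b≢c , a≢c) with b F.≤? c
sort₃-sorted (a , b , c) (a≢b , b≢c , a≢c) | yes b≤c with a F.≤? b | a F.≤? c
... | yes a≤b | _       = F.≤∧≢⇒< a≤b a≢b , F.≤∧≢⇒< b≤c b≢c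
... | no a≰b  | yes a≤c = ℕ.≰⇒> a≰b , F.≤∧≢⇒< a≤c a≢c
... | no _    | no a≰c  = F.≤∧≢⇒< b≤c b≢c , ℕ.≰⇒> a≰c
sort₃-sorted (a , b , c) (a≢b , b≢c , a≢c) | no b≰c with a F.≤? c | a F.≤? b
... | yes a≤c | _       = F.≤∧≢⇒< a≤c a≢c , ℕ.≰⇒> b≰c
... | no a≰c  | yes a≤b = ℕ.≰⇒> a≰c , F.≤∧≢⇒< a≤b a≢b
... | no _    | no a≰b  = ℕ.≰⇒> b≰c , ℕ.≰⇒> a≰b

module _ {v a b c : Fin n} where
  swap₂₃ : v ∈₃ (a , b , c) → v ∈₃ (a , c , b)
  swap₂₃ (inj₁ e) = inj₁ e
  swap₂₃ (inj₂ (inj₁ e)) = inj₂ (inj₂ e)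
  swap₂₃ (inj₂ (inj₂ e)) = inj₂ (inj₁ e)

  swap₁₂ : v ∈₃ (a , b , c) → v ∈₃ (b , a , c)
  swap₁₂ (inj₁ e) = inj₂ (inj₁ e)
  swap₁₂ (inj₂ (inj₁ e)) = inj₁ e
  swap₁₂ (inj₂ (inj₂ e)) = inj₂ (inj₂ e)

sort₃-sameSet : (t : Triple n) → SameSet (sort₃ t) t
sort₃-sameSet (a , b , c) v with b F.≤? c
sort₃-sameSet (a , b , c) v | yes b≤c with a F.≤? b | a F.≤? c
... | yes a≤b | _       = id , id
... | no a≰b  | yes a≤c = swap₁₂ , swap₁₂
... | no _    | no a≰c  = swap₁₂ ∘ swap₂₃ , swap₂₃ ∘ swap₁₂
sort₃-sameSet (a , b , c) v | no b≰c with a F.≤? c | a F.≤? b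
... | yes a≤c | _       = swap₂₃ , swap₂₃
... | no a≰c  | yes a≤b = swap₂₃ ∘ swap₁₂ , swap₁₂ ∘ swap₂₃
... | no _    | no a≰b  = swap₂₃ ∘ swap₁₂ ∘ swap₂₃ , swap₂₃ ∘ swap₁₂ ∘ swap₂₃

-- Triples are ordered here, so listing one 3-set in two orders has to be excluded by `sameSet`.
-- Nothing is asked of links: they are unions of cycles, and the splitting below separates these.
record Closed (F : List (Triple n)) : Set where
  field
    distinct : ∀ {t} → t ∈ F → Distinct t
    sameSet  : ∀ {t t'} → t ∈ F → t' ∈ F → SameSet t t' → t ≡ t'
    mate     : ∀ {t u v} → t ∈ F → u ≢ v → u ∈₃ t → v ∈₃ t →
               ∃[ t' ] (t' ∈ F × t' ≢ t × u ∈₃ t' × v ∈₃ t' ×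
                 (∀ {s} → s ∈ F → u ∈₃ s → v ∈₃ s → s ≡ t ⊎ s ≡ t'))

-- Union-find: each generating pair redirects the class of `x` to the representative of `y`. Labels
-- are themselves elements, so the chain from an element to its label certifies connectivity and no
-- search for chains is needed.
components : {A : Set} → DecidableEquality A → {S : Rel A 0ℓ} → Symmetric S → (gs : List (A × A)) →
  (∀ {x y} → (x , y) ∈ gs → S x y) →
  Σ (A → A) λ f → ((∀ x → Star S x (f x)) × (∀ {x y} → (x , y) ∈ gs → f x ≡ f y))
components _≟_ sym-S [] gen = id , (λ _ → ε) , λ ()
components {A} _≟_ {S} sym-S ((x , y) ∷ gs) gen with components _≟_ sym-S gs (gen ∘ there)
... | f , conn , eq = g , g-conn , λ { (here refl) → g-xy ; (there p) → g-cong (eq p) }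
  where
  g : A → A
  g z = if does (f z ≟ f x) then f y else f z
  g-conn : ∀ z → Star S z (g z)
  g-conn z with f z ≟ f x
  ... | yes e = conn z ◅◅ subst (λ w → Star S w x) (sym e) (Star.reverse sym-S (conn x)) ◅◅ (gen (here refl) ◅ conn y)
  ... | no _  = conn z
  g-xy : g x ≡ g y
  g-xy with f x ≟ f x | f y ≟ f x
  ... | yes _ | yes _ = refl
  ... | yes _ | no _  = refl
  ... | no ne | _     = contradiction refl ne
  g-cong : ∀ {z w} → f z ≡ f w → g z ≡ g w
  g-cong {z} {w} e with f z ≟ f x | f w ≟ f x
  ... | yes _ | yes _ = refl
  ... | yes p | no q = contradiction (trans (sym e) p) q
  ... | no p | yes q = contradiction (trans e q) p
  ... | no _ | no _ = e

Within : Rel A 0ℓ → List A → Rel A 0ℓ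
Within R xs x y = R x y × x ∈ xs × y ∈ xs

components-within : {A : Set} → DecidableEquality A → {R : Rel A 0ℓ} → Decidable₂ R → Symmetric R → (xs : List A) →
  Σ (A → A) λ f → ((∀ x → Star (Within R xs) x (f x)) × (∀ {x y} → Within R xs x y → f x ≡ f y))
components-within {A} _≟_ {R} R? sym-R xs =
  let f , conn , eq = components _≟_ (λ { (r , x∈ , y∈) → sym-R r , y∈ , x∈ }) gs gen
  in f , conn , λ { (r , x∈ , y∈) → eq (∈-filter⁺ R?' (∈-cartesianProduct⁺ x∈ y∈) r) }
  where
  R?' : Decidable (λ (xy : A × A) → R (proj₁ xy) (proj₂ xy))
  R?' (x , y) = R? x y
  gs = filter R?' (cartesianProduct xs xs)
  gen : ∀ {x y} → (x , y) ∈ gs → Within R xs x y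
  gen p = let q , r = ∈-filter⁻ R?' {xs = cartesianProduct xs xs} p
              x∈ , y∈ = ∈-cartesianProduct⁻ xs xs q
          in r , x∈ , y∈

Adjacent : Rel (Triple n) 0ℓ
Adjacent {n} t t' = ∃[ u ] ∃[ v ] (u ≢ v × (u ∈₃ t × v ∈₃ t) × (u ∈₃ t' × v ∈₃ t'))

adjacent? : Decidable₂ (Adjacent {n})
adjacent? t t' = F.any? λ u → F.any? λ v → ¬? (u F.≟ v) ×-dec ((u ∈₃? t ×-dec v ∈₃? t) ×-dec (u ∈₃? t' ×-dec v ∈₃? t'))

adjacent-sym : Symmetric (Adjacent {n})
adjacent-sym (u , v , ne , p , q) = u , v , ne , q , p

-- Mates share a pair and are therefore adjacent, so they carry the same label; this is why a
-- component inherits closedness.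
connected-component : {F : List (Triple n)} {t₀ : Triple n} → Closed F → t₀ ∈ F →
  ∃[ F' ] (Closed F' × t₀ ∈ F' × (∀ {t} → t ∈ F' → t ∈ F) ×
    (∀ {t t'} → t ∈ F' → t' ∈ F' → Star (Within Adjacent F') t t'))
connected-component {F = F} {t₀} closed t₀∈ =
  F' , record { distinct = distinct ∘ F'⊆F ; sameSet = λ p q → sameSet (F'⊆F p) (F'⊆F q) ; mate = mate' }
     , F'-in t₀∈ refl , F'⊆F , conn'
  where
  open Closed closed
  cs = components-within _≟₃_ adjacent? adjacent-sym F
  f = proj₁ cs
  conn = proj₁ (proj₂ cs)
  f-eq = proj₂ (proj₂ cs)
  P? = λ t → f t ≟₃ f t₀
  F' = filter P? F
  F'⊆F : ∀ {t} → t ∈ F' → t ∈ F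
  F'⊆F t∈ = proj₁ (∈-filter⁻ P? {xs = F} t∈)
  label : ∀ {t} → t ∈ F' → f t ≡ f t₀
  label t∈ = proj₂ (∈-filter⁻ P? {xs = F} t∈)
  F'-in : ∀ {t} → t ∈ F → f t ≡ f t₀ → t ∈ F'
  F'-in t∈ e = ∈-filter⁺ P? t∈ e
  mate' : ∀ {t u v} → t ∈ F' → u ≢ v → u ∈₃ t → v ∈₃ t →
    ∃[ t' ] (t' ∈ F' × t' ≢ t × u ∈₃ t' × v ∈₃ t' × (∀ {s} → s ∈ F' → u ∈₃ s → v ∈₃ s → s ≡ t ⊎ s ≡ t'))
  mate' {u = u} {v} t∈ ne u∈ v∈ with mate (F'⊆F t∈) ne u∈ v∈
  ... | t' , t'∈ , ne' , u∈' , v∈' , only =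
    t' , F'-in t'∈ (trans (f-eq ((u , v , ne , (u∈' , v∈') , (u∈ , v∈)) , t'∈ , F'⊆F t∈)) (label t∈)) ,
    ne' , u∈' , v∈' , λ s∈ → only (F'⊆F s∈)
  restrict : ∀ {t t'} → t ∈ F' → Star (Within Adjacent F) t t' → Star (Within Adjacent F') t t'
  restrict t∈ ε = ε
  restrict t∈ ((a , p , q) ◅ path) =
    let s∈ = F'-in q (trans (sym (f-eq (a , p , q))) (label t∈)) in (a , t∈ , s∈) ◅ restrict s∈ path
  conn' : ∀ {t t'} → t ∈ F' → t' ∈ F' → Star (Within Adjacent F') t t'
  conn' {t} {t'} t∈ t'∈ = restrict t∈ (conn t ◅◅ subst (λ z → Star _ z t') (trans (label t'∈) (sym (label t∈)))
    (Star.reverse (λ { (a , p , q) → adjacent-sym a , q , p }) (conn t')))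

-- Splitting vertices along their links

Corner : ℕ → Set
Corner n = Triple n × Fin n

corners : List (Triple n) → List (Corner n)
corners = concatMap λ { t@(a , b , c) → (t , a) ∷ (t , b) ∷ (t , c) ∷ [] }

∈-corners⁺ : {F : List (Triple n)} {t : Triple n} {v : Fin n} → t ∈ F → v ∈₃ t → (t , v) ∈ corners F
∈-corners⁺ t∈ v∈ = ∈-concatMap⁺ _ (lose t∈ (corner v∈))
  where
  corner : ∀ {t v} → v ∈₃ t → (t , v) ∈ (t , proj₁ t) ∷ (t , proj₁ (proj₂ t)) ∷ (t , proj₂ (proj₂ t)) ∷ []
  corner (inj₁ refl) = here refl
  corner (inj₂ (inj₁ refl)) = there (here refl)
  corner (inj₂ (inj₂ refl)) = there (there (here refl))

∈-corners⁻ : {F : List (Triple n)} {t : Triple n} {v : Fin n} → (t , v) ∈ corners F → t ∈ F × v ∈₃ t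
∈-corners⁻ {F = F} tv∈ with find (∈-concatMap⁻ _ {xs = F} tv∈)
... | t , t∈ , here refl = t∈ , inj₁ refl
... | t , t∈ , there (here refl) = t∈ , inj₂ (inj₁ refl)
... | t , t∈ , there (there (here refl)) = t∈ , inj₂ (inj₂ refl)

-- A corner at `p` is an edge of the link of `p`, and two of them are related when they share the
-- link vertex `z`. The classes at `p` are thus the components of its link.
Turn : Rel (Corner n) 0ℓ
Turn (t , p) (t' , p') = p ≡ p' × ∃[ z ] (z ≢ p × (p ∈₃ t × z ∈₃ t) × (p ∈₃ t' × z ∈₃ t'))

turn? : Decidable₂ (Turn {n})
turn? (t , p) (t' , p') = p F.≟ p' ×-dec F.any? λ z → ¬? (z F.≟ p) ×-dec ((p ∈₃? t ×-dec z ∈₃? t) ×-dec (p ∈₃? t' ×-dec z ∈₃? t'))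

turn-sym : Symmetric (Turn {n})
turn-sym (refl , z , ne , p , q) = refl , z , ne , q , p

lookup-injective : {xs : List A} → Unique xs → ∀ i j → lookup xs i ≡ lookup xs j → i ≡ j
lookup-injective (_ ∷ _) F.zero F.zero _ = refl
lookup-injective (x∉ ∷ _) F.zero (F.suc j) e = contradiction e (All.lookup x∉ (∈-lookup j))
lookup-injective (x∉ ∷ _) (F.suc i) F.zero e = contradiction (sym e) (All.lookup x∉ (∈-lookup i))
lookup-injective (_ ∷ u) (F.suc i) (F.suc j) e = cong F.suc (lookup-injective u i j e)

-- Splits every vertex p into the components of its link: κ t p is the copy of p
-- that the triple t is attached to.
record Splitting (F : List (Triple n)) : Set where
  field
    m        : ℕ
    κ        : Triple n → Fin n → Fin m
    φ        : Fin m → Fin n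
    φ-κ      : ∀ {t v} → t ∈ F → v ∈₃ t → φ (κ t v) ≡ v
    κ-turn   : ∀ {t t' v} → Within Turn (corners F) (t , v) (t' , v) → κ t v ≡ κ t' v
    κ-conn   : ∀ {t t' v} → t ∈ F → t' ∈ F → v ∈₃ t → v ∈₃ t' → κ t v ≡ κ t' v →
               Star (Within Turn (corners F)) (t , v) (t' , v)
    κ-onto   : ∀ i → ∃[ t ] ∃[ v ] (t ∈ F × v ∈₃ t × i ≡ κ t v)

splitting : {F : List (Triple n)} {t₀ : Triple n} → t₀ ∈ F → Splitting F
splitting {n} {F} {t₀} t₀∈ = record
  { m = length vs ; κ = κ ; φ = φ ; φ-κ = φ-κ ; κ-turn = κ-turn ; κ-conn = κ-conn ; κ-onto = κ-onto }
  where
  _≟c_ : DecidableEquality (Corner n)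
  _≟c_ = Product.≡-dec _≟₃_ F._≟_
  open import Data.List.Membership.DecPropositional _≟c_ using (_∈?_)
  cs = components-within _≟c_ turn? turn-sym (corners F)
  f = proj₁ cs
  conn = proj₁ (proj₂ cs)
  f-eq = proj₂ (proj₂ cs)
  vs = deduplicate _≟c_ (map f (corners F))
  vs! : Unique vs
  vs! = DecUnique.deduplicate-! _≟c_ (map f (corners F))
  f∈vs : ∀ {t v} → t ∈ F → v ∈₃ t → f (t , v) ∈ vs
  f∈vs t∈ v∈ = ∈-deduplicate⁺ _≟c_ (∈-map⁺ f (∈-corners⁺ t∈ v∈))
  position : Corner n → Fin (length vs)
  position x with x ∈? vs
  ... | yes p = index p
  -- A default for corners outside `vs`, never met by labels of corners of `F`; `t₀` is there to
  -- make the index type inhabited.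
  ... | no _  = index (f∈vs t₀∈ (inj₁ refl))
  lookup-position : ∀ {x} → x ∈ vs → lookup vs (position x) ≡ x
  lookup-position {x} p with x ∈? vs
  ... | yes q = sym (lookup-index q)
  ... | no np = contradiction p np
  κ : Triple n → Fin n → Fin (length vs)
  κ t v = position (f (t , v))
  -- Turning keeps the vertex, so the representative corner of a copy still shows which vertex was
  -- split.
  φ : Fin (length vs) → Fin n
  φ i = proj₂ (lookup vs i)
  star-vertex : ∀ {x y} → Star (Within Turn (corners F)) x y → proj₂ x ≡ proj₂ y
  star-vertex ε = refl
  star-vertex (((refl , _) , _) ◅ s) = star-vertex s
  φ-κ : ∀ {t v} → t ∈ F → v ∈₃ t → φ (κ t v) ≡ v
  φ-κ t∈ v∈ = trans (cong proj₂ (lookup-position (f∈vs t∈ v∈))) (sym (star-vertex (conn _)))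
  κ-turn : ∀ {t t' v} → Within Turn (corners F) (t , v) (t' , v) → κ t v ≡ κ t' v
  κ-turn r = cong position (f-eq r)
  κ-conn : ∀ {t t' v} → t ∈ F → t' ∈ F → v ∈₃ t → v ∈₃ t' → κ t v ≡ κ t' v →
    Star (Within Turn (corners F)) (t , v) (t' , v)
  κ-conn {t} {t'} {v} t∈ t'∈ v∈ v∈' e = conn (t , v) ◅◅ subst (λ z → Star _ z (t' , v))
    (trans (sym (lookup-position (f∈vs t'∈ v∈'))) (trans (cong (lookup vs) (sym e)) (lookup-position (f∈vs t∈ v∈))))
    (Star.reverse (λ { (a , p , q) → turn-sym a , q , p }) (conn (t' , v)))
  κ-onto : ∀ i → ∃[ t ] ∃[ v ] (t ∈ F × v ∈₃ t × i ≡ κ t v)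
  κ-onto i with ∈-map⁻ f (∈-deduplicate⁻ _≟c_ (map f (corners F)) (∈-lookup {xs = vs} i))
  ... | (t , v) , tv∈ , e = let t∈ , v∈ = ∈-corners⁻ tv∈ in
    t , v , t∈ , v∈ , lookup-injective vs! _ _ (trans e (sym (lookup-position (f∈vs t∈ v∈))))

-- The closed surface and its immersion

module Surface {G : TripleSystem n} {F : List (Triple n)} {t₀ : Triple n} (closed : Closed F) (t₀∈ : t₀ ∈ F)
  (split : Splitting F)
  (linked : ∀ {t t'} → t ∈ F → t' ∈ F → Star (Within Adjacent F) t t')
  (in-G : ∀ {t} → t ∈ F → ∃[ f ] (f ∈ triples G × SameSet t f)) where

  open Closed closed
  open Splitting split

  lift : Triple n → Triple m
  lift t@(a , b , c) = sort₃ (κ t a , κ t b , κ t c)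

  lift⁺ : ∀ {t v} → v ∈₃ t → κ t v ∈₃ lift t
  lift⁺ {t@(a , b , c)} v∈ = proj₂ (sort₃-sameSet (κ t a , κ t b , κ t c) _) (image v∈)
    where
    image : ∀ {v} → v ∈₃ t → κ t v ∈₃ (κ t a , κ t b , κ t c)
    image (inj₁ refl) = inj₁ refl
    image (inj₂ (inj₁ refl)) = inj₂ (inj₁ refl)
    image (inj₂ (inj₂ refl)) = inj₂ (inj₂ refl)

  lift⁻ : ∀ {t x} → x ∈₃ lift t → ∃[ v ] (v ∈₃ t × x ≡ κ t v)
  lift⁻ {t@(a , b , c)} x∈ with proj₁ (sort₃-sameSet (κ t a , κ t b , κ t c) _) x∈
  ... | inj₁ e = a , inj₁ refl , e
  ... | inj₂ (inj₁ e) = b , inj₂ (inj₁ refl) , e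
  ... | inj₂ (inj₂ e) = c , inj₂ (inj₂ refl) , e

  κ-injective : ∀ {t t' u v} → t ∈ F → t' ∈ F → u ∈₃ t → v ∈₃ t' → κ t u ≡ κ t' v → u ≡ v
  κ-injective t∈ t'∈ u∈ v∈ e = trans (sym (φ-κ t∈ u∈)) (trans (cong φ e) (φ-κ t'∈ v∈))

  -- Triples through `u` and `v` turn into one another around `u`. So splitting separates vertices
  -- but never edges: a pair of vertices has a single lift, which gives both the two faces at every
  -- edge and injectivity on 1-faces.
  κ-shared : ∀ {t t' u v} → t ∈ F → t' ∈ F → u ≢ v → u ∈₃ t → v ∈₃ t → u ∈₃ t' → v ∈₃ t' → κ t u ≡ κ t' u
  κ-shared {v = v} t∈ t'∈ ne u∈ v∈ u∈' v∈' =
    κ-turn ((refl , v , ≢-sym ne , (u∈ , v∈) , (u∈' , v∈')) , ∈-corners⁺ t∈ u∈ , ∈-corners⁺ t'∈ u∈')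

  lift-sorted : ∀ {t} → t ∈ F → Sorted (lift t)
  lift-sorted {t@(a , b , c)} t∈ = let a≢b , b≢c , a≢c = distinct t∈ in
    sort₃-sorted (κ t a , κ t b , κ t c)
      ( a≢b ∘ κ-injective t∈ t∈ (inj₁ refl) (inj₂ (inj₁ refl))
      , b≢c ∘ κ-injective t∈ t∈ (inj₂ (inj₁ refl)) (inj₂ (inj₂ refl))
      , a≢c ∘ κ-injective t∈ t∈ (inj₁ refl) (inj₂ (inj₂ refl)))

  H : TripleSystem m
  H = record
    { triples = deduplicate _≟₃_ (map lift F)
    ; sorted  = All.tabulate λ x∈ → let t , t∈ , e = ∈-map⁻ lift (∈-deduplicate⁻ _≟₃_ (map lift F) x∈)
                                     in subst Sorted (sym e) (lift-sorted t∈)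
    ; unique  = DecUnique.deduplicate-! _≟₃_ (map lift F)
    }

  H⁺ : ∀ {t} → t ∈ F → lift t ∈ triples H
  H⁺ t∈ = ∈-deduplicate⁺ _≟₃_ (∈-map⁺ lift t∈)

  H⁻ : ∀ {x} → x ∈ triples H → ∃[ t ] (t ∈ F × x ≡ lift t)
  H⁻ x∈ = ∈-map⁻ lift (∈-deduplicate⁻ _≟₃_ (map lift F) x∈)

  φ-lift : ∀ {t} → t ∈ F → SameSet (mapT φ (lift t)) t
  φ-lift {t} t∈ v = to ∘ mapT⁻ (lift t) , λ v∈ → subst (_∈₃ mapT φ (lift t)) (φ-κ t∈ v∈) (mapT⁺ (lift t) (lift⁺ v∈))
    where
    mapT⁻ : ∀ s {v} → v ∈₃ mapT φ s → ∃[ x ] (x ∈₃ s × v ≡ φ x)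
    mapT⁻ (x , y , z) (inj₁ e) = x , inj₁ refl , e
    mapT⁻ (x , y , z) (inj₂ (inj₁ e)) = y , inj₂ (inj₁ refl) , e
    mapT⁻ (x , y , z) (inj₂ (inj₂ e)) = z , inj₂ (inj₂ refl) , e
    mapT⁺ : ∀ s {x} → x ∈₃ s → φ x ∈₃ mapT φ s
    mapT⁺ (x , y , z) (inj₁ refl) = inj₁ refl
    mapT⁺ (x , y , z) (inj₂ (inj₁ refl)) = inj₂ (inj₁ refl)
    mapT⁺ (x , y , z) (inj₂ (inj₂ refl)) = inj₂ (inj₂ refl)
    to : ∀ {v} → ∃[ x ] (x ∈₃ lift t × v ≡ φ x) → v ∈₃ t
    to (x , x∈ , refl) with lift⁻ x∈
    ... | w , w∈ , refl = subst (_∈₃ t) (sym (φ-κ t∈ w∈)) w∈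

  face : ∀ {x y} → x ≢ y → ∃[ s ] (s ∈ triples H × x ∈₃ s × y ∈₃ s) →
    ∃[ t ] ∃[ u ] ∃[ v ] (t ∈ F × u ∈₃ t × v ∈₃ t × u ≢ v × x ≡ κ t u × y ≡ κ t v)
  face ne (s , s∈ , x∈ , y∈) with H⁻ s∈
  ... | t , t∈ , refl with lift⁻ x∈ | lift⁻ y∈
  ... | u , u∈ , refl | v , v∈ , refl = t , u , v , t∈ , u∈ , v∈ , (λ { refl → ne refl }) , refl , refl

  within-triple : ∀ {t u v} → t ∈ F → u ∈₃ t → v ∈₃ t → Reach H (κ t u) (κ t v)
  within-triple {t} {u} {v} t∈ u∈ v∈ with u F.≟ v
  ... | yes refl = here
  ... | no ne = step (ne ∘ κ-injective t∈ t∈ u∈ v∈ , lift t , H⁺ t∈ , lift⁺ u∈ , lift⁺ v∈) here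

  reach-trans : ∀ {a b c} → Reach H a b → Reach H b c → Reach H a c
  reach-trans here q = q
  reach-trans (step a p) q = step a (reach-trans p q)

  reach : ∀ {t t' u v} → t ∈ F → t' ∈ F → Star (Within Adjacent F) t t' → u ∈₃ t → v ∈₃ t' → Reach H (κ t u) (κ t' v)
  reach t∈ t'∈ ε u∈ v∈ = within-triple t∈ u∈ v∈
  reach {t' = t'} {v = v} t∈ t'∈ (_◅_ {j = s} ((p , q , ne , (p∈ , q∈) , (p∈' , q∈')) , _ , s∈) path) u∈ v∈ =
    reach-trans (within-triple t∈ u∈ p∈)
      (subst (λ z → Reach H z (κ t' v)) (sym (κ-shared t∈ s∈ ne p∈ q∈ p∈' q∈')) (reach s∈ t'∈ path p∈' v∈))

  link-trans : ∀ {v a b c} → LinkReach H v a b → LinkReach H v b c → LinkReach H v a c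
  link-trans here q = q
  link-trans (step x y z w p) q = step x y z w (link-trans p q)

  link-within : ∀ {t p u v} → t ∈ F → p ∈₃ t → u ∈₃ t → v ∈₃ t → u ≢ p → v ≢ p →
    LinkReach H (κ t p) (κ t u) (κ t v)
  link-within {t} {p} {u} {v} t∈ p∈ u∈ v∈ u≢p v≢p with u F.≟ v
  ... | yes refl = here
  ... | no u≢v = step (u≢p ∘ sym ∘ κ-injective t∈ t∈ p∈ u∈) (u≢v ∘ κ-injective t∈ t∈ u∈ v∈)
                      (v≢p ∘ sym ∘ κ-injective t∈ t∈ p∈ v∈)
                      (lift t , H⁺ t∈ , lift⁺ p∈ , lift⁺ u∈ , lift⁺ v∈) here

  -- A turn around `p` passes over a shared pair `p`, `z`. By `κ-shared` the copies of `p` and of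
  -- `z` agree in both triples, so the two link edges meet in the copy of `z`.
  link-reach : ∀ {t t' p u v} → t ∈ F → t' ∈ F → Star (Within Turn (corners F)) (t , p) (t' , p) →
    p ∈₃ t → p ∈₃ t' → u ∈₃ t → v ∈₃ t' → u ≢ p → v ≢ p → LinkReach H (κ t p) (κ t u) (κ t' v)
  link-reach t∈ t'∈ ε p∈ p∈' u∈ v∈ u≢p v≢p = link-within t∈ p∈ u∈ v∈ u≢p v≢p
  link-reach {t} {t'} {p} {v = v} t∈ t'∈ (_◅_ {j = s , _} ((refl , z , z≢p , (_ , z∈) , (p∈s , z∈s)) , _ , s∈') path) p∈ p∈' u∈ v∈ u≢p v≢p =
    let s∈ , _ = ∈-corners⁻ s∈' in
    link-trans (link-within t∈ p∈ u∈ z∈ u≢p z≢p)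
      (subst (λ w → LinkReach H (κ t p) w (κ t' v)) (sym (κ-shared t∈ s∈ z≢p z∈ p∈ z∈s p∈s))
        (subst (λ w → LinkReach H w (κ s z) (κ t' v)) (sym (κ-shared t∈ s∈ (≢-sym z≢p) p∈ z∈ p∈s z∈s))
          (link-reach s∈ t'∈ path p∈s p∈' z∈s v∈ z≢p v≢p)))

  -- `φ` undoes the splitting on every single triple, so the images recover the original 3-sets.
  lift-injective : ∀ {t t'} → t ∈ F → t' ∈ F → SameSet (mapT φ (lift t)) (mapT φ (lift t')) → t ≡ t'
  lift-injective {t} {t'} t∈ t'∈ s = sameSet t∈ t'∈
    (sameSet-trans t (mapT φ (lift t)) t' (sameSet-sym (mapT φ (lift t)) t (φ-lift t∈))
      (sameSet-trans (mapT φ (lift t)) (mapT φ (lift t')) t' s (φ-lift t'∈)))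

  closedSurface : ClosedSurface H
  closedSurface = record
    { nonempty = lift t₀ , H⁺ t₀∈
    ; covers = λ i → let t , v , t∈ , v∈ , e = κ-onto i in lift t , H⁺ t∈ , subst (_∈₃ lift t) (sym e) (lift⁺ v∈)
    ; edgeTwo = edgeTwo
    ; connected = λ i j → conn (κ-onto i) (κ-onto j)
    ; linkConn = linkConn
    }
    where
    conn : ∀ {i j} → ∃[ t ] ∃[ v ] (t ∈ F × v ∈₃ t × i ≡ κ t v) → ∃[ t ] ∃[ v ] (t ∈ F × v ∈₃ t × j ≡ κ t v) → Reach H i j
    conn (t , u , t∈ , u∈ , refl) (t' , v , t'∈ , v∈ , refl) = reach t∈ t'∈ (linked t∈ t'∈) u∈ v∈
    edgeTwo : ∀ x y → Face1 H x y → ∃[ t₁ ] ∃[ t₂ ] (t₁ ∈ triples H × t₂ ∈ triples H × t₁ ≢ t₂ ×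
      x ∈₃ t₁ × y ∈₃ t₁ × x ∈₃ t₂ × y ∈₃ t₂ × ((t : Triple m) → t ∈ triples H → x ∈₃ t → y ∈₃ t → t ≡ t₁ ⊎ t ≡ t₂))
    edgeTwo x y (x<y , s) with face (F.<⇒≢ x<y) s
    ... | t , u , v , t∈ , u∈ , v∈ , ne , refl , refl with mate t∈ ne u∈ v∈
    ... | t' , t'∈ , t'≢t , u∈' , v∈' , only =
      lift t , lift t' , H⁺ t∈ , H⁺ t'∈ ,
      (λ e → t'≢t (sym (lift-injective t∈ t'∈ (subst (λ z → SameSet (mapT φ (lift t)) (mapT φ z)) e (sameSet-refl (mapT φ (lift t))))))) ,
      lift⁺ u∈ , lift⁺ v∈ ,
      subst (_∈₃ lift t') (sym (κ-shared t∈ t'∈ ne u∈ v∈ u∈' v∈')) (lift⁺ u∈') ,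
      subst (_∈₃ lift t') (sym (κ-shared t∈ t'∈ (≢-sym ne) v∈ u∈ v∈' u∈')) (lift⁺ v∈') , others
      where
      others : ∀ s → s ∈ triples H → κ t u ∈₃ s → κ t v ∈₃ s → s ≡ lift t ⊎ s ≡ lift t'
      others s s∈ x∈ y∈ with H⁻ s∈
      ... | r , r∈ , refl with lift⁻ x∈ | lift⁻ y∈
      ... | u' , u'∈ , eu | v' , v'∈ , ev with κ-injective t∈ r∈ u∈ u'∈ eu | κ-injective t∈ r∈ v∈ v'∈ ev
      ... | refl | refl = ⊎-map (cong lift) (cong lift) (only r∈ u'∈ v'∈)
    linkConn : ∀ v a b → Adj H v a → Adj H v b → LinkReach H v a b
    linkConn v a b (v≢a , sa) (v≢b , sb) with face v≢a sa | face v≢b sb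
    ... | t , p , u , t∈ , p∈ , u∈ , p≢u , refl , refl | t' , p' , w , t'∈ , p'∈ , w∈ , p'≢w , e , refl
      with κ-injective t∈ t'∈ p∈ p'∈ e
    ... | refl = link-reach t∈ t'∈ (κ-conn t∈ t'∈ p∈ p'∈ e) p∈ p'∈ u∈ w∈ (≢-sym p≢u) (≢-sym p'≢w)

  immersion : ZeroImmersion H G φ
  immersion = record { hom = hom ; inj2 = inj2 ; inj1 = inj1 }
    where
    hom : ∀ s → s ∈ triples H → ∃[ f ] (f ∈ triples G × SameSet (mapT φ s) f)
    hom s s∈ with H⁻ s∈
    ... | t , t∈ , refl = let f , f∈ , same = in-G t∈ in f , f∈ , sameSet-trans (mapT φ (lift t)) t f (φ-lift t∈) same
    inj2 : ∀ s s' → s ∈ triples H → s' ∈ triples H → SameSet (mapT φ s) (mapT φ s') → s ≡ s'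
    inj2 s s' s∈ s'∈ same with H⁻ s∈ | H⁻ s'∈
    ... | t , t∈ , refl | t' , t'∈ , refl = cong lift (lift-injective t∈ t'∈ same)
    inj1 : ∀ x y x' y' → Face1 H x y → Face1 H x' y' → SamePair (φ x) (φ y) (φ x') (φ y') → x ≡ x' × y ≡ y'
    inj1 x y x' y' (x<y , s) (x'<y' , s') same with face (F.<⇒≢ x<y) s | face (F.<⇒≢ x'<y') s'
    ... | t , u , v , t∈ , u∈ , v∈ , ne , refl , refl | t' , u' , v' , t'∈ , u'∈ , v'∈ , ne' , refl , refl
      rewrite φ-κ t∈ u∈ | φ-κ t∈ v∈ | φ-κ t'∈ u'∈ | φ-κ t'∈ v'∈
      with proj₁ (same u) (inj₁ refl) | proj₁ (same v) (inj₂ refl)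
    ... | inj₁ refl | inj₁ e = contradiction (sym e) ne
    ... | inj₁ refl | inj₂ refl = κ-shared t∈ t'∈ ne u∈ v∈ u'∈ v'∈ , κ-shared t∈ t'∈ (≢-sym ne) v∈ u∈ v'∈ u'∈
    ... | inj₂ refl | inj₂ e = contradiction (sym e) ne
    -- The copies of `u` and `v` agree in both triples, so a crosswise match would list the same
    -- 1-face once in increasing and once in decreasing order.
    ... | inj₂ refl | inj₁ refl = contradiction x'<y'
      (ℕ.<-asym (subst (λ z → z F.< κ t' v) (κ-shared t∈ t'∈ ne u∈ v∈ v'∈ u'∈)
        (subst (κ t u F.<_) (κ-shared t∈ t'∈ (≢-sym ne) v∈ u∈ u'∈ v'∈) x<y)))

closed⇒immersion : {G : TripleSystem n} {F : List (Triple n)} {t₀ : Triple n} → Closed F → t₀ ∈ F →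
  (∀ {t} → t ∈ F → ∃[ f ] (f ∈ triples G × SameSet t f)) → ContainsSurfaceImmersion G
closed⇒immersion {G = G} closed t₀∈ in-G =
  let F' , closed' , t₀∈' , sub , linked = connected-component closed t₀∈
      open Surface {G = G} closed' t₀∈' (splitting t₀∈') linked (in-G ∘ sub)
  in _ , H , closedSurface , _ , immersion

-- Blocks

Block : ℕ → Set
Block n = List (Triple n)

_≟ᵇ_ : DecidableEquality (Block n)
_≟ᵇ_ = ≡-dec _≟₃_

Conflict : Rel (Block n) 0ℓ
Conflict b b' = Any (λ t → Any (Adjacent t) b') b

conflict? : Decidable₂ (Conflict {n})
conflict? b b' = any? (λ t → any? (adjacent? t) b') b

conflict⁺ : {b b' : Block n} {t t' : Triple n} → t ∈ b → t' ∈ b' → Adjacent t t' → Conflict b b'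
conflict⁺ t∈ t'∈ a = lose t∈ (lose t'∈ a)

conflict⁻ : {b b' : Block n} → Conflict b b' → ∃[ t ] ∃[ t' ] (t ∈ b × t' ∈ b' × Adjacent t t')
conflict⁻ c = let t , t∈ , c' = find c ; t' , t'∈ , a = find c' in t , t' , t∈ , t'∈ , a

conflict-sym : Symmetric (Conflict {n})
conflict-sym c = let t , t' , t∈ , t'∈ , a = conflict⁻ c in conflict⁺ t'∈ t∈ (adjacent-sym a)

allPairs-lookup : {R : Rel A 0ℓ} → Symmetric R → {xs : List A} → AllPairs R xs → ∀ {x y} → x ∈ xs → y ∈ xs → x ≢ y → R x y
allPairs-lookup sym-R (_ ∷ _) (here refl) (here refl) ne = contradiction refl ne
allPairs-lookup sym-R (rs ∷ _) (here refl) (there y∈) ne = All.lookup rs y∈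
allPairs-lookup sym-R (rs ∷ _) (there x∈) (here refl) ne = sym-R (All.lookup rs x∈)
allPairs-lookup sym-R (_ ∷ p) (there x∈) (there y∈) ne = allPairs-lookup sym-R p x∈ y∈ ne

Compatible : List (Block n) → Set
Compatible = AllPairs (λ b c → ¬ Conflict b c)

compatible-≡ : {M : List (Block n)} → Compatible M → ∀ {b b' t t'} → b ∈ M → b' ∈ M → t ∈ b → t' ∈ b' → Adjacent t t' → b ≡ b'
compatible-≡ compatible {b} {b'} b∈ b'∈ t∈ t'∈ adj with b ≟ᵇ b'
... | yes e = e
... | no ne = contradiction (conflict⁺ t∈ t'∈ adj)
  (allPairs-lookup (λ nc c → nc (conflict-sym c)) compatible b∈ b'∈ ne)

-- A block system over T: the pairs u v with K t u v are the keys of a block, the other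
-- pairs are already matched up inside the block and occur in no other block.
record BlockSystem {n} (T : List (Triple n)) (𝓑 : List (Block n)) (K : Triple n → Fin n → Fin n → Set) : Set where
  field
    distinct : ∀ {t} → t ∈ T → Distinct t
    sameSet  : ∀ {t t'} → t ∈ T → t' ∈ T → SameSet t t' → t ≡ t'
    sub      : ∀ {b t} → b ∈ 𝓑 → t ∈ b → t ∈ T
    disjoint : ∀ {b b' t} → b ∈ 𝓑 → b' ∈ 𝓑 → t ∈ b → t ∈ b' → b ≡ b'
    kind     : ∀ {b t u v} → b ∈ 𝓑 → t ∈ b → u ≢ v → u ∈₃ t → v ∈₃ t →
      (∃[ t' ] (t' ∈ b × t' ≢ t × u ∈₃ t' × v ∈₃ t' ×
         (∀ {b' s} → b' ∈ 𝓑 → s ∈ b' → u ∈₃ s → v ∈₃ s → s ≡ t ⊎ s ≡ t')))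
      ⊎ (K t u v × (∀ {s} → s ∈ b → u ∈₃ s → v ∈₃ s → s ≡ t))

module _ {T : List (Triple n)} {𝓑 : List (Block n)} {K : Triple n → Fin n → Fin n → Set} (system : BlockSystem T 𝓑 K) where

  open BlockSystem system
  open import Data.List.Membership.DecPropositional (_≟ᵇ_ {n}) using (_∈?_)

  Covers : List (Block n) → List (Block n) → Set
  Covers M M' = ∀ {b t u v} → b ∈ M → t ∈ b → u ≢ v → u ∈₃ t → v ∈₃ t → K t u v →
    ∃[ b' ] ∃[ t' ] (b' ∈ M' × t' ∈ b' × u ∈₃ t' × v ∈₃ t')

  InDifference : List (Block n) → List (Block n) → Triple n → Set
  InDifference M M' t = ∃[ b ] (t ∈ b × b ∈ M × b ∉ M')

  difference : List (Block n) → List (Block n) → List (Triple n)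
  difference M M' = concat (filter (λ b → ¬? (b ∈? M')) M)

  difference⁺ : ∀ {M M' t} → InDifference M M' t → t ∈ difference M M'
  difference⁺ (b , t∈ , b∈ , b∉) = ∈-concat⁺′ t∈ (∈-filter⁺ (λ b → ¬? (b ∈? _)) b∈ b∉)

  difference⁻ : ∀ {M M' t} → t ∈ difference M M' → InDifference M M' t
  difference⁻ {M} t∈ = let b , t∈b , b∈ = ∈-concat⁻′ _ t∈ in b , t∈b , ∈-filter⁻ (λ b → ¬? (b ∈? _)) {xs = M} b∈

  -- A pair matched inside its block finds its mate there. A key pair lies in one triple of `M` by
  -- compatibility and, the keys being equal, also in one of `M'`. The block of `M'` that holds it
  -- is not in `M`: it would conflict with `b`, hence be `b`, which is not in `M'`.
  mate-in-difference : ∀ {M M'} → (∀ {b} → b ∈ M → b ∈ 𝓑) → (∀ {b} → b ∈ M' → b ∈ 𝓑) →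
    Compatible M → Compatible M' → Covers M M' →
    ∀ {t u v} → InDifference M M' t → u ≢ v → u ∈₃ t → v ∈₃ t →
    ∃[ t' ] ((InDifference M M' t' ⊎ InDifference M' M t') × t' ≢ t × u ∈₃ t' × v ∈₃ t' ×
      (∀ {s} → InDifference M M' s ⊎ InDifference M' M s → u ∈₃ s → v ∈₃ s → s ≡ t ⊎ s ≡ t'))
  mate-in-difference {M} {M'} inM inM' cM cM' covers {t} {u} {v} (b , t∈ , b∈ , b∉) ne u∈ v∈ with kind (inM b∈) t∈ ne u∈ v∈
  ... | inj₁ (t' , t'∈ , t'≢t , u∈' , v∈' , only) = t' , inj₁ (b , t'∈ , b∈ , b∉) , t'≢t , u∈' , v∈' , λ where
    (inj₁ (_ , s∈ , b'∈ , _)) → only (inM b'∈) s∈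
    (inj₂ (_ , s∈ , b'∈ , _)) → only (inM' b'∈) s∈
  ... | inj₂ (k , only) with covers b∈ t∈ ne u∈ v∈ k
  ... | b' , t' , b'∈ , t'∈ , u∈' , v∈' = t' , inj₂ (b' , t'∈ , b'∈ , b'∉) , t'≢t , u∈' , v∈' , others
    where
    b'∉ : b' ∉ M
    b'∉ b'∈M = b∉ (subst (_∈ M') (compatible-≡ cM b'∈M b∈ t'∈ t∈ (u , v , ne , (u∈' , v∈') , (u∈ , v∈))) b'∈)
    t'≢t : t' ≢ t
    t'≢t refl = b∉ (subst (_∈ M') (disjoint (inM' b'∈) (inM b∈) t'∈ t∈) b'∈)
    others : ∀ {s} → InDifference M M' s ⊎ InDifference M' M s → u ∈₃ s → v ∈₃ s → s ≡ t ⊎ s ≡ t'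
    others (inj₁ (b″ , s∈ , b″∈ , _)) us vs with compatible-≡ cM b″∈ b∈ s∈ t∈ (u , v , ne , (us , vs) , (u∈ , v∈))
    ... | refl = inj₁ (only s∈ us vs)
    others (inj₂ (b″ , s∈ , b″∈ , _)) us vs with compatible-≡ cM' b″∈ b'∈ s∈ t'∈ (u , v , ne , (us , vs) , (u∈' , v∈'))
    ... | refl with kind (inM' b'∈) t'∈ ne u∈' v∈'
    ... | inj₂ (_ , only') = inj₂ (only' s∈ us vs)
    -- A key of `b` might be matched internally in `b'`. Then `t`, which contains the pair, would be
    -- one of the two triples of `b'`, making `b` and `b'` equal.
    ... | inj₁ (t″ , t″∈ , _ , _ , _ , only') with only' (inM b∈) t∈ u∈ v∈
    ... | inj₁ refl = contradiction refl t'≢t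
    ... | inj₂ refl = contradiction (subst (_∈ M') (disjoint (inM' b'∈) (inM b∈) t″∈ t∈) b'∈) b∉

  closed-difference : ∀ {M M'} → All (_∈ 𝓑) M → All (_∈ 𝓑) M' → Compatible M → Compatible M' →
    Covers M M' → Covers M' M → Closed (difference M M' ++ difference M' M)
  closed-difference {M} {M'} allM allM' cM cM' covers covers' = record
    { distinct = distinct ∘ inT ∘ elim ; sameSet = λ p q → sameSet (inT (elim p)) (inT (elim q)) ; mate = mate }
    where
    inM : ∀ {b} → b ∈ M → b ∈ 𝓑
    inM = All.lookup allM
    inM' : ∀ {b} → b ∈ M' → b ∈ 𝓑
    inM' = All.lookup allM'
    elim : ∀ {t} → t ∈ difference M M' ++ difference M' M → InDifference M M' t ⊎ InDifference M' M t
    elim t∈ = ⊎-map difference⁻ difference⁻ (∈-++⁻ (difference M M') t∈)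
    intro : ∀ {t} → InDifference M M' t ⊎ InDifference M' M t → t ∈ difference M M' ++ difference M' M
    intro (inj₁ p) = ∈-++⁺ˡ (difference⁺ p)
    intro (inj₂ p) = ∈-++⁺ʳ (difference M M') (difference⁺ p)
    inT : ∀ {t} → InDifference M M' t ⊎ InDifference M' M t → t ∈ T
    inT (inj₁ (_ , t∈ , b∈ , _)) = sub (inM b∈) t∈
    inT (inj₂ (_ , t∈ , b∈ , _)) = sub (inM' b∈) t∈
    mate : ∀ {t u v} → t ∈ difference M M' ++ difference M' M → u ≢ v → u ∈₃ t → v ∈₃ t →
      ∃[ t' ] (t' ∈ difference M M' ++ difference M' M × t' ≢ t × u ∈₃ t' × v ∈₃ t' ×
        (∀ {s} → s ∈ difference M M' ++ difference M' M → u ∈₃ s → v ∈₃ s → s ≡ t ⊎ s ≡ t'))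
    mate t∈ ne u∈ v∈ with elim t∈
    ... | inj₁ p = let t' , q , t'≢t , u∈' , v∈' , only = mate-in-difference inM inM' cM cM' covers p ne u∈ v∈
                   in t' , intro q , t'≢t , u∈' , v∈' , λ s∈ → only (elim s∈)
    ... | inj₂ p = let t' , q , t'≢t , u∈' , v∈' , only = mate-in-difference inM' inM cM' cM covers' p ne u∈ v∈
                   in t' , intro (⊎-swap q) , t'≢t , u∈' , v∈' , λ s∈ → only (⊎-swap (elim s∈))

  difference⇒immersion : {G : TripleSystem n} → (∀ {t} → t ∈ T → ∃[ f ] (f ∈ triples G × SameSet t f)) →
    ∀ {M M'} → All (_∈ 𝓑) M → All (_∈ 𝓑) M' → Compatible M → Compatible M' → Covers M M' → Covers M' M →
    ∃[ b ] (b ∈ M × b ∉ M' × ∃[ t ] (t ∈ b)) → ContainsSurfaceImmersion G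
  difference⇒immersion in-G {M} {M'} allM allM' cM cM' covers covers' (b , b∈ , b∉ , t , t∈) =
    closed⇒immersion (closed-difference allM allM' cM cM' covers covers') (∈-++⁺ˡ (difference⁺ (b , t∈ , b∈ , b∉)))
      λ s∈ → in-G (inT (∈-++⁻ (difference M M') s∈))
    where
    inT : ∀ {s} → s ∈ difference M M' ⊎ s ∈ difference M' M → s ∈ T
    inT (inj₁ s∈) = let _ , s∈b , b∈ , _ = difference⁻ s∈ in sub (All.lookup allM b∈) s∈b
    inT (inj₂ s∈) = let _ , s∈b , b∈ , _ = difference⁻ {M'} s∈ in sub (All.lookup allM' b∈) s∈b

-- Short cycles in graphs

count-unique : (_≟_ : DecidableEquality A) {xs : List A} → Unique xs → ∀ x → count (x ≟_) xs ≤ 1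
count-unique _≟_ u x = count≤1 (x ≟_) u λ _ _ x≡y x≡z → trans (sym x≡y) x≡z

count-yes : {P : Pred A 0ℓ} (P? : Decidable P) → ∀ {x} → P x → count P? [ x ] ≡ 1
count-yes P? px = cong length (filter-accept P? px)

count-no : {P : Pred A 0ℓ} (P? : Decidable P) → ∀ {x} → ¬ P x → count P? [ x ] ≡ 0
count-no P? npx = cong length (filter-reject P? npx)

count-middle : {P : Pred A 0ℓ} (P? : Decidable P) → ∀ x ys zs → count P? (ys ++ x ∷ zs) ≡ count P? [ x ] + count P? (ys ++ zs)
count-middle P? x [] zs = count-∷ P? x zs
count-middle P? x (y ∷ ys) zs = begin
  count P? (y ∷ ys ++ x ∷ zs) ≡⟨ count-∷ P? y (ys ++ x ∷ zs) ⟩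
  count P? [ y ] + count P? (ys ++ x ∷ zs) ≡⟨ cong (count P? [ y ] +_) (count-middle P? x ys zs) ⟩
  count P? [ y ] + (count P? [ x ] + count P? (ys ++ zs)) ≡⟨ exchange (count P? [ y ]) (count P? [ x ]) _ ⟩
  count P? [ x ] + (count P? [ y ] + count P? (ys ++ zs)) ≡⟨ cong (count P? [ x ] +_) (count-∷ P? y (ys ++ zs)) ⟨
  count P? [ x ] + count P? (y ∷ ys ++ zs) ∎
  where
  open ≡-Reasoning
  exchange : ∀ a b c → a + (b + c) ≡ b + (a + c)
  exchange = solve-∀

sum-middle : (f : A → ℕ) → ∀ x ys zs → sum (map f (ys ++ x ∷ zs)) ≡ f x + sum (map f (ys ++ zs))
sum-middle f x [] zs = refl
sum-middle f x (y ∷ ys) zs = trans (cong (f y +_) (sum-middle f x ys zs)) (exchange (f y) (f x) _)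
  where
  exchange : ∀ a b c → a + (b + c) ≡ b + (a + c)
  exchange = solve-∀

module Graph {n : ℕ} {_~_ : Rel (Fin n) 0ℓ} (_~?_ : Decidable₂ _~_) (~-sym : Symmetric _~_) (~-irrefl : ∀ u → ¬ u ~ u) where

  degree : List (Fin n) → Fin n → ℕ
  degree V u = count (u ~?_) V

  degree-sum : List (Fin n) → ℕ
  degree-sum V = sum (map (degree V) V)

  degree-sum-middle : ∀ u ys zs → degree-sum (ys ++ u ∷ zs) ≤ 2 * degree (ys ++ u ∷ zs) u + degree-sum (ys ++ zs)
  degree-sum-middle u ys zs = begin
    degree-sum V ≡⟨ sum-middle (degree V) u ys zs ⟩
    degree V u + sum (map (degree V) V') ≡⟨ cong (degree V u +_) (sum-cong (degree V) _ V' (λ w → count-middle (w ~?_) u ys zs)) ⟩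
    degree V u + sum (map (λ w → count (w ~?_) [ u ] + degree V' w) V') ≡⟨ cong (degree V u +_) (sum-+ _ _ V') ⟩
    degree V u + (sum (map (λ w → count (w ~?_) [ u ]) V') + degree-sum V')
      ≡⟨ cong (λ z → degree V u + (z + degree-sum V')) (double-count _~?_ V' [ u ]) ⟩
    degree V u + (count (_~? u) V' + 0 + degree-sum V')
      ≤⟨ ℕ.+-monoʳ-≤ (degree V u) (ℕ.+-monoˡ-≤ (degree-sum V') (ℕ.+-monoˡ-≤ 0 (≤-trans (count-cong (_~? u) (u ~?_) V' (λ _ → ~-sym)) grow))) ⟩
    degree V u + (degree V u + 0 + degree-sum V') ≡⟨ ℕ.+-assoc (degree V u) _ _ ⟨
    2 * degree V u + degree-sum V' ∎
    where
    open ≤-Reasoning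
    V = ys ++ u ∷ zs
    V' = ys ++ zs
    grow : degree V' u ≤ degree V u
    grow = ≤-trans (ℕ.m≤n+m _ (count (u ~?_) [ u ])) (≤-reflexive (sym (count-middle (u ~?_) u ys zs)))

  -- Deleting a vertex of degree at most `s` lowers the left side by 2s and the degree sum by at
  -- most 2s, so the strict inequality persists. It fails for the empty list, hence deletion stops
  -- at a non-empty core.
  dense-core : ∀ s k V → length V ≡ k → 2 * s * length V < degree-sum V →
    ∃[ V' ] (V' ⊑ V × 0 < length V' × (∀ {u} → u ∈ V' → s < degree V' u))
  dense-core s k V eq dense with any? (λ u → degree V u ≤? s) V
  dense-core s k [] eq dense | no _ = contradiction dense λ ()
  dense-core s k (v ∷ V) eq dense | no none = v ∷ V , ⊑-refl , s≤s z≤n , λ u∈ → ℕ.≰⇒> λ le → none (lose u∈ le)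
  dense-core s zero [] eq dense | yes ()
  dense-core s (suc k) V eq dense | yes some with find some
  ... | u , u∈ , le with ∈-∃++ u∈
  ... | ys , zs , refl =
    let len : length (ys ++ u ∷ zs) ≡ suc (length (ys ++ zs))
        len = trans (length-++ ys) (trans (ℕ.+-suc (length ys) (length zs)) (cong suc (sym (length-++ ys))))
        V' , V'⊑ , pos , large = dense-core s k (ys ++ zs) (ℕ.suc-injective (trans (sym len) eq)) (smaller len)
    in V' , ⊑-trans V'⊑ (Sublist.++⁺ {as = ys} ⊑-refl (u Sublist.∷ʳ ⊑-refl)) , pos , large
    where
    open ≤-Reasoning
    smaller : length (ys ++ u ∷ zs) ≡ suc (length (ys ++ zs)) → 2 * s * length (ys ++ zs) < degree-sum (ys ++ zs)
    smaller len = ℕ.+-cancelˡ-< (2 * s) _ _ (begin-strict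
      2 * s + 2 * s * length (ys ++ zs) ≡⟨ ℕ.*-suc (2 * s) (length (ys ++ zs)) ⟨
      2 * s * suc (length (ys ++ zs)) ≡⟨ cong (2 * s *_) len ⟨
      2 * s * length (ys ++ u ∷ zs) <⟨ dense ⟩
      degree-sum (ys ++ u ∷ zs) ≤⟨ degree-sum-middle u ys zs ⟩
      2 * degree (ys ++ u ∷ zs) u + degree-sum (ys ++ zs) ≤⟨ ℕ.+-monoˡ-≤ _ (ℕ.*-monoʳ-≤ 2 le) ⟩
      2 * s + degree-sum (ys ++ zs) ∎)

  data Path : Fin n → Fin n → List (Fin n) → Set where
    end  : ∀ {u} → Path u u [ u ]
    cons : ∀ {u v z vs} → u ~ v → u ∉ vs → Path v z vs → Path u z (u ∷ vs)

  head∈ : ∀ {u z vs} → Path u z vs → u ∈ vs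
  head∈ end = here refl
  head∈ (cons _ _ _) = here refl

  last∈ : ∀ {u z vs} → Path u z vs → z ∈ vs
  last∈ end = here refl
  last∈ (cons _ _ p) = there (last∈ p)

  path-unique : ∀ {u z vs} → Path u z vs → Unique vs
  path-unique end = [] ∷ []
  path-unique (cons _ u∉ p) = All.¬Any⇒All¬ _ u∉ ∷ path-unique p

  cut : ∀ {u z vs w} → Path u z vs → w ∈ vs →
    ∃[ ws ] (Path u w ws × length ws ≤ length vs × (∀ {x} → x ∈ ws → x ∈ vs))
  cut end (here refl) = _ , end , ≤-refl , id
  cut (cons _ _ _) (here refl) = _ , end , s≤s z≤n , λ { (here refl) → here refl }
  cut (cons a u∉ p) (there w∈) =
    let ws , q , le , sub = cut p w∈
    in _ , cons a (u∉ ∘ sub) q , s≤s le , λ { (here e) → here e ; (there x∈) → there (sub x∈) }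

  Cycle : List (Fin n) → Set
  Cycle vs = ∃[ u ] ∃[ z ] (Path u z vs × z ~ u × 3 ≤ length vs)

  -- Walks are listed with their current end in front, so the second entry is the vertex just left;
  -- stepping back to it closes no cycle.
  Second : List (Fin n) → Fin n → Set
  Second (_ ∷ w ∷ _) z = w ≡ z
  Second _           z = ⊥

  second? : ∀ vs z → Dec (Second vs z)
  second? (_ ∷ w ∷ _) z = w F.≟ z
  second? []          z = no λ ()
  second? (_ ∷ [])    z = no λ ()

  -- The stretch of the path from `w` to `z` is closed by the edge between them. As `z` is neither
  -- `w` nor the vertex next to it, the stretch has at least three vertices.
  close : ∀ {w v p z} → Path w v p → w ~ z → ¬ Second p z → z ∈ p → ∃[ c ] (Cycle c × length c ≤ length p)
  close end a _ (here refl) = contradiction a (~-irrefl _)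
  close (cons _ _ _) a _ (here refl) = contradiction a (~-irrefl _)
  close (cons _ _ end) a ns (there (here refl)) = contradiction refl ns
  close (cons _ _ (cons _ _ _)) a ns (there (here refl)) = contradiction refl ns
  close (cons b w∉ (cons b' w'∉ p)) a ns (there (there z∈)) =
    let ws , q , le , sub = cut p z∈
        q' = cons b' (w'∉ ∘ sub) q
    in _ , (_ , _ , cons b (λ { (here e) → w∉ (here e) ; (there x∈) → w∉ (there (sub x∈)) }) q' , ~-sym a ,
            s≤s (s≤s (∈-length (head∈ q)))) , s≤s (s≤s le)

  -- Moves vertices from the front of `Q` to the front of `P` until the next one already lies on
  -- `P`, which happens at the latest at their common end. The total length does not change, and
  -- `w ∉ q` ensures that no move is a step back.
  merge : ∀ {w v p z q} → Path w v p → Path z v q → w ~ z → ¬ Second p z → w ∉ q →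
    ∃[ c ] (Cycle c × length c ≤ length p + length q)
  merge {p = p} {z} {q} P Q a ns w∉ with any? (z F.≟_) p
  ... | yes z∈ = let c , cyc , le = close P a ns z∈ in c , cyc , ≤-trans le (ℕ.m≤m+n _ _)
  ... | no z∉ with Q
  ... | end = contradiction (last∈ P) z∉
  ... | cons {v = y} {vs = q'} b z∉q' Q' =
    let c , cyc , le = merge (cons (~-sym a) z∉ P) Q' b (λ e → w∉ (there (subst (_∈ q') (sym (second-head P e)) (head∈ Q')))) z∉q'
    in c , cyc , ≤-trans le (≤-reflexive (sym (ℕ.+-suc (length p) (length q'))))
    where
    second-head : ∀ {w v p z y} → Path w v p → Second (z ∷ p) y → w ≡ y
    second-head end e = e
    second-head (cons _ _ _) e = e

  -- Beyond the common initial stretch the next vertices differ, and there `merge` applies with the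
  -- whole remaining `P` and the tail of `Q`.
  fork : ∀ {w v p q} → Path w v p → Path w v q → p ≢ q → ∃[ c ] (Cycle c × length c ≤ length p + length q)
  fork end end ne = contradiction refl ne
  fork end (cons _ w∉ Q) ne = contradiction (last∈ Q) w∉
  fork (cons _ w∉ P) end ne = contradiction (last∈ P) w∉
  fork (cons {v = a} {vs = p} x w∉ P) (cons {v = b} {vs = q} y w∉' Q) ne with a F.≟ b
  ... | yes refl = let c , cyc , le = fork P Q (λ { refl → ne refl })
                   in c , cyc , ≤-trans le (ℕ.+-mono-≤ (ℕ.n≤1+n (length p)) (ℕ.n≤1+n (length q)))
  ... | no a≢b = let c , cyc , le = merge (cons x w∉ P) Q y (second P a≢b) w∉'
                 in c , cyc , ≤-trans le (ℕ.+-monoʳ-≤ (suc (length p)) (ℕ.n≤1+n (length q)))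
    where
    second : ∀ {a b v p w} → Path a v p → a ≢ b → ¬ Second (w ∷ p) b
    second end ne = ne
    second (cons _ _ _) ne = ne

  module _ (s : ℕ) (V : List (Fin n)) (V! : Unique V) (large : ∀ {u} → u ∈ V → s < degree V u) (v₀ : Fin n) (v₀∈ : v₀ ∈ V) where

    extensions : List (Fin n) → List (Fin n)
    extensions []       = []
    extensions p@(w ∷ _) = filter (λ z → ¬? (second? p z)) (filter (w ~?_) V)

    -- Walks from `v₀` that never step straight back. Revisits are not forbidden by construction;
    -- they are excluded once short cycles are assumed away.
    paths : ℕ → List (List (Fin n))
    paths zero    = [ [ v₀ ] ]
    paths (suc j) = concatMap (λ p → map (_∷ p) (extensions p)) (paths j)

    paths-unique : ∀ j → Unique (paths j)
    paths-unique zero = [] ∷ []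
    paths-unique (suc j) = AllPairs.concat⁺ (All.map⁺ (All.universal same (paths j)))
      (AllPairs.map⁺ (AllPairs.map (λ ne → All.map⁺ (All.universal (λ _ → All.map⁺ (All.universal (λ _ e → ne (proj₂ (∷-injective e))) _)) _)) (paths-unique j)))
      where
      extensions! : ∀ p → Unique (extensions p)
      extensions! [] = []
      extensions! p@(w ∷ _) = Unique.filter⁺ (λ z → ¬? (second? p z)) (Unique.filter⁺ (w ~?_) V!)
      same : ∀ p → Unique (map (_∷ p) (extensions p))
      same p = Unique.map⁺ (λ e → proj₁ (∷-injective e)) (extensions! p)

    extensions-length : ∀ w p → w ∈ V → s ≤ length (extensions (w ∷ p))
    extensions-length w p w∈ = ℕ.+-cancelˡ-≤ 1 _ _ (begin
      1 + s ≤⟨ large w∈ ⟩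
      length N ≡⟨ count-complement (second? (w ∷ p)) N ⟩
      count (second? (w ∷ p)) N + length (extensions (w ∷ p)) ≤⟨ ℕ.+-monoˡ-≤ _ (few p) ⟩
      1 + length (extensions (w ∷ p)) ∎)
      where
      open ≤-Reasoning
      N = filter (w ~?_) V
      few : ∀ p → count (second? (w ∷ p)) N ≤ 1
      few [] = ≤-trans (count-cong (second? [ w ]) (w F.≟_) N (λ _ ())) (count-unique F._≟_ (Unique.filter⁺ (w ~?_) V!) w)
      few (w' ∷ _) = count-unique F._≟_ (Unique.filter⁺ (w ~?_) V!) w'

    module _ (R : ℕ) (no-cycle : ∀ c → Cycle c → ¬ (length c ≤ R)) where

      paths-path : ∀ j {p} → j < R → p ∈ paths j → ∃[ w ] (Path w v₀ p × w ∈ V × length p ≡ suc j)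
      paths-path zero _ (here refl) = v₀ , end , v₀∈ , refl
      paths-path (suc j) j<R p∈ with find (∈-concatMap⁻ _ {xs = paths j} p∈)
      ... | q , q∈ , p∈' with ∈-map⁻ (_∷ q) p∈'
      ... | z , z∈ , refl with paths-path j (ℕ.<-trans (ℕ.n<1+n j) j<R) q∈
      ... | w , Q , w∈ , len with extension Q z∈
        where
        extension : ∀ {w v q z} → Path w v q → z ∈ extensions q → w ~ z × z ∈ V × ¬ Second q z
        extension {q = q} {z} end z∈ = let z∈' , ns = ∈-filter⁻ (λ z → ¬? (second? q z)) {xs = filter (_ ~?_) V} z∈
                                           z∈V , a = ∈-filter⁻ (_ ~?_) {xs = V} z∈' in a , z∈V , ns
        extension {q = q} {z} (cons _ _ _) z∈ = let z∈' , ns = ∈-filter⁻ (λ z → ¬? (second? q z)) {xs = filter (_ ~?_) V} z∈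
                                                    z∈V , a = ∈-filter⁻ (_ ~?_) {xs = V} z∈' in a , z∈V , ns
      ... | a , z∈V , ns = z , cons (~-sym a) z∉ Q , z∈V , cong suc len
        where
        z∉ : z ∉ q
        z∉ z∈q = let c , cyc , le = close Q a ns z∈q in
          no-cycle c cyc (≤-trans le (≤-trans (≤-reflexive len) (ℕ.<⇒≤ j<R)))

      paths-length : ∀ j → j ≤ R → s ^ j ≤ length (paths j)
      paths-length zero _ = ≤-refl
      paths-length (suc j) j<R = begin
        s * s ^ j ≡⟨ ℕ.*-comm s (s ^ j) ⟩
        s ^ j * s ≤⟨ ℕ.*-monoˡ-≤ s (paths-length j (ℕ.<⇒≤ j<R)) ⟩
        length (paths j) * s ≤⟨ sum-≥ (λ p → length (branch p)) s (paths j) each ⟩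
        sum (map (λ p → length (branch p)) (paths j)) ≡⟨ cong sum (map-∘ {g = length} {f = branch} (paths j)) ⟩
        sum (map length (map branch (paths j))) ≡⟨ length-concat (map branch (paths j)) ⟨
        length (paths (suc j)) ∎
        where
        open ≤-Reasoning
        branch = λ p → map (_∷ p) (extensions p)
        each : ∀ {p} → p ∈ paths j → s ≤ length (branch p)
        each {p} p∈ with paths-path j j<R p∈
        ... | w , P , w∈ , _ = ≤-trans (size P) (≤-reflexive (sym (length-map (_∷ p) (extensions p))))
          where
          size : ∀ {p} → Path w v₀ p → s ≤ length (extensions p)
          size end = extensions-length w [] w∈
          size (cons _ _ _) = extensions-length w _ w∈

      head : List (Fin n) → Fin n
      head []      = v₀
      head (w ∷ _) = w

      paths-collide : ∀ j → suc j + suc j ≤ R → n < s ^ j → ⊥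
      paths-collide j le lt =
        let j<R = ≤-trans (ℕ.m≤m+n (suc j) (suc j)) le
            p , q , p∈ , q∈ , ne , eq = pigeonhole head {ys = allFin n} (paths-unique j) (λ _ → ∈-allFin _)
              (≤-trans (s≤s (≤-reflexive (length-tabulate {n = n} id))) (≤-trans lt (paths-length j (ℕ.<⇒≤ j<R))))
            w , P , _ , lenp = paths-path j j<R p∈
            z , Q , _ , lenq = paths-path j j<R q∈
            c , cyc , le' = fork (subst (λ w → Path w v₀ p) (trans (sym (head-path P)) (trans eq (head-path Q))) P) Q ne
        in no-cycle c cyc (≤-trans le' (≤-trans (≤-reflexive (cong₂ _+_ lenp lenq)) le))
        where
        head-path : ∀ {w p} → Path w v₀ p → head p ≡ w
        head-path end = refl
        head-path (cons _ _ _) = refl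

  -- The Moore bound. Without short cycles the non-backtracking walks of `j` steps in a core of
  -- minimum degree above `s` are simple paths with distinct ends, yet there are at least `s ^ j` of
  -- them. Reasoning from the absence of cycles is the source of the double negation.
  short-cycle : ∀ s j → 2 * s * n < degree-sum (allFin n) → n < s ^ j →
    ¬ ¬ (∃[ c ] (Cycle c × length c ≤ suc j + suc j))
  short-cycle s j dense lt none
    with dense-core s n (allFin n) (length-tabulate {n = n} id) (subst (λ k → 2 * s * k < degree-sum (allFin n)) (sym (length-tabulate {n = n} id)) dense)
  ... | v ∷ V , V⊑ , _ , large = paths-collide s (v ∷ V) (unique-⊑ V⊑ (Unique.allFin⁺ n)) large v (here refl) _
          (λ c cyc le → none (c , cyc , le)) j ≤-refl lt
    where
    unique-⊑ : ∀ {xs ys : List (Fin n)} → xs ⊑ ys → Unique ys → Unique xs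
    unique-⊑ Sublist.[] _ = []
    unique-⊑ (_ Sublist.∷ʳ s) (_ ∷ u) = unique-⊑ s u
    unique-⊑ (refl Sublist.∷ s) (x∉ ∷ u) = Sublist.All-resp-⊆ s x∉ ∷ unique-⊑ s u

  -- An edge of a link may stem from a triple with its rim vertices in either order, so an edge is
  -- attached to a proof of adjacency and its ends are known only up to order.
  module Edges {E : Set} (src tgt : E → Fin n) (edge : ∀ {u v} → u ~ v → E)
    (edge-ends : ∀ {u v} (a : u ~ v) → (src (edge a) ≡ u × tgt (edge a) ≡ v) ⊎ (src (edge a) ≡ v × tgt (edge a) ≡ u)) where

    Incident : Fin n → E → Set
    Incident x e = x ≡ src e ⊎ x ≡ tgt e

    incident? : ∀ x → Decidable (Incident x)
    incident? x e = x F.≟ src e ⊎-dec x F.≟ tgt e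

    δ : Fin n → Fin n → ℕ
    δ x u = count (x F.≟_) [ u ]

    incident-edge : ∀ {x u v} (a : u ~ v) → Incident x (edge a) → x ≡ u ⊎ x ≡ v
    incident-edge a i with edge-ends a | i
    ... | inj₁ (p , _) | inj₁ q = inj₁ (trans q p)
    ... | inj₁ (_ , p) | inj₂ q = inj₂ (trans q p)
    ... | inj₂ (p , _) | inj₁ q = inj₂ (trans q p)
    ... | inj₂ (_ , p) | inj₂ q = inj₁ (trans q p)

    edge-incident : ∀ {u v} (a : u ~ v) → Incident u (edge a) × Incident v (edge a)
    edge-incident a with edge-ends a
    ... | inj₁ (p , q) = inj₁ (sym p) , inj₂ (sym q)
    ... | inj₂ (p , q) = inj₂ (sym q) , inj₁ (sym p)

    incidences : ∀ x {u v} (a : u ~ v) → count (incident? x) [ edge a ] ≡ δ x u + δ x v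
    incidences x {u} {v} a with x F.≟ u | x F.≟ v
    ... | yes refl | yes refl = contradiction a (~-irrefl x)
    ... | yes refl | no _ = count-yes (incident? x) (proj₁ (edge-incident a))
    ... | no _ | yes refl = count-yes (incident? x) (proj₂ (edge-incident a))
    ... | no x≢u | no x≢v = count-no (incident? x) λ i → [ x≢u , x≢v ]′ (incident-edge a i)

    edges : ∀ {u z vs} → Path u z vs → List E
    edges end = []
    edges (cons a _ p) = edge a ∷ edges p

    -- The end points of a path are counted once more so that every vertex has degree two.
    edges-count : ∀ x {u z vs} (p : Path u z vs) →
      δ x u + δ x z + count (incident? x) (edges p) ≡ 2 * count (x F.≟_) vs
    edges-count x {u} end with x F.≟ u
    ... | yes _ = refl
    ... | no _ = refl
    edges-count x {u} {z} {vs = _ ∷ vs} (cons {v = v} a _ p) = begin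
      δ x u + δ x z + count (incident? x) (edge a ∷ edges p)
        ≡⟨ cong (δ x u + δ x z +_) (trans (count-∷ (incident? x) (edge a) (edges p)) (cong (_+ c) (incidences x a))) ⟩
      δ x u + δ x z + (δ x u + δ x v + c) ≡⟨ rearrange (δ x u) (δ x z) (δ x v) c ⟩
      2 * δ x u + (δ x v + δ x z + c) ≡⟨ cong (2 * δ x u +_) (edges-count x p) ⟩
      2 * δ x u + 2 * count (x F.≟_) vs ≡⟨ ℕ.*-distribˡ-+ 2 (δ x u) _ ⟨
      2 * (δ x u + count (x F.≟_) vs) ≡⟨ cong (2 *_) (count-∷ (x F.≟_) u vs) ⟨
      2 * count (x F.≟_) (u ∷ vs) ∎
      where
      open ≡-Reasoning
      c = count (incident? x) (edges p)
      rearrange : ∀ a b d c → a + b + (a + d + c) ≡ 2 * a + (d + b + c)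
      rearrange = solve-∀

    edges-length : ∀ {u z vs} (p : Path u z vs) → suc (length (edges p)) ≡ length vs
    edges-length end = refl
    edges-length (cons _ _ p) = cong suc (edges-length p)

    edges-incident : ∀ {u z vs} (p : Path u z vs) {e x} → e ∈ edges p → Incident x e → x ∈ vs
    edges-incident (cons a _ p) (here refl) i with incident-edge a i
    ... | inj₁ refl = here refl
    ... | inj₂ refl = there (head∈ p)
    edges-incident (cons _ _ p) (there e∈) i = there (edges-incident p e∈ i)

    edges-unique : ∀ {u z vs} (p : Path u z vs) → Unique (edges p)
    edges-unique end = []
    edges-unique (cons a u∉ p) =
      All.tabulate (λ { e∈ refl → u∉ (edges-incident p e∈ (proj₁ (edge-incident a))) }) ∷ edges-unique p

    edges-from : (P : E → Set) → (∀ {u v} (a : u ~ v) → P (edge a)) → ∀ {u z vs} (p : Path u z vs) → All P (edges p)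
    edges-from P all end = []
    edges-from P all (cons a _ p) = all a ∷ edges-from P all p

    cycle-edges : (P : E → Set) → (∀ {u v} (a : u ~ v) → P (edge a)) → ∀ {c} → Cycle c →
      ∃[ es ] (Unique es × All P es × 0 < length es × length es ≤ length c ×
        (∀ {x e} → e ∈ es → Incident x e → count (incident? x) es ≡ 2))
    cycle-edges P all {vs} (u , z , p , a , 3≤) =
      edge a ∷ edges p , All.tabulate (new p a 3≤) ∷ edges-unique p , all a ∷ edges-from P all p , s≤s z≤n ,
      ≤-reflexive (edges-length p) , two
      where
      -- On two vertices the closing edge could be the path edge run backwards; the bound on the
      -- length rules this out.
      new : ∀ {u z vs} (p : Path u z vs) (a : z ~ u) → 3 ≤ length vs → {e : E} → e ∈ edges p → edge a ≢ e
      new (cons _ _ end) _ (s≤s (s≤s ()))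
      new (cons b _ (cons _ v∉ q)) a _ (here refl) eq with incident-edge b (subst (Incident _) eq (proj₁ (edge-incident a)))
      ... | inj₁ refl = ~-irrefl _ a
      ... | inj₂ refl = v∉ (last∈ q)
      new (cons b u∉ q@(cons _ _ _)) a _ (there e∈) refl = u∉ (edges-incident q e∈ (proj₂ (edge-incident a)))
      degree-two : ∀ x → count (incident? x) (edge a ∷ edges p) ≡ 2 * count (x F.≟_) vs
      degree-two x = begin
        count (incident? x) (edge a ∷ edges p) ≡⟨ count-∷ (incident? x) (edge a) (edges p) ⟩
        count (incident? x) [ edge a ] + count (incident? x) (edges p)
          ≡⟨ cong (_+ count (incident? x) (edges p)) (trans (incidences x a) (ℕ.+-comm (δ x z) (δ x u))) ⟩
        δ x u + δ x z + count (incident? x) (edges p) ≡⟨ edges-count x p ⟩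
        2 * count (x F.≟_) vs ∎
        where open ≡-Reasoning
      two : ∀ {x e} → e ∈ edge a ∷ edges p → Incident x e → count (incident? x) (edge a ∷ edges p) ≡ 2
      -- The degree of `x` is twice its number of occurrences on the path, which is at most one, and
      -- not zero since `x` meets the edge `e`.
      two {x} {e} e∈ i = trans (degree-two x) (cong (2 *_) (ℕ.≤-antisym (count-unique F._≟_ (path-unique p) x)
        (ℕ.*-cancelˡ-< 2 0 _ (≤-trans (∈⇒count>0 (incident? x) e∈ i) (≤-reflexive (degree-two x))))))

-- Pairs

Pair : ℕ → Set
Pair n = Fin n × Fin n

_≟ₚ_ : DecidableEquality (Pair n)
_≟ₚ_ = Product.≡-dec F._≟_ F._≟_

abstract
  pair : Fin n → Fin n → Pair n
  pair u v with u F.≤? v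
  ... | yes _ = u , v
  ... | no _  = v , u

  pair-cases : (u v : Fin n) → pair u v ≡ (u , v) ⊎ pair u v ≡ (v , u)
  pair-cases u v with u F.≤? v
  ... | yes _ = inj₁ refl
  ... | no _  = inj₂ refl

  pair-comm : (u v : Fin n) → pair u v ≡ pair v u
  pair-comm u v with u F.≤? v | v F.≤? u
  ... | yes p | yes q = cong₂ _,_ (F.≤-antisym p q) (F.≤-antisym q p)
  ... | yes _ | no _  = refl
  ... | no _  | yes _ = refl
  ... | no p  | no q  = contradiction (ℕ.<⇒≤ (ℕ.≰⇒> p)) q

pair-injective : {u v u' v' : Fin n} → pair u v ≡ pair u' v' → (u ≡ u' × v ≡ v') ⊎ (u ≡ v' × v ≡ u')
pair-injective {u = u} {v} {u'} {v'} e with pair-cases u v | pair-cases u' v'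
... | inj₁ p | inj₁ q = let e' = trans (sym p) (trans e q) in inj₁ (cong proj₁ e' , cong proj₂ e')
... | inj₁ p | inj₂ q = let e' = trans (sym p) (trans e q) in inj₂ (cong proj₁ e' , cong proj₂ e')
... | inj₂ p | inj₁ q = let e' = trans (sym p) (trans e q) in inj₂ (cong proj₂ e' , cong proj₁ e')
... | inj₂ p | inj₂ q = let e' = trans (sym p) (trans e q) in inj₁ (cong proj₂ e' , cong proj₁ e')

-- The first entry of a triple is read as the hub of a wheel: `e₁` and `e₂` are spokes and `e₃` is
-- the rim pair. Triples will be turned so that the levels of the three increase.
e₁ e₂ e₃ : Triple n → Pair n
e₁ (y , x , z) = pair y x
e₂ (y , x , z) = pair y z
e₃ (y , x , z) = pair x z

spokes pairs : Triple n → List (Pair n)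
spokes t = e₁ t ∷ e₂ t ∷ []
pairs t = e₁ t ∷ e₂ t ∷ e₃ t ∷ []

_∈ₚ?_ : (p : Pair n) (ps : List (Pair n)) → Dec (p ∈ ps)
p ∈ₚ? ps = any? (p ≟ₚ_) ps

pair∈pairs : {u v : Fin n} (t : Triple n) → u ≢ v → u ∈₃ t → v ∈₃ t → pair u v ∈ pairs t
pair∈pairs t ne (inj₁ refl) (inj₁ refl) = contradiction refl ne
pair∈pairs t ne (inj₁ refl) (inj₂ (inj₁ refl)) = here refl
pair∈pairs t ne (inj₁ refl) (inj₂ (inj₂ refl)) = there (here refl)
pair∈pairs (y , x , z) ne (inj₂ (inj₁ refl)) (inj₁ refl) = here (pair-comm x y)
pair∈pairs t ne (inj₂ (inj₁ refl)) (inj₂ (inj₁ refl)) = contradiction refl ne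
pair∈pairs t ne (inj₂ (inj₁ refl)) (inj₂ (inj₂ refl)) = there (there (here refl))
pair∈pairs (y , x , z) ne (inj₂ (inj₂ refl)) (inj₁ refl) = there (here (pair-comm z y))
pair∈pairs (y , x , z) ne (inj₂ (inj₂ refl)) (inj₂ (inj₁ refl)) = there (there (here (pair-comm z x)))
pair∈pairs t ne (inj₂ (inj₂ refl)) (inj₂ (inj₂ refl)) = contradiction refl ne

pair-⊆ : {u v u' v' : Fin n} {P : Fin n → Set} → pair u v ≡ pair u' v' → P u' → P v' → P u × P v
pair-⊆ e pu pv with pair-injective e
... | inj₁ (refl , refl) = pu , pv
... | inj₂ (refl , refl) = pv , pu

pair∈pairs⁻ : {u v : Fin n} (t : Triple n) → pair u v ∈ pairs t → u ∈₃ t × v ∈₃ t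
pair∈pairs⁻ t (here e) = pair-⊆ {P = _∈₃ t} e (inj₁ refl) (inj₂ (inj₁ refl))
pair∈pairs⁻ t (there (here e)) = pair-⊆ {P = _∈₃ t} e (inj₁ refl) (inj₂ (inj₂ refl))
pair∈pairs⁻ t (there (there (here e))) = pair-⊆ {P = _∈₃ t} e (inj₂ (inj₁ refl)) (inj₂ (inj₂ refl))

adjacent⇒common-pair : {t t' : Triple n} → Adjacent t t' → ∃[ p ] (p ∈ pairs t × p ∈ pairs t')
adjacent⇒common-pair {t = t} {t'} (u , v , ne , (u∈ , v∈) , (u∈' , v∈')) =
  pair u v , pair∈pairs t ne u∈ v∈ , pair∈pairs t' ne u∈' v∈'

codegree : List (Triple n) → Pair n → ℕ
codegree T p = count (λ t → p ∈ₚ? pairs t) T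

count-map : {P : Pred B 0ℓ} (P? : Decidable P) (f : A → B) → ∀ xs → count P? (map f xs) ≡ count (λ x → P? (f x)) xs
count-map P? f [] = refl
count-map P? f (x ∷ xs) with P? (f x)
... | yes _ = cong suc (count-map P? f xs)
... | no _ = count-map P? f xs

-- Balanced degrees: single triples as blocks

record Oriented (G : TripleSystem n) (T : List (Triple n)) : Set where
  field
    uniqueT  : Unique T
    distinct : ∀ {t} → t ∈ T → Distinct t
    sameSet  : ∀ {t t'} → t ∈ T → t' ∈ T → SameSet t t' → t ≡ t'
    in-G     : ∀ {t} → t ∈ T → ∃[ f ] (f ∈ triples G × SameSet t f)

map-[]-inverse : {M : List (List A)} {xs : List A} → All (_∈ map [_] xs) M → ∀ {b} → b ∈ M → ∃[ x ] (x ∈ xs × b ≡ [ x ])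
map-[]-inverse all b∈ = ∈-map⁻ [_] (All.lookup all b∈)

length-concat-singletons : {M : List (List A)} → (∀ {b} → b ∈ M → length b ≤ 1) → length (concat M) ≤ length M
length-concat-singletons {M = M} le = ≤-trans (≤-reflexive (length-concat M)) (≤-trans (sum-≤ length 1 M le) (≤-reflexive (ℕ.*-identityʳ _)))

-- Every pair is a key here. The three kinds of pairs are coded separately because their universes
-- differ in size; a joint code would charge all of them at the rate of the largest.
balanced : {G : TripleSystem n} {T : List (Triple n)} → Oriented G T → ∀ D m (U₁ U₂ U₃ : List (Pair n)) v₁ v₂ v₃ →
  (∀ {t p} → t ∈ T → p ∈ pairs t → codegree T p ≤ D) →
  Unique U₁ → Unique U₂ → Unique U₃ → (∀ {t} → t ∈ T → e₁ t ∈ U₁ × e₂ t ∈ U₂ × e₃ t ∈ U₃) →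
  0 < v₁ → 0 < v₂ → 0 < v₃ → length U₁ ≤ m * (v₁ + v₁) → length U₂ ≤ m * (v₂ + v₂) → length U₃ ≤ m * (v₃ + v₃) →
  m * (3 * D + 3 * D) ≤ length T →
  (4 * (v₁ + v₁)) ^ m * ((4 * (v₂ + v₂)) ^ m * (4 * (v₃ + v₃)) ^ m) < (3 * D) ^ m →
  ContainsSurfaceImmersion G
balanced {n} {G} {T} oriented D m U₁ U₂ U₃ v₁ v₂ v₃ codeg u₁ u₂ u₃ into p₁ p₂ p₃ l₁ l₂ l₃ size few =
  -- Branching over `3 * D` blocks, as many as conflicts may remove, at most doubles the number of
  -- blocks a step uses up.
  let M , M' , allM , allM' , cM , cM' , eq , b , b∈ , b∉ = equal-codes conflict? (3 * D) (3 * D) m blocks! degree size' code codes code∈ few'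
      t , _ , b≡ = map-[]-inverse allM b∈
  in difference⇒immersion system in-G allM allM' cM cM' (covers eq allM) (covers (sym eq) allM')
       (b , b∈ , b∉ , t , subst (t ∈_) (sym b≡) (here refl))
  where
  open Oriented oriented
  blocks = map [_] T
  blocks! : Unique blocks
  blocks! = Unique.map⁺ (λ { refl → refl }) uniqueT
  system : BlockSystem T blocks (λ _ _ _ → ⊤)
  system = record
    { distinct = distinct ; sameSet = sameSet
    ; sub = λ b∈ t∈ → sub (∈-map⁻ [_] b∈) t∈
    ; disjoint = λ b∈ b'∈ t∈ t∈' → trans (alone (∈-map⁻ [_] b∈) t∈) (sym (alone (∈-map⁻ [_] b'∈) t∈'))
    ; kind = λ b∈ t∈ _ _ _ → inj₂ (tt , λ s∈ _ _ → same (∈-map⁻ [_] b∈) s∈ t∈) }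
    where
    sub : ∀ {b t} → ∃[ s ] (s ∈ T × b ≡ [ s ]) → t ∈ b → t ∈ T
    sub (_ , s∈ , refl) (here refl) = s∈
    alone : ∀ {b t} → ∃[ s ] (s ∈ T × b ≡ [ s ]) → t ∈ b → b ≡ [ t ]
    alone (_ , _ , refl) (here refl) = refl
    same : ∀ {b s t} → ∃[ r ] (r ∈ T × b ≡ [ r ]) → s ∈ b → t ∈ b → s ≡ t
    same (_ , _ , refl) (here refl) (here refl) = refl
  degree : ∀ {b} → b ∈ blocks → count (conflict? b) blocks ≤ 3 * D
  degree b∈ with ∈-map⁻ [_] b∈
  ... | t , t∈ , refl = begin
    count (conflict? [ t ]) (map [_] T) ≡⟨ count-map (conflict? [ t ]) [_] T ⟩
    count (λ s → conflict? [ t ] [ s ]) T ≤⟨ count-cong _ (λ s → any? (_∈ₚ? pairs s) (pairs t)) T (λ _ → common) ⟩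
    count (λ s → any? (_∈ₚ? pairs s) (pairs t)) T ≤⟨ count-any (λ s p → p ∈ₚ? pairs s) T (pairs t) ⟩
    sum (map (codegree T) (pairs t)) ≤⟨ sum-≤ (codegree T) D (pairs t) (codeg t∈) ⟩
    3 * D ∎
    where
    open ≤-Reasoning
    common : ∀ {s} → Conflict [ t ] [ s ] → Any (_∈ pairs s) (pairs t)
    common (here (here a)) = let p , p∈ , p∈' = adjacent⇒common-pair a in lose p∈ p∈'
  size' : m * (3 * D + 3 * D) ≤ length blocks
  size' = ≤-trans size (≤-reflexive (sym (length-map [_] T)))
  ind : List (Pair n) → (Triple n → Pair n) → List (Block n) → List Bool
  ind U e M = indicator _≟ₚ_ U (map e (concat M))
  code : List (Block n) → List Bool × List Bool × List Bool
  code M = ind U₁ e₁ M , ind U₂ e₂ M , ind U₃ e₃ M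
  S : List (Pair n) → List (List Bool)
  S U = subsets (length U) m
  codes = cartesianProduct (S U₁) (cartesianProduct (S U₂) (S U₃))
  code∈ : ∀ {M} → length M ≡ m → All (_∈ blocks) M → code M ∈ codes
  code∈ {M} len all = ∈-cartesianProduct⁺ (ind∈ e₁ u₁) (∈-cartesianProduct⁺ (ind∈ e₂ u₂) (ind∈ e₃ u₃))
    where
    short : length (concat M) ≤ m
    short = ≤-trans (length-concat-singletons λ b∈ → case map-[]-inverse all b∈ of λ { (_ , _ , refl) → ≤-refl }) (≤-reflexive len)
    ind∈ : ∀ e {U} → Unique U → ind U e M ∈ S U
    ind∈ e u = indicator-∈ _≟ₚ_ (map e (concat M)) m u (≤-trans (≤-reflexive (length-map e (concat M))) short)
  few' : length codes < (3 * D) ^ m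
  few' = begin-strict
    length codes ≡⟨ trans (length-cartesianProduct (S U₁) _) (cong (length (S U₁) *_) (length-cartesianProduct (S U₂) (S U₃))) ⟩
    length (S U₁) * (length (S U₂) * length (S U₃))
      ≤⟨ ℕ.*-mono-≤ (subsets-≤ v₁ _ m p₁ l₁) (ℕ.*-mono-≤ (subsets-≤ v₂ _ m p₂ l₂) (subsets-≤ v₃ _ m p₃ l₃)) ⟩
    (4 * (v₁ + v₁)) ^ m * ((4 * (v₂ + v₂)) ^ m * (4 * (v₃ + v₃)) ^ m) <⟨ few ⟩
    (3 * D) ^ m ∎
    where open ≤-Reasoning
  covers : ∀ {M M'} → code M ≡ code M' → All (_∈ blocks) M → Covers system M M'
  covers {M} {M'} eq all {b} {t} {u} {v} b∈ t∈ ne u∈ v∈ _ = cover (pair∈pairs t ne u∈ v∈)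
    where
    t∈T : t ∈ T
    t∈T = BlockSystem.sub system (All.lookup all b∈) t∈
    transfer : ∀ e {U} → ind U e M ≡ ind U e M' → e t ∈ U → (∀ s → e s ∈ pairs s) → pair u v ≡ e t →
      ∃[ b' ] ∃[ t' ] (b' ∈ M' × t' ∈ b' × u ∈₃ t' × v ∈₃ t')
    transfer e {U} eq et∈ in-pairs e≡ =
      let s , s∈ , es = ∈-map⁻ e (indicator-≡ _≟ₚ_ U eq et∈ (∈-map⁺ e (∈-concat⁺′ t∈ b∈)))
          b' , s∈b' , b'∈ = ∈-concat⁻′ M' s∈
          us , vs = pair∈pairs⁻ s (subst (_∈ pairs s) (sym (trans e≡ es)) (in-pairs s))
      in b' , s , b'∈ , s∈b' , us , vs
    cover : pair u v ∈ pairs t → ∃[ b' ] ∃[ t' ] (b' ∈ M' × t' ∈ b' × u ∈₃ t' × v ∈₃ t')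
    cover (here e) = transfer e₁ (cong proj₁ eq) (proj₁ (into t∈T)) (λ _ → here refl) e
    cover (there (here e)) = transfer e₂ (cong (proj₁ ∘ proj₂) eq) (proj₁ (proj₂ (into t∈T))) (λ _ → there (here refl)) e
    cover (there (there (here e))) = transfer e₃ (cong (proj₂ ∘ proj₂) eq) (proj₂ (proj₂ (into t∈T))) (λ _ → there (there (here refl))) e

-- Wheels

¬¬-map : {A B : Set} → (A → B) → ¬ ¬ A → ¬ ¬ B
¬¬-map f nna nb = nna (nb ∘ f)

count-concat : {P : Pred A 0ℓ} (P? : Decidable P) → ∀ bs → count (any? P?) bs ≤ count P? (concat bs)
count-concat P? [] = z≤n
count-concat P? (b ∷ bs) with any? P? b
... | no _ = ≤-trans (count-concat P? bs) (≤-trans (ℕ.m≤n+m _ (count P? b)) (≤-reflexive (sym (count-++ P? b (concat bs)))))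
... | yes a = let _ , x∈ , px = find a in
  ≤-trans (ℕ.+-mono-≤ (∈⇒count>0 P? x∈ px) (count-concat P? bs)) (≤-reflexive (sym (count-++ P? b (concat bs))))

rim₁ rim₂ : ∀ {n} → Triple n → Fin n
rim₁ (_ , x , _) = x
rim₂ (_ , _ , z) = z

OnRim : ∀ {n} → Fin n → Triple n → Set
OnRim x t = x ≡ rim₁ t ⊎ x ≡ rim₂ t

onRim? : ∀ {n} (x : Fin n) → Decidable (OnRim x)
onRim? x t = x F.≟ rim₁ t ⊎-dec x F.≟ rim₂ t

module Wheels {n} {G : TripleSystem n} {T : List (Triple n)} (oriented : Oriented G T)
  (separated : ∀ {t t'} → t ∈ T → t' ∈ T → e₃ t ∉ spokes t')
  (s j r W D h : ℕ)
  (cycle-length : suc j + suc j ≤ r)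
  (n<s^j : n < s ^ j)
  (spoke-codegree : ∀ {t p} → t ∈ T → p ∈ spokes t → codegree T p ≤ D)
  (rim-codegree : ∀ {t} → t ∈ T → codegree T (e₃ t) ≤ h * D)
  (h>0 : 0 < h)
  (dense : n * (2 * s * n) + 3 * (r * W * D) < length T) where

  open Oriented oriented

  record Wheel (b : Block n) : Set where
    field
      hub       : Fin n
      hubs      : ∀ {t} → t ∈ b → proj₁ t ≡ hub
      members   : ∀ {t} → t ∈ b → t ∈ T
      unique    : Unique b
      nonempty  : ∃[ t ] (t ∈ b)
      short     : length b ≤ r
      two       : ∀ {x t} → t ∈ b → OnRim x t → count (onRim? x) b ≡ 2
  open Wheel

  SpokeDisjoint : Rel (Block n) 0ℓ
  SpokeDisjoint b b' = ∀ {t t' p} → t ∈ b → t' ∈ b' → p ∈ spokes t → p ∉ spokes t'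

  usage : Pair n → List (Triple n) → ℕ
  usage p = count (λ t → e₃ t ≟ₚ p)

  -- Spokes are never shared, since they must be matched inside one wheel. Rim pairs are shared up
  -- to `h` times: these overlaps are the conflicts that leave real choices among wheels.
  record Family (Ws : List (Block n)) : Set where
    field
      wheels : All Wheel Ws
      disj   : AllPairs SpokeDisjoint Ws
      load   : ∀ p → usage p (concat Ws) ≤ h
  open Family

  same-rim : ∀ {t t'} → t ∈ T → t' ∈ T → proj₁ t ≡ proj₁ t' → e₃ t ≡ e₃ t' → t ≡ t'
  same-rim {y , x , z} {_ , x' , z'} t∈ t'∈ refl eq with pair-injective eq
  ... | inj₁ (refl , refl) = refl
  ... | inj₂ (refl , refl) = sameSet t∈ t'∈ λ v → swap₂₃ , swap₂₃

  -- The triples of a wheel have a common hub, so each is determined by its rim pair.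
  wheel-usage : ∀ {b} → Wheel b → ∀ p → usage p b ≤ 1
  wheel-usage {b} w p = count≤1 (λ t → e₃ t ≟ₚ p) (unique w) λ s∈ t∈ es et →
    same-rim (members w s∈) (members w t∈) (trans (hubs w s∈) (sym (hubs w t∈))) (trans es (sym et))

  module Extend (Ws : List (Block n)) (family : Family Ws) (few : length Ws ≤ W) where

    R : List (Triple n)
    R = concat Ws

    R⊆T : ∀ {t} → t ∈ R → t ∈ T
    R⊆T t∈ = let b , t∈b , b∈ = ∈-concat⁻′ Ws t∈ in members (All.lookup (wheels family) b∈) t∈b

    R-length : length R ≤ r * W
    R-length = ≤-trans (≤-reflexive (length-concat Ws)) (≤-trans (sum-≤ length r Ws (λ b∈ → short (All.lookup (wheels family) b∈)))
      (≤-trans (ℕ.*-monoˡ-≤ r few) (≤-reflexive (ℕ.*-comm W r))))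

    Meets : Triple n → Triple n → Set
    Meets t t' = Any (_∈ spokes t) (spokes t')

    meets? : Decidable₂ Meets
    meets? t t' = any? (_∈ₚ? spokes t) (spokes t')

    Blocked : Triple n → Set
    Blocked t = Any (Meets t) R

    Saturated : Triple n → Set
    Saturated t = h ≤ usage (e₃ t) R

    Alive : Triple n → Set
    Alive t = ¬ (Blocked t ⊎ Saturated t)

    blocked? : Decidable Blocked
    blocked? t = any? (meets? t) R

    saturated? : Decidable Saturated
    saturated? t = h ≤? usage (e₃ t) R

    dead? : Decidable (λ t → Blocked t ⊎ Saturated t)
    dead? t = blocked? t ⊎-dec saturated? t

    alive : List (Triple n)
    alive = filter (¬? ∘ dead?) T

    alive⊆T : ∀ {t} → t ∈ alive → t ∈ T
    alive⊆T t∈ = proj₁ (∈-filter⁻ (¬? ∘ dead?) {xs = T} t∈)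

    alive! : Unique alive
    alive! = Unique.filter⁺ (¬? ∘ dead?) uniqueT

    blocked-count : count blocked? T ≤ 2 * (r * W * D)
    blocked-count = begin
      count blocked? T ≤⟨ count-any meets? T R ⟩
      sum (map (λ t' → count (λ t → meets? t t') T) R) ≤⟨ sum-≤ _ (2 * D) R meets-count ⟩
      length R * (2 * D) ≤⟨ ℕ.*-monoˡ-≤ (2 * D) R-length ⟩
      r * W * (2 * D) ≡⟨ rearrange (r * W) D ⟩
      2 * (r * W * D) ∎
      where
      open ≤-Reasoning
      rearrange : ∀ a b → a * (2 * b) ≡ 2 * (a * b)
      rearrange = solve-∀
      spokes⊆pairs : ∀ {p} (t : Triple n) → p ∈ spokes t → p ∈ pairs t
      spokes⊆pairs t (here e) = here e
      spokes⊆pairs t (there (here e)) = there (here e)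
      meets-count : ∀ {t'} → t' ∈ R → count (λ t → meets? t t') T ≤ 2 * D
      meets-count {t'} t'∈ = begin
        count (λ t → meets? t t') T ≤⟨ count-any (λ t p → p ∈ₚ? spokes t) T (spokes t') ⟩
        sum (map (λ p → count (λ t → p ∈ₚ? spokes t) T) (spokes t'))
          ≤⟨ sum-≤ _ D (spokes t') (λ {p} p∈ → ≤-trans (count-cong (λ t → p ∈ₚ? spokes t) (λ t → p ∈ₚ? pairs t) T (λ {t} _ → spokes⊆pairs t)) (spoke-codegree (R⊆T t'∈) p∈)) ⟩
        2 * D ∎

    -- A saturated rim pair excludes up to `h * D` triples, but only after `h` uses. Averaged over
    -- the uses, a triple of the family excludes `D` triples by its rim, no more than by a single
    -- spoke.
    saturated-count : count saturated? T ≤ r * W * D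
    saturated-count = ℕ.*-cancelʳ-≤ _ _ h {{>-nonZero h>0}} (begin
      count saturated? T * h ≤⟨ sum-≥ (λ t → usage (e₃ t) R) h (filter saturated? T) (λ t∈ → proj₂ (∈-filter⁻ saturated? {xs = T} t∈)) ⟩
      sum (map (λ t → usage (e₃ t) R) (filter saturated? T)) ≡⟨ double-count (λ t t' → e₃ t' ≟ₚ e₃ t) (filter saturated? T) R ⟩
      sum (map (λ t' → count (λ t → e₃ t' ≟ₚ e₃ t) (filter saturated? T)) R) ≤⟨ sum-≤ _ (h * D) R same-count ⟩
      length R * (h * D) ≤⟨ ℕ.*-monoˡ-≤ (h * D) R-length ⟩
      r * W * (h * D) ≡⟨ rearrange (r * W) h D ⟩
      r * W * D * h ∎)
      where
      open ≤-Reasoning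
      rearrange : ∀ a b c → a * (b * c) ≡ a * c * b
      rearrange = solve-∀
      same-count : ∀ {t'} → t' ∈ R → count (λ t → e₃ t' ≟ₚ e₃ t) (filter saturated? T) ≤ h * D
      same-count {t'} t'∈ = ≤-trans (count-⊑ (λ t → e₃ t' ≟ₚ e₃ t) (Sublist.filter-⊆ saturated? T))
        (≤-trans (count-cong (λ t → e₃ t' ≟ₚ e₃ t) (λ t → e₃ t' ∈ₚ? pairs t) T (λ _ e → there (there (here e)))) (rim-codegree (R⊆T t'∈)))

    -- Each of the at most r W triples in use excludes 2D others by its spokes and D by its rim,
    -- which is the 3 in `dense`. What remains forces a hub whose link has degree sum above 2 s n.
    many-alive : n * (2 * s * n) < length alive
    many-alive = ℕ.+-cancelʳ-< (3 * (r * W * D)) _ _ (begin-strict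
      n * (2 * s * n) + 3 * (r * W * D) <⟨ dense ⟩
      length T ≡⟨ count-complement dead? T ⟩
      count dead? T + length alive
        ≤⟨ ℕ.+-monoˡ-≤ _ (≤-trans (count-⊎ dead? blocked? saturated? T (λ _ → id)) (ℕ.+-mono-≤ blocked-count saturated-count)) ⟩
      2 * (r * W * D) + r * W * D + length alive ≡⟨ rearrange (r * W * D) (length alive) ⟩
      length alive + 3 * (r * W * D) ∎)
      where
      open ≤-Reasoning
      rearrange : ∀ a b → 2 * a + a + b ≡ b + 3 * a
      rearrange = solve-∀

    module Link (y : Fin n) where

      _~_ : Rel (Fin n) 0ℓ
      u ~ v = (y , u , v) ∈ alive ⊎ (y , v , u) ∈ alive

      _~?_ : Decidable₂ _~_
      u ~? v = any? ((y , u , v) ≟₃_) alive ⊎-dec any? ((y , v , u) ≟₃_) alive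

      ~-irrefl : ∀ u → ¬ u ~ u
      ~-irrefl u (inj₁ t∈) = proj₁ (proj₂ (distinct (alive⊆T t∈))) refl
      ~-irrefl u (inj₂ t∈) = proj₁ (proj₂ (distinct (alive⊆T t∈))) refl

      open Graph _~?_ ⊎-swap ~-irrefl public

      edge : ∀ {u v} → u ~ v → Triple n
      edge {u} {v} (inj₁ _) = y , u , v
      edge {u} {v} (inj₂ _) = y , v , u

      edge-ends : ∀ {u v} (a : u ~ v) → (rim₁ (edge a) ≡ u × rim₂ (edge a) ≡ v) ⊎ (rim₁ (edge a) ≡ v × rim₂ (edge a) ≡ u)
      edge-ends (inj₁ _) = inj₁ (refl , refl)
      edge-ends (inj₂ _) = inj₂ (refl , refl)

      edge-alive : ∀ {u v} (a : u ~ v) → edge a ∈ alive × proj₁ (edge a) ≡ y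
      edge-alive (inj₁ t∈) = t∈ , refl
      edge-alive (inj₂ t∈) = t∈ , refl

      open Edges rim₁ rim₂ edge edge-ends public using (cycle-edges)

      link : List (Triple n)
      link = filter (λ t → proj₁ t F.≟ y) alive

      link-degrees : length link ≤ degree-sum (allFin n)
      link-degrees = ≤-trans (sum-fibres F._≟_ rim₁ (allFin n) link (λ _ → ∈-allFin _))
        (sum-mono _ (degree (allFin n)) (allFin n) (λ {u} _ → begin
          count (λ t → rim₁ t F.≟ u) link ≤⟨ unique⇒length≤ (Unique.filter⁺ _ (Unique.filter⁺ _ alive!)) (inside u) ⟩
          length (map (λ v → y , u , v) (filter (u ~?_) (allFin n))) ≡⟨ length-map _ (filter (u ~?_) (allFin n)) ⟩
          degree (allFin n) u ∎))
        where
        open ≤-Reasoning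
        inside : ∀ u {t} → t ∈ filter (λ t → rim₁ t F.≟ u) link → t ∈ map (λ v → y , u , v) (filter (u ~?_) (allFin n))
        inside u {t} t∈ =
          let t∈' , x≡u = ∈-filter⁻ (λ t → rim₁ t F.≟ u) {xs = link} t∈
              t∈″ , y≡ = ∈-filter⁻ (λ t → proj₁ t F.≟ y) {xs = alive} t∈'
          in joins t∈″ y≡ x≡u
          where
          joins : ∀ {t} → t ∈ alive → proj₁ t ≡ y → rim₁ t ≡ u → t ∈ map (λ v → y , u , v) (filter (u ~?_) (allFin n))
          joins t∈ refl refl = ∈-map⁺ _ (∈-filter⁺ (u ~?_) (∈-allFin _) (inj₁ t∈))

    wheel-at : ∀ y → length alive ≤ length (allFin n) * length (Link.link y) →
      ¬ ¬ (∃[ b ] (Wheel b × (∀ {t} → t ∈ b → t ∈ alive)))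
    wheel-at y large = ¬¬-map make (short-cycle s j link-dense n<s^j)
      where
      open Link y
      link-dense : 2 * s * n < degree-sum (allFin n)
      link-dense = ≤-trans (ℕ.*-cancelˡ-< n _ _ (≤-trans many-alive
        (≤-trans large (≤-reflexive (cong (_* length link) (length-tabulate {n = n} id)))))) link-degrees
      inhabited : ∀ {b : Block n} → 0 < length b → ∃[ t ] (t ∈ b)
      inhabited {t ∷ _} _ = t , here refl
      make : ∃[ c ] (Cycle c × length c ≤ suc j + suc j) → ∃[ b ] (Wheel b × (∀ {t} → t ∈ b → t ∈ alive))
      make (c , cyc , le) =
        let b , b! , all , pos , len , two = cycle-edges (λ t → t ∈ alive × proj₁ t ≡ y) edge-alive cyc
        in b , record { hub = y ; hubs = λ t∈ → proj₂ (All.lookup all t∈) ; members = λ t∈ → alive⊆T (proj₁ (All.lookup all t∈))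
                      ; unique = b! ; nonempty = inhabited pos ; short = ≤-trans len (≤-trans le cycle-length) ; two = two }
             , λ t∈ → proj₁ (All.lookup all t∈)

    new-wheel : ¬ ¬ (∃[ b ] (Wheel b × (∀ {t} → t ∈ b → t ∈ alive)))
    new-wheel =
      let t₀ , _ = count>0⇒∈ (¬? ∘ dead?) T (≤-trans (s≤s z≤n) many-alive)
          y , large = large-fibre F._≟_ proj₁ (allFin n) alive (λ _ → ∈-allFin _) (∈-length (∈-allFin (proj₁ t₀)))
      in wheel-at y large

    extend : ¬ ¬ (∃[ b ] Family (b ∷ Ws))
    extend = ¬¬-map (λ { (b , wheel , live) → b , record
      { wheels = wheel ∷ wheels family
      ; disj = All.tabulate (λ b'∈ t∈ t'∈ p∈ p∈' → not-dead (live t∈) (inj₁ (lose (∈-concat⁺′ t'∈ b'∈) (lose p∈' p∈)))) ∷ disj family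
      ; load = λ p → ≤-trans (≤-reflexive (count-++ _ b R)) (new-load b wheel live p) } }) new-wheel
      where
      not-dead : ∀ {t} → t ∈ alive → Alive t
      not-dead t∈ = proj₂ (∈-filter⁻ (¬? ∘ dead?) {xs = T} t∈)
      new-load : ∀ b → Wheel b → (∀ {t} → t ∈ b → t ∈ alive) → ∀ p → usage p b + usage p R ≤ h
      new-load b wheel live p with usage p b in eq | wheel-usage wheel p
      ... | zero | _ = load family p
      ... | suc zero | _ with count>0⇒∈ (λ t → e₃ t ≟ₚ p) b (≤-trans (s≤s z≤n) (≤-reflexive (sym eq)))
      ... | t , t∈ , refl = ℕ.≰⇒> (λ le → not-dead (live t∈) (inj₂ le))
      new-load b wheel live p | suc (suc _) | s≤s ()

  many-wheels : ∀ k → k ≤ W → ¬ ¬ (∃[ Ws ] (Family Ws × length Ws ≡ k))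
  many-wheels zero _ none = none ([] , record { wheels = [] ; disj = [] ; load = λ _ → z≤n } , refl)
  many-wheels (suc k) k<W none = many-wheels k (ℕ.<⇒≤ k<W) λ { (Ws , family , refl) →
    Extend.extend Ws family (ℕ.<⇒≤ k<W) λ { (b , family') → none (b ∷ Ws , family' , refl) } }

  module System (Ws : List (Block n)) (family : Family Ws) where

    wheel : ∀ {b} → b ∈ Ws → Wheel b
    wheel = All.lookup (wheels family)

    shared-spoke : ∀ {b b' t t' p} → b ∈ Ws → b' ∈ Ws → t ∈ b → t' ∈ b' → p ∈ spokes t → p ∈ spokes t' → b ≡ b'
    shared-spoke {b} {b'} b∈ b'∈ t∈ t'∈ p∈ p∈' with b ≟ᵇ b'
    ... | yes e = e
    ... | no ne = contradiction p∈' (allPairs-lookup {R = SpokeDisjoint} (λ d x y p q → d y x q p) (disj family) b∈ b'∈ ne t∈ t'∈ p∈)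

    family-unique : Unique Ws
    family-unique = go (wheels family) (disj family)
      where
      go : ∀ {Vs} → All Wheel Vs → AllPairs SpokeDisjoint Vs → Unique Vs
      go [] [] = []
      go (w ∷ ws) (d ∷ ds) = All.map (λ { dis refl → let t , t∈ = nonempty w in dis t∈ t∈ (here refl) (here refl) }) d ∷ go ws ds

    spoke-or-rim : ∀ {p} (t : Triple n) → p ∈ pairs t → p ∈ spokes t ⊎ p ≡ e₃ t
    spoke-or-rim t (here e) = inj₁ (here e)
    spoke-or-rim t (there (here e)) = inj₁ (there (here e))
    spoke-or-rim t (there (there (here e))) = inj₂ e

    spoke-end : ∀ {p} (t : Triple n) → p ∈ spokes t → ∃[ x ] (OnRim x t × p ≡ pair (proj₁ t) x)
    spoke-end (y , x , z) (here refl) = x , inj₁ refl , refl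
    spoke-end (y , x , z) (there (here refl)) = z , inj₂ refl , refl

    on-rim : ∀ {x} (t : Triple n) → x ∈₃ t → x ≢ proj₁ t → OnRim x t
    on-rim t (inj₁ e) ne = contradiction e ne
    on-rim t (inj₂ i) ne = i

    -- A rim vertex lies on exactly two triples of its wheel, which matches its spoke there.
    -- Spoke-disjointness keeps the spoke out of other wheels, and `separated` keeps it from being a
    -- rim pair anywhere. A rim pair occurs once per wheel and so is a key.
    system : BlockSystem T Ws (λ t u v → pair u v ≡ e₃ t)
    system = record
      { distinct = distinct ; sameSet = sameSet ; sub = λ b∈ → members (wheel b∈)
      ; disjoint = λ b∈ b'∈ t∈ t∈' → shared-spoke b∈ b'∈ t∈ t∈' (here refl) (here refl)
      ; kind = kind }
      where
      kind : ∀ {b t u v} → b ∈ Ws → t ∈ b → u ≢ v → u ∈₃ t → v ∈₃ t →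
        (∃[ t' ] (t' ∈ b × t' ≢ t × u ∈₃ t' × v ∈₃ t' ×
           (∀ {b' s} → b' ∈ Ws → s ∈ b' → u ∈₃ s → v ∈₃ s → s ≡ t ⊎ s ≡ t')))
        ⊎ (pair u v ≡ e₃ t × (∀ {s} → s ∈ b → u ∈₃ s → v ∈₃ s → s ≡ t))
      kind {b} {t} {u} {v} b∈ t∈ ne u∈ v∈ with spoke-or-rim t (pair∈pairs t ne u∈ v∈)
      ... | inj₂ e = inj₂ (e , only)
        where
        only : ∀ {s} → s ∈ b → u ∈₃ s → v ∈₃ s → s ≡ t
        only {s} s∈ us vs with spoke-or-rim s (pair∈pairs s ne us vs)
        ... | inj₁ p∈ = contradiction (subst (_∈ spokes s) e p∈) (separated (members (wheel b∈) t∈) (members (wheel b∈) s∈))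
        ... | inj₂ e' = same-rim (members (wheel b∈) s∈) (members (wheel b∈) t∈)
                          (trans (hubs (wheel b∈) s∈) (sym (hubs (wheel b∈) t∈))) (trans (sym e') e)
      ... | inj₁ p∈ with spoke-end t p∈
      ... | x , x-on , p≡ with count≡2 (onRim? x) (unique (wheel b∈)) (two (wheel b∈) t∈ x-on) t∈ x-on
      ... | t' , t'∈ , t'≢t , x-on' , only =
        inj₁ (t' , t'∈ , t'≢t , proj₁ uv∈ , proj₂ uv∈ , only')
        where
        same-hub : proj₁ t ≡ proj₁ t'
        same-hub = trans (hubs (wheel b∈) t∈) (sym (hubs (wheel b∈) t'∈))
        uv∈ : u ∈₃ t' × v ∈₃ t'
        uv∈ = pair-⊆ {P = _∈₃ t'} p≡ (inj₁ same-hub) (inj₂ x-on')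
        x≢hub : ∀ {t} → t ∈ T → OnRim x t → x ≢ proj₁ t
        x≢hub t∈ (inj₁ refl) e = proj₁ (distinct t∈) (sym e)
        x≢hub t∈ (inj₂ refl) e = proj₂ (proj₂ (distinct t∈)) (sym e)
        only' : ∀ {b' s} → b' ∈ Ws → s ∈ b' → u ∈₃ s → v ∈₃ s → s ≡ t ⊎ s ≡ t'
        only' {b'} {s} b'∈ s∈ us vs with spoke-or-rim s (pair∈pairs s ne us vs)
        ... | inj₂ e = contradiction (subst (_∈ spokes t) e p∈) (separated (members (wheel b'∈) s∈) (members (wheel b∈) t∈))
        ... | inj₁ p∈' with shared-spoke b∈ b'∈ t∈ s∈ p∈ p∈'
        ... | refl = only s∈ (on-rim s (proj₂ (pair-⊆ {P = _∈₃ s} (sym p≡) us vs))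
                       (λ e → x≢hub (members (wheel b∈) t∈) x-on (trans e (trans (hubs (wheel b∈) s∈) (sym (hubs (wheel b∈) t∈))))))

    -- Different wheels can only conflict along a rim pair, and each of at most `r` rim pairs of a
    -- wheel is used at most `h` times.
    conflict-count : ∀ {b} → b ∈ Ws → count (conflict? b) Ws ≤ r * h
    conflict-count {b} b∈ = begin
      count (conflict? b) Ws ≤⟨ count-cong (conflict? b) _ Ws common-rim ⟩
      count (λ b' → any? (λ t → any? (λ t' → e₃ t' ≟ₚ e₃ t) b') b) Ws ≤⟨ count-any (λ b' t → any? (λ t' → e₃ t' ≟ₚ e₃ t) b') Ws b ⟩
      sum (map (λ t → count (λ b' → any? (λ t' → e₃ t' ≟ₚ e₃ t) b') Ws) b)
        ≤⟨ sum-≤ _ h b (λ {t} _ → ≤-trans (count-concat (λ t' → e₃ t' ≟ₚ e₃ t) Ws) (load family (e₃ t))) ⟩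
      length b * h ≤⟨ ℕ.*-monoˡ-≤ h (short (wheel b∈)) ⟩
      r * h ∎
      where
      open ≤-Reasoning
      common-rim : ∀ {b'} → b' ∈ Ws → Conflict b b' → Any (λ t → Any (λ t' → e₃ t' ≡ e₃ t) b') b
      common-rim {b'} b'∈ c with conflict⁻ c
      ... | t , t' , t∈ , t'∈ , adj with adjacent⇒common-pair adj
      ... | p , p∈ , p∈' with spoke-or-rim t p∈ | spoke-or-rim t' p∈'
      ... | inj₁ q | inj₂ refl = contradiction q (separated (members (wheel b'∈) t'∈) (members (wheel b∈) t∈))
      ... | inj₂ refl | inj₁ q = contradiction q (separated (members (wheel b∈) t∈) (members (wheel b'∈) t'∈))
      ... | inj₂ e | inj₂ e' = lose t∈ (lose t'∈ (trans (sym e') e))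
      ... | inj₁ q | inj₁ q' with shared-spoke b∈ b'∈ t∈ t'∈ q q'
      -- A common spoke forces the two wheels to be one, which shares every rim pair with itself.
      ... | refl = lose t∈ (lose t∈ refl)

    -- A family of `m` wheels may have `r * m` keys, so key sets are counted with exponent `r * m`
    -- against `m` for the choices. Only a large `h` makes up for this, and it needs `r` to be
    -- bounded.
    wheel-immersion : ∀ m (U : List (Pair n)) v → Unique U → (∀ {t} → t ∈ T → e₃ t ∈ U) → 0 < v →
      length U ≤ r * m * (v + v) → m * (r * h + r * h) ≤ length Ws → (4 * (v + v)) ^ (r * m) < (r * h) ^ m →
      ContainsSurfaceImmersion G
    wheel-immersion m U v u into v>0 lenU size few =
      let M , M' , allM , allM' , cM , cM' , eq , b , b∈ , b∉ = equal-codes conflict? (r * h) (r * h) m family-unique conflict-count size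
            code (subsets (length U) (r * m)) code∈ (≤-trans (s≤s (subsets-≤ v (length U) (r * m) v>0 lenU)) few)
      in difference⇒immersion system in-G allM allM' cM cM' (covers eq allM) (covers (sym eq) allM')
           (b , b∈ , b∉ , nonempty (wheel (All.lookup allM b∈)))
      where
      code : List (Block n) → List Bool
      code M = indicator _≟ₚ_ U (map e₃ (concat M))
      code∈ : ∀ {M} → length M ≡ m → All (_∈ Ws) M → code M ∈ subsets (length U) (r * m)
      code∈ {M} refl all = indicator-∈ _≟ₚ_ (map e₃ (concat M)) (r * m) u (begin
        length (map e₃ (concat M)) ≡⟨ trans (length-map e₃ (concat M)) (length-concat M) ⟩
        sum (map length M) ≤⟨ sum-≤ length r M (λ b∈ → short (wheel (All.lookup all b∈))) ⟩
        m * r ≡⟨ ℕ.*-comm m r ⟩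
        r * m ∎)
        where open ≤-Reasoning
      covers : ∀ {M M'} → code M ≡ code M' → All (_∈ Ws) M → Covers system M M'
      covers {M} {M'} eq all {t = t} b∈ t∈ ne u∈ v∈ key =
        let s , s∈ , es = ∈-map⁻ e₃ (indicator-≡ _≟ₚ_ U eq (into (members (wheel (All.lookup all b∈)) t∈)) (∈-map⁺ e₃ (∈-concat⁺′ t∈ b∈)))
            b' , s∈b' , b'∈ = ∈-concat⁻′ M' s∈
            us , vs = pair∈pairs⁻ s (there (there (here (trans key es))))
        in b' , s , b'∈ , s∈b' , us , vs

  unbalanced : ∀ m (U : List (Pair n)) v → Unique U → (∀ {t} → t ∈ T → e₃ t ∈ U) → 0 < v →
    length U ≤ r * m * (v + v) → m * (r * h + r * h) ≤ W → (4 * (v + v)) ^ (r * m) < (r * h) ^ m →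
    ¬ ¬ ContainsSurfaceImmersion G
  unbalanced m U v u into v>0 lenU size few = ¬¬-map
    (λ { (Ws , family , refl) → System.wheel-immersion Ws family m U v u into v>0 lenU size few }) (many-wheels W ≤-refl)

-- Arithmetic

quotient : ∀ a b → 0 < b → b ≤ a → ∃[ x ] (0 < x × x * b ≤ a × a ≤ 2 * x * b)
quotient a b@(suc _) b>0 b≤a = x , x>0 , m/n*n≤m a b , bound x>0 below
  where
  open ≤-Reasoning
  x = a / b
  below : a ≤ b + x * b
  below = ≤-trans (≤-reflexive (m≡m%n+[m/n]*n a b)) (ℕ.+-monoˡ-≤ (x * b) (ℕ.<⇒≤ (m%n<n a b)))
  x>0 : 0 < x
  x>0 = m≥n⇒m/n>0 b≤a
  bound : ∀ {x} → 0 < x → a ≤ b + x * b → a ≤ 2 * x * b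
  bound {suc x} _ le = ≤-trans le (≤-trans (ℕ.m≤m+n _ (x * b)) (≤-reflexive (expand b x)))
    where
    expand : ∀ b x → b + suc x * b + x * b ≡ 2 * suc x * b
    expand = solve-∀

root : ∀ Q s n b → 0 < s → n < b ^ s → Q ^ s ≤ n → ∃[ q ] (Q ≤ q × q ^ s ≤ n × n < suc q ^ s)
root Q (suc s) n zero _ () _
root Q s n (suc b) s>0 n< Q≤ with b ^ s ≤? n
... | no nle = root Q s n b s>0 (ℕ.≰⇒> nle) Q≤
... | yes le = b , ℕ.≮⇒≥ (λ b<Q → ℕ.<⇒≱ n< (≤-trans (ℕ.^-monoˡ-≤ s b<Q) Q≤)) , le , n<

abstract
  -- The integer part of the logarithm of `d` to base `q`, searched downwards from `b`.
  level : ℕ → ℕ → ℕ → ℕ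
  level q zero    d = 0
  level q (suc b) d with q ^ b ≤? d
  ... | yes _ = b
  ... | no _  = level q b d

  level-spec : ∀ q b d → 0 < d → d < q ^ b → q ^ level q b d ≤ d × d < q ^ suc (level q b d)
  level-spec q zero d d>0 d< = contradiction d< (ℕ.≤⇒≯ d>0)
  level-spec q (suc b) d d>0 d< with q ^ b ≤? d
  ... | yes le = le , d<
  ... | no nle = level-spec q b d d>0 (ℕ.≰⇒> nle)

  level-≤ : ∀ q b d → level q b d ≤ b
  level-≤ q zero d = z≤n
  level-≤ q (suc b) d with q ^ b ≤? d
  ... | yes _ = ℕ.n≤1+n b
  ... | no _ = ℕ.m≤n⇒m≤1+n (level-≤ q b d)

^-positive : ∀ q d → 0 < q → 0 < q ^ d
^-positive q d q>0 = ℕ.m^n>0 q {{>-nonZero q>0}} d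

^-∸-* : ∀ q {a b} → a ≤ b → q ^ (b ∸ a) * q ^ a ≡ q ^ b
^-∸-* q {a} {b} a≤b = trans (sym (ℕ.^-distribˡ-+-* q (b ∸ a) a)) (cong (q ^_) (ℕ.m∸n+n≡m a≤b))

m≤m*n⁺ : ∀ m {n} → 0 < n → m ≤ m * n
m≤m*n⁺ m n>0 = ℕ.m≤m*n m _ {{>-nonZero n>0}}

-- Choice of the numerical parameters

module Parameters (K r q t : ℕ) (K>0 : 0 < K) (r>0 : 0 < r) (Kr≤q : 576 * K * r * r ≤ q) where

  open ≤-Reasoning

  576Kr≤q : 576 * K * r ≤ q
  576Kr≤q = ≤-trans (m≤m*n⁺ (576 * K * r) r>0) Kr≤q

  576K≤q : 576 * K ≤ q
  576K≤q = ≤-trans (m≤m*n⁺ (576 * K) r>0) 576Kr≤q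

  2≤q : 2 ≤ q
  2≤q = ≤-trans (ℕ.≤-trans (ℕ.m≤m+n 2 574) (m≤m*n⁺ 576 K>0)) 576K≤q

  q>0 : 0 < q
  q>0 = ≤-trans (s≤s z≤n) 2≤q

  unbalanced-parameters : ∀ n u d₂ d₃ σ → 0 < n → 2 ≤ σ → n * n * q ^ suc σ < K * t → q ^ d₃ ≤ n →
    u * q ^ d₃ ≤ 3 * (K * t) → d₂ + suc (r + r) ≤ d₃ →
    let h = q ^ (d₃ ∸ d₂) in
    ∃[ W ] ∃[ m ] ∃[ v ] (0 < v × n * (2 * q ^ σ * n) + 3 * (r * W * q ^ suc d₂) < t × u ≤ r * m * (v + v) ×
      m * (r * h + r * h) ≤ W × (4 * (v + v)) ^ (r * m) < (r * h) ^ m)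
  unbalanced-parameters n u d₂ d₃ σ n>0 2≤σ large P₃≤n u≤ gap =
    W , m , v , v>0 , dense , u-bound , m-below , few
    where
    h = q ^ (d₃ ∸ d₂)
    P₂ = q ^ d₂
    P₃ = q ^ d₃
    d₂≤d₃ : d₂ ≤ d₃
    d₂≤d₃ = ≤-trans (ℕ.m≤m+n d₂ (suc (r + r))) gap
    hP₂ : h * P₂ ≡ P₃
    hP₂ = ^-∸-* q d₂≤d₃
    P₂>0 = ^-positive q d₂ q>0
    P₃>0 = ^-positive q d₃ q>0
    h>0 = ^-positive q (d₃ ∸ d₂) q>0
    -- Makes the quotients `W` and `m` below positive; the square of `r` in the bound on `q` is
    -- spent here.
    big : 24 * (r * r) * (q * P₃) ≤ t
    big = ℕ.*-cancelˡ-≤ K {{>-nonZero K>0}} (begin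
      K * (24 * (r * r) * (q * P₃)) ≡⟨ solve₁ K r (q * P₃) ⟩
      24 * (K * r * r) * (q * P₃) ≤⟨ ℕ.*-monoˡ-≤ (q * P₃) (ℕ.*-monoˡ-≤ (K * r * r) (ℕ.m≤m+n 24 552)) ⟩
      576 * (K * r * r) * (q * P₃) ≡⟨ cong (_* (q * P₃)) (solve₂ K r) ⟩
      576 * K * r * r * (q * P₃) ≤⟨ ℕ.*-mono-≤ Kr≤q (ℕ.*-monoʳ-≤ q (≤-trans P₃≤n (m≤m*n⁺ n n>0))) ⟩
      q * (q * (n * n)) ≡⟨ solve₃ q (n * n) ⟩
      n * n * q ^ 2 ≤⟨ ℕ.*-monoʳ-≤ (n * n) (ℕ.^-monoʳ-≤ q {{>-nonZero q>0}} (ℕ.m≤n⇒m≤1+n 2≤σ)) ⟩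
      n * n * q ^ suc σ ≤⟨ ℕ.<⇒≤ large ⟩
      K * t ∎)
      where
      solve₁ : ∀ K r x → K * (24 * (r * r) * x) ≡ 24 * (K * r * r) * x
      solve₁ = solve-∀
      solve₂ : ∀ K r → 576 * (K * r * r) ≡ 576 * K * r * r
      solve₂ = solve-∀
      solve₃ : ∀ q x → q * (q * x) ≡ x * (q * (q * 1))
      solve₃ = solve-∀
    rqP₂>0 : 0 < r * (q * P₂)
    rqP₂>0 = ℕ.*-mono-< r>0 (ℕ.*-mono-< q>0 P₂>0)
    -- Half of the `t` triples may be used up or excluded by the `W` wheels, hence 6 = 2 * 3; the
    -- other half keeps the links dense.
    W-quotient = quotient t (6 * (r * (q * P₂))) (ℕ.*-mono-< (s≤s (z≤n {5})) rqP₂>0) (≤-trans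
      (ℕ.*-mono-≤ (ℕ.m≤m+n 6 18) (ℕ.*-mono-≤ (m≤m*n⁺ r r>0) (ℕ.*-monoʳ-≤ q (ℕ.^-monoʳ-≤ q {{>-nonZero q>0}} d₂≤d₃))))
      (≤-trans (≤-reflexive (sym (ℕ.*-assoc 24 (r * r) (q * P₃)))) big))
    W = proj₁ W-quotient
    W-below : W * (6 * (r * (q * P₂))) ≤ t
    W-below = proj₁ (proj₂ (proj₂ W-quotient))
    W-above : t ≤ 2 * W * (6 * (r * (q * P₂)))
    W-above = proj₂ (proj₂ (proj₂ W-quotient))
    2rh≤W : r * h + r * h ≤ W
    2rh≤W = ℕ.*-cancelʳ-≤ _ _ (12 * (r * (q * P₂))) {{>-nonZero (ℕ.*-mono-< (s≤s (z≤n {11})) rqP₂>0)}} (begin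
      (r * h + r * h) * (12 * (r * (q * P₂))) ≡⟨ solve₁ r h q P₂ ⟩
      24 * (r * r) * (q * (h * P₂)) ≡⟨ cong (λ z → 24 * (r * r) * (q * z)) hP₂ ⟩
      24 * (r * r) * (q * P₃) ≤⟨ big ⟩
      t ≤⟨ W-above ⟩
      2 * W * (6 * (r * (q * P₂))) ≡⟨ solve₂ W (r * (q * P₂)) ⟩
      W * (12 * (r * (q * P₂))) ∎)
      where
      solve₁ : ∀ r h q p → (r * h + r * h) * (12 * (r * (q * p))) ≡ 24 * (r * r) * (q * (h * p))
      solve₁ = solve-∀
      solve₂ : ∀ w x → 2 * w * (6 * x) ≡ w * (12 * x)
      solve₂ = solve-∀
    rh>0 : 0 < r * h
    rh>0 = ℕ.*-mono-< r>0 h>0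
    m-quotient = quotient W (r * h + r * h) (≤-trans rh>0 (ℕ.m≤m+n _ _)) 2rh≤W
    m = proj₁ m-quotient
    m>0 : 0 < m
    m>0 = proj₁ (proj₂ m-quotient)
    m-below : m * (r * h + r * h) ≤ W
    m-below = proj₁ (proj₂ (proj₂ m-quotient))
    m-above : W ≤ 2 * m * (r * h + r * h)
    m-above = proj₂ (proj₂ (proj₂ m-quotient))
    -- Inserting t ≤ 12 r q P₂ W and W ≤ 4 r h m into u P₃ ≤ 3 K t gives u ≤ r m (144 K r q), and
    -- 144 = 2 * 72. Then 4 (v + v) = 576 K r q, the origin of the constant demanded of `q`.
    v = 72 * (K * r * q)
    v>0 : 0 < v
    v>0 = ℕ.*-mono-< (s≤s (z≤n {71})) (ℕ.*-mono-< (ℕ.*-mono-< K>0 r>0) q>0)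
    dense : n * (2 * q ^ σ * n) + 3 * (r * W * q ^ suc d₂) < t
    dense = ℕ.*-cancelˡ-< 2 _ _ (begin-strict
      2 * (n * (2 * q ^ σ * n) + 3 * (r * W * (q * P₂))) ≡⟨ solve₁ n (q ^ σ) r W (q * P₂) ⟩
      4 * (n * n * q ^ σ) + W * (6 * (r * (q * P₂))) <⟨ ℕ.+-mono-<-≤ small W-below ⟩
      t + t ≡⟨ cong (t +_) (ℕ.+-identityʳ t) ⟨
      2 * t ∎)
      where
      solve₁ : ∀ n s r w x → 2 * (n * (2 * s * n) + 3 * (r * w * x)) ≡ 4 * (n * n * s) + w * (6 * (r * x))
      solve₁ = solve-∀
      solve₂ : ∀ K x s → K * (4 * (x * s)) ≡ x * (4 * K * s)
      solve₂ = solve-∀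
      -- The links only need `q ^ σ`; the spare factor `q` in the density pays for `K` and the
      -- constant.
      small : 4 * (n * n * q ^ σ) < t
      small = ℕ.*-cancelˡ-< K _ _ (begin-strict
        K * (4 * (n * n * q ^ σ)) ≡⟨ solve₂ K (n * n) (q ^ σ) ⟩
        n * n * (4 * K * q ^ σ) ≤⟨ ℕ.*-monoʳ-≤ (n * n) (ℕ.*-monoˡ-≤ (q ^ σ) (≤-trans (ℕ.*-monoˡ-≤ K (ℕ.m≤m+n 4 572)) 576K≤q)) ⟩
        n * n * q ^ suc σ <⟨ large ⟩
        K * t ∎)
    u-bound : u ≤ r * m * (v + v)
    u-bound = ℕ.*-cancelʳ-≤ _ _ P₃ {{>-nonZero P₃>0}} (begin
      u * P₃ ≤⟨ u≤ ⟩
      3 * (K * t) ≤⟨ ℕ.*-monoʳ-≤ 3 (ℕ.*-monoʳ-≤ K (≤-trans W-above (ℕ.*-monoˡ-≤ (6 * (r * (q * P₂))) (ℕ.*-monoʳ-≤ 2 m-above)))) ⟩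
      3 * (K * (2 * (2 * m * (r * h + r * h)) * (6 * (r * (q * P₂))))) ≡⟨ solve₁ K m r h q P₂ ⟩
      r * m * (v + v) * (h * P₂) ≡⟨ cong (r * m * (v + v) *_) hP₂ ⟩
      r * m * (v + v) * P₃ ∎)
      where
      solve₁ : ∀ K m r h q p → 3 * (K * (2 * (2 * m * (r * h + r * h)) * (6 * (r * (q * p))))) ≡
        r * m * (72 * (K * r * q) + 72 * (K * r * q)) * (h * p)
      solve₁ = solve-∀
    few : (4 * (v + v)) ^ (r * m) < (r * h) ^ m
    few = begin-strict
      (4 * (v + v)) ^ (r * m) ≡⟨ ℕ.^-*-assoc (4 * (v + v)) r m ⟨
      ((4 * (v + v)) ^ r) ^ m <⟨ ℕ.^-monoˡ-< m {{>-nonZero m>0}} base ⟩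
      (r * h) ^ m ∎
      where
      solve₁ : ∀ K r q → 4 * (72 * (K * r * q) + 72 * (K * r * q)) ≡ 576 * K * r * q
      solve₁ = solve-∀
      -- The keys of one wheel cost at most `q ^ (r + r)`, so a gap of one level more suffices. This
      -- sets the threshold between the two cases.
      base : (4 * (v + v)) ^ r < r * h
      base = begin-strict
        (4 * (v + v)) ^ r ≡⟨ cong (_^ r) (solve₁ K r q) ⟩
        (576 * K * r * q) ^ r ≤⟨ ℕ.^-monoˡ-≤ r (ℕ.*-monoˡ-≤ q 576Kr≤q) ⟩
        (q * q) ^ r ≡⟨ trans (^-distribʳ-* q q r) (sym (ℕ.^-distribˡ-+-* q r r)) ⟩
        q ^ (r + r) <⟨ ℕ.^-monoʳ-< q 2≤q (ℕ.n<1+n (r + r)) ⟩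
        q ^ suc (r + r) ≤⟨ ℕ.^-monoʳ-≤ q {{>-nonZero q>0}} (≤-trans (≤-reflexive (sym (ℕ.m+n∸m≡n d₂ _))) (ℕ.∸-monoˡ-≤ d₂ gap)) ⟩
        h ≤⟨ ℕ.m≤n*m h r {{>-nonZero r>0}} ⟩
        r * h ∎

  balanced-parameters : ∀ n u₁ u₂ u₃ d₁ d₂ d₃ σ → 0 < n → 2 ≤ σ → n * n * q ^ suc σ < K * t → q ^ d₃ ≤ n →
    u₁ * q ^ d₁ ≤ 3 * (K * t) → u₂ * q ^ d₂ ≤ 3 * (K * t) → u₃ * q ^ d₃ ≤ 3 * (K * t) →
    d₁ ≤ d₂ → d₂ ≤ d₃ → d₃ ≤ d₂ + (r + r) → 5 + (r + r) ≤ d₁ →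
    let D = q ^ suc d₃ in
    ∃[ m ] ∃[ v₁ ] ∃[ v₂ ] ∃[ v₃ ] (0 < v₁ × 0 < v₂ × 0 < v₃ ×
      u₁ ≤ m * (v₁ + v₁) × u₂ ≤ m * (v₂ + v₂) × u₃ ≤ m * (v₃ + v₃) × m * (3 * D + 3 * D) ≤ t ×
      (4 * (v₁ + v₁)) ^ m * ((4 * (v₂ + v₂)) ^ m * (4 * (v₃ + v₃)) ^ m) < (3 * D) ^ m)
  balanced-parameters n u₁ u₂ u₃ d₁ d₂ d₃ σ n>0 2≤σ large P₃≤n u₁≤ u₂≤ u₃≤ d₁≤d₂ d₂≤d₃ gap deep =
    m , v d₁ , v d₂ , v d₃ , v>0 d₁ , v>0 d₂ , v>0 d₃ ,
    u-bound (≤-trans d₁≤d₂ d₂≤d₃) u₁≤ , u-bound d₂≤d₃ u₂≤ , u-bound ≤-refl u₃≤ , m-below , few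
    where
    D = q ^ suc d₃
    D>0 = ^-positive q (suc d₃) q>0
    6D≤t : 3 * D + 3 * D ≤ t
    6D≤t = ℕ.*-cancelˡ-≤ K {{>-nonZero K>0}} (begin
      K * (3 * (q * q ^ d₃) + 3 * (q * q ^ d₃)) ≡⟨ solve₁ K q (q ^ d₃) ⟩
      6 * K * (q * q ^ d₃) ≤⟨ ℕ.*-mono-≤ (≤-trans (ℕ.*-monoˡ-≤ K (ℕ.m≤m+n 6 570)) 576K≤q) (ℕ.*-monoʳ-≤ q (≤-trans P₃≤n (m≤m*n⁺ n n>0))) ⟩
      q * (q * (n * n)) ≡⟨ solve₃ q (n * n) ⟩
      n * n * q ^ 2 ≤⟨ ℕ.*-monoʳ-≤ (n * n) (ℕ.^-monoʳ-≤ q {{>-nonZero q>0}} (ℕ.m≤n⇒m≤1+n 2≤σ)) ⟩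
      n * n * q ^ suc σ ≤⟨ ℕ.<⇒≤ large ⟩
      K * t ∎)
      where
      solve₁ : ∀ K q p → K * (3 * (q * p) + 3 * (q * p)) ≡ 6 * K * (q * p)
      solve₁ = solve-∀
      solve₃ : ∀ q x → q * (q * x) ≡ x * (q * (q * 1))
      solve₃ = solve-∀
    m-quotient = quotient t (3 * D + 3 * D) (≤-trans (ℕ.*-mono-< (s≤s (z≤n {2})) D>0) (ℕ.m≤m+n _ _)) 6D≤t
    m = proj₁ m-quotient
    m>0 : 0 < m
    m>0 = proj₁ (proj₂ m-quotient)
    m-below : m * (3 * D + 3 * D) ≤ t
    m-below = proj₁ (proj₂ (proj₂ m-quotient))
    m-above : t ≤ 2 * m * (3 * D + 3 * D)
    m-above = proj₂ (proj₂ (proj₂ m-quotient))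
    v : ℕ → ℕ
    -- From t ≤ 12 m D one gets u q^d ≤ 36 K m D, where D is `q ^ suc (d₃ ∸ d)` times q^d, and 36 =
    -- 2 * 18.
    v d = 18 * (K * q ^ suc (d₃ ∸ d))
    v>0 : ∀ d → 0 < v d
    v>0 d = ℕ.*-mono-< (s≤s (z≤n {17})) (ℕ.*-mono-< K>0 (^-positive q (suc (d₃ ∸ d)) q>0))
    u-bound : ∀ {u d} → d ≤ d₃ → u * q ^ d ≤ 3 * (K * t) → u ≤ m * (v d + v d)
    u-bound {u} {d} d≤d₃ u≤ = ℕ.*-cancelʳ-≤ _ _ (q ^ d) {{>-nonZero (^-positive q d q>0)}} (begin
      u * q ^ d ≤⟨ u≤ ⟩
      3 * (K * t) ≤⟨ ℕ.*-monoʳ-≤ 3 (ℕ.*-monoʳ-≤ K m-above) ⟩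
      3 * (K * (2 * m * (3 * D + 3 * D))) ≡⟨ cong (λ z → 3 * (K * (2 * m * (3 * (q * z) + 3 * (q * z))))) (^-∸-* q d≤d₃) ⟨
      3 * (K * (2 * m * (3 * (q * (q ^ (d₃ ∸ d) * q ^ d)) + 3 * (q * (q ^ (d₃ ∸ d) * q ^ d))))) ≡⟨ solve₁ K m q (q ^ (d₃ ∸ d)) (q ^ d) ⟩
      m * (v d + v d) * q ^ d ∎)
      where
      solve₁ : ∀ K m q a b → 3 * (K * (2 * m * (3 * (q * (a * b)) + 3 * (q * (a * b))))) ≡ m * (18 * (K * (q * a)) + 18 * (K * (q * a))) * b
      solve₁ = solve-∀
    v-bound : ∀ d → 4 * (v d + v d) ≤ q ^ (2 + (d₃ ∸ d))
    v-bound d = begin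
      4 * (18 * (K * x) + 18 * (K * x)) ≡⟨ solve₁ K x ⟩
      144 * K * x ≤⟨ ℕ.*-monoˡ-≤ x (≤-trans (ℕ.*-monoˡ-≤ K (ℕ.m≤m+n 144 432)) 576K≤q) ⟩
      q * x ∎
      where
      x = q ^ suc (d₃ ∸ d)
      solve₁ : ∀ K x → 4 * (18 * (K * x) + 18 * (K * x)) ≡ 144 * K * x
      solve₁ = solve-∀
    few : (4 * (v d₁ + v d₁)) ^ m * ((4 * (v d₂ + v d₂)) ^ m * (4 * (v d₃ + v d₃)) ^ m) < (3 * D) ^ m
    few = begin-strict
      x₁ ^ m * (x₂ ^ m * x₃ ^ m) ≡⟨ cong (x₁ ^ m *_) (^-distribʳ-* x₂ x₃ m) ⟨
      x₁ ^ m * (x₂ * x₃) ^ m ≡⟨ ^-distribʳ-* x₁ (x₂ * x₃) m ⟨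
      (x₁ * (x₂ * x₃)) ^ m <⟨ ℕ.^-monoˡ-< m {{>-nonZero m>0}} base ⟩
      (3 * D) ^ m ∎
      where
      x₁ = 4 * (v d₁ + v d₁)
      x₂ = 4 * (v d₂ + v d₂)
      x₃ = 4 * (v d₃ + v d₃)
      solve₁ : ∀ a b → 2 + a + (2 + b + (2 + 0)) ≡ 6 + b + a
      solve₁ = solve-∀
      solve₂ : ∀ a b → 6 + b + a ≡ suc (a + (5 + b))
      solve₂ = solve-∀
      -- Each kind of key costs two levels beyond its distance from `d₃`, six in all, of which the
      -- exponent of `D` covers one. The other 5 and the gap of at most `r + r` must fit below `d₁`:
      -- hence σ = 5 + (r + r).
      exponents : 2 + (d₃ ∸ d₁) + (2 + (d₃ ∸ d₂) + (2 + (d₃ ∸ d₃))) ≤ suc d₃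
      exponents = begin
        2 + (d₃ ∸ d₁) + (2 + (d₃ ∸ d₂) + (2 + (d₃ ∸ d₃))) ≡⟨ cong (λ z → 2 + (d₃ ∸ d₁) + (2 + (d₃ ∸ d₂) + (2 + z))) (ℕ.n∸n≡0 d₃) ⟩
        2 + (d₃ ∸ d₁) + (2 + (d₃ ∸ d₂) + (2 + 0)) ≡⟨ trans (solve₁ (d₃ ∸ d₁) (d₃ ∸ d₂)) (solve₂ (d₃ ∸ d₁) (d₃ ∸ d₂)) ⟩
        suc (d₃ ∸ d₁ + (5 + (d₃ ∸ d₂))) ≤⟨ s≤s (ℕ.+-monoʳ-≤ (d₃ ∸ d₁) (≤-trans (ℕ.+-monoʳ-≤ 5 (≤-trans (ℕ.∸-monoˡ-≤ d₂ gap) (≤-reflexive (ℕ.m+n∸m≡n d₂ (r + r))))) deep)) ⟩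
        suc (d₃ ∸ d₁ + d₁) ≡⟨ cong suc (ℕ.m∸n+n≡m (≤-trans d₁≤d₂ d₂≤d₃)) ⟩
        suc d₃ ∎
      base : x₁ * (x₂ * x₃) < 3 * D
      base = begin-strict
        x₁ * (x₂ * x₃) ≤⟨ ℕ.*-mono-≤ (v-bound d₁) (ℕ.*-mono-≤ (v-bound d₂) (v-bound d₃)) ⟩
        q ^ a₁ * (q ^ a₂ * q ^ a₃) ≡⟨ cong (q ^ a₁ *_) (ℕ.^-distribˡ-+-* q a₂ a₃) ⟨
        q ^ a₁ * q ^ (a₂ + a₃) ≡⟨ ℕ.^-distribˡ-+-* q a₁ (a₂ + a₃) ⟨
        q ^ (a₁ + (a₂ + a₃)) ≤⟨ ℕ.^-monoʳ-≤ q {{>-nonZero q>0}} exponents ⟩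
        D <⟨ ℕ.m<n+m D (≤-trans D>0 (ℕ.m≤m+n D (D + 0))) ⟩
        D + (D + 0) + D ≡⟨ solve₃ D ⟩
        3 * D ∎
        where
        a₁ = 2 + (d₃ ∸ d₁)
        a₂ = 2 + (d₃ ∸ d₂)
        a₃ = 2 + (d₃ ∸ d₃)
        solve₃ : ∀ D → D + (D + 0) + D ≡ 3 * D
        solve₃ = solve-∀

-- Levels

module _ {n : ℕ} where

  sameSet-pair : {u v u' v' w : Fin n} → pair u v ≡ pair u' v' → SameSet (u' , v' , w) (u , v , w)
  sameSet-pair {w = w} e with pair-injective e
  ... | inj₁ (refl , refl) = λ _ → id , id
  ... | inj₂ (refl , refl) = λ _ → swap₁₂ , swap₁₂

  complete : {u v : Fin n} (t : Triple n) → pair u v ∈ pairs t → ∃[ w ] SameSet t (u , v , w)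
  complete t@(y , x , z) (here e) = z , sameSet-pair e
  complete {u} {v} t@(y , x , z) (there (here e)) =
    x , sameSet-trans t (y , z , x) (u , v , x) (λ _ → swap₂₃ , swap₂₃) (sameSet-pair e)
  complete {u} {v} t@(y , x , z) (there (there (here e))) =
    y , sameSet-trans t (x , z , y) (u , v , y) (λ _ → swap₂₃ ∘ swap₁₂ , swap₁₂ ∘ swap₂₃) (sameSet-pair e)

  sameSet? : Decidable₂ (SameSet {n})
  sameSet? t t' = F.all? λ v → (v ∈₃? t →-dec v ∈₃? t') ×-dec (v ∈₃? t' →-dec v ∈₃? t)

  pairs-sameSet : {t t' : Triple n} → Distinct t → SameSet t t' → ∀ {p} → p ∈ pairs t → p ∈ pairs t'
  pairs-sameSet {y , x , z} {t'} (y≢x , _ , _) s (here refl) = pair∈pairs t' y≢x (proj₁ (s y) (inj₁ refl)) (proj₁ (s x) (inj₂ (inj₁ refl)))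
  pairs-sameSet {y , x , z} {t'} (_ , _ , y≢z) s (there (here refl)) = pair∈pairs t' y≢z (proj₁ (s y) (inj₁ refl)) (proj₁ (s z) (inj₂ (inj₂ refl)))
  pairs-sameSet {y , x , z} {t'} (_ , x≢z , _) s (there (there (here refl))) = pair∈pairs t' x≢z (proj₁ (s x) (inj₂ (inj₁ refl))) (proj₁ (s z) (inj₂ (inj₂ refl)))

  Ordered : (Pair n → ℕ) → Triple n → Set
  Ordered f t = f (e₁ t) ≤ f (e₂ t) × f (e₂ t) ≤ f (e₃ t)

  abstract
    orient : (f : Pair n → ℕ) (t : Triple n) → ∃[ t' ] (SameSet t' t × (Distinct t → Distinct t') × Ordered f t')
    orient f (y , x , z)
      with ℕ.≤-total (f (pair y x)) (f (pair y z)) | ℕ.≤-total (f (pair y z)) (f (pair x z)) | ℕ.≤-total (f (pair y x)) (f (pair x z))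
    ... | inj₁ a | inj₁ b | _      = (y , x , z) , (λ _ → id , id) , id , a , b
    ... | inj₁ _ | inj₂ b | inj₁ c rewrite pair-comm y x =
      (x , y , z) , (λ _ → swap₁₂ , swap₁₂) , (λ { (p , q , s) → ≢-sym p , s , q }) , c , b
    ... | inj₁ a | inj₂ b | inj₂ c rewrite pair-comm y x | pair-comm y z =
      (x , z , y) , (λ _ → swap₁₂ ∘ swap₂₃ , swap₂₃ ∘ swap₁₂) , (λ { (p , q , s) → q , ≢-sym s , ≢-sym p }) , c , a
    ... | inj₂ a | inj₁ _ | inj₁ c rewrite pair-comm x z =
      (y , z , x) , (λ _ → swap₂₃ , swap₂₃) , (λ { (p , q , s) → s , ≢-sym q , p }) , a , c
    ... | inj₂ _ | inj₁ b | inj₂ c rewrite pair-comm x z | pair-comm y z =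
      (z , y , x) , (λ _ → swap₂₃ ∘ swap₁₂ , swap₁₂ ∘ swap₂₃) , (λ { (p , q , s) → ≢-sym s , p , ≢-sym q }) , b , c
    ... | inj₂ a | inj₂ b | _      rewrite pair-comm x z | pair-comm y z | pair-comm y x =
      (z , x , y) , (λ _ → swap₂₃ ∘ swap₁₂ ∘ swap₂₃ , swap₂₃ ∘ swap₁₂ ∘ swap₂₃) , (λ { (p , q , s) → ≢-sym q , ≢-sym p , ≢-sym s }) , b , a

  sorted⇒distinct : (t : Triple n) → Sorted t → Distinct t
  sorted⇒distinct (a , b , c) (a<b , b<c) = F.<⇒≢ a<b , F.<⇒≢ b<c , F.<⇒≢ (F.<-trans a<b b<c)

  sorted-sameSet : (t t' : Triple n) → Sorted t → Sorted t' → SameSet t t' → t ≡ t'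
  sorted-sameSet t@(a , b , c) t'@(a' , b' , c') s s' same
    with F.≤-antisym (least t s (proj₂ (same a') (inj₁ refl))) (least t' s' (proj₁ (same a) (inj₁ refl)))
       | F.≤-antisym (greatest t' s' (proj₁ (same c) (inj₂ (inj₂ refl)))) (greatest t s (proj₂ (same c') (inj₂ (inj₂ refl))))
    where
    least : ∀ {v} (t : Triple n) → Sorted t → v ∈₃ t → proj₁ t F.≤ v
    least t _ (inj₁ refl) = ≤-refl
    least t (a<b , _) (inj₂ (inj₁ refl)) = ℕ.<⇒≤ a<b
    least t (a<b , b<c) (inj₂ (inj₂ refl)) = ℕ.<⇒≤ (ℕ.<-trans a<b b<c)
    greatest : ∀ {v} (t : Triple n) → Sorted t → v ∈₃ t → v F.≤ proj₂ (proj₂ t)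
    greatest t (a<b , b<c) (inj₁ refl) = ℕ.<⇒≤ (ℕ.<-trans a<b b<c)
    greatest t (_ , b<c) (inj₂ (inj₁ refl)) = ℕ.<⇒≤ b<c
    greatest t _ (inj₂ (inj₂ refl)) = ≤-refl
  ... | refl | refl with proj₁ (same b) (inj₂ (inj₁ refl))
  ... | inj₁ refl = contradiction refl (F.<⇒≢ (proj₁ s))
  ... | inj₂ (inj₁ refl) = refl
  ... | inj₂ (inj₂ refl) = contradiction refl (F.<⇒≢ (proj₂ s))

  module _ (G : TripleSystem n) where

    sorted-in : ∀ {g} → g ∈ triples G → Sorted g
    sorted-in = All.lookup (sorted G)

    -- A triple through `u` and `v` is determined by its third vertex.
    codegree-≤ : ∀ u v → codegree (triples G) (pair u v) ≤ n
    codegree-≤ u v = begin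
      count (λ g → pair u v ∈ₚ? pairs g) (triples G) ≤⟨ count-cong (λ g → p ∈ₚ? pairs g) (λ g → any? (completes? g) (allFin n)) (triples G) (λ {g} _ p∈ → let w , s = complete g p∈ in lose (∈-allFin w) s) ⟩
      count (λ g → any? (completes? g) (allFin n)) (triples G) ≤⟨ count-any completes? (triples G) (allFin n) ⟩
      sum (map (λ w → count (λ g → completes? g w) (triples G)) (allFin n)) ≤⟨ sum-≤ _ 1 (allFin n) (λ {w} _ → once w) ⟩
      length (allFin n) * 1 ≡⟨ trans (ℕ.*-identityʳ _) (length-tabulate {n = n} id) ⟩
      n ∎
      where
      open ≤-Reasoning
      p = pair u v
      Completes : Triple n → Fin n → Set
      Completes g w = SameSet g (u , v , w)
      completes? : Decidable₂ Completes
      completes? g w = sameSet? g (u , v , w)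
      once : ∀ w → count (λ g → completes? g w) (triples G) ≤ 1
      once w = count≤1 (λ g → completes? g w) (unique G) λ {g} {g'} g∈ g'∈ s s' →
        sorted-sameSet g g' (sorted-in g∈) (sorted-in g'∈) (sameSet-trans g (u , v , w) g' s (sameSet-sym g' (u , v , w) s'))

    codegree-sum : ∀ {U} → Unique U → sum (map (codegree (triples G)) U) ≤ 3 * e G
    codegree-sum {U} U! = begin
      sum (map (codegree (triples G)) U) ≡⟨ double-count (λ p g → p ∈ₚ? pairs g) U (triples G) ⟩
      sum (map (λ g → count (_∈ₚ? pairs g) U) (triples G))
        ≤⟨ sum-≤ _ 3 (triples G) (λ {g} _ → unique⇒length≤ (Unique.filter⁺ (_∈ₚ? pairs g) U!) (λ p∈ → proj₂ (∈-filter⁻ (_∈ₚ? pairs g) {xs = U} p∈))) ⟩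
      e G * 3 ≡⟨ ℕ.*-comm (e G) 3 ⟩
      3 * e G ∎
      where open ≤-Reasoning

-- Classes of triples with prescribed levels

module Classes {n : ℕ} (n>0 : 0 < n) (G : TripleSystem n) (q j r σ S K : ℕ)
  (r≡ : r ≡ suc j + suc j) (σ≡ : σ ≡ 5 + (r + r)) (K≡ : K ≡ (2 + S) * ((2 + S) * (2 + S))) (exponent : suc S ≤ σ * j)
  (large-q : 576 * K * r * r ≤ q) (n<q^ : n < q ^ suc S) (dense : n * n * q ^ suc σ < e G) where

  K>0 : 0 < K
  K>0 = subst (0 <_) (sym K≡) (s≤s z≤n)

  r>0 : 0 < r
  r>0 = subst (0 <_) (sym r≡) (s≤s z≤n)

  2≤σ : 2 ≤ σ
  2≤σ = subst (2 ≤_) (sym σ≡) (s≤s (s≤s z≤n))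

  cod : Pair n → ℕ
  cod = codegree (triples G)

  lev : Pair n → ℕ
  lev p = level q (suc S) (cod p)

  turned : Triple n → Triple n
  turned g = proj₁ (orient lev g)

  turned-sameSet : ∀ g → SameSet (turned g) g
  turned-sameSet g = proj₁ (proj₂ (orient lev g))

  turned-distinct : ∀ {g} → g ∈ triples G → Distinct (turned g)
  turned-distinct {g} g∈ = proj₁ (proj₂ (proj₂ (orient lev g))) (sorted⇒distinct g (sorted-in G g∈))

  turned-ordered : ∀ g → Ordered lev (turned g)
  turned-ordered g = proj₂ (proj₂ (proj₂ (orient lev g)))

  turned-injective : ∀ {g g'} → g ∈ triples G → g' ∈ triples G → SameSet (turned g) (turned g') → g ≡ g'
  turned-injective {g} {g'} g∈ g'∈ s = sorted-sameSet g g' (sorted-in G g∈) (sorted-in G g'∈)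
    (sameSet-trans g (turned g) g' (sameSet-sym (turned g) g (turned-sameSet g))
      (sameSet-trans (turned g) (turned g') g' s (turned-sameSet g')))

  O : List (Triple n)
  O = map turned (triples G)

  O! : Unique O
  O! = unique-map turned (λ {g} {g'} g∈ g'∈ eq → turned-injective g∈ g'∈
    (subst (SameSet (turned g)) eq (sameSet-refl (turned g)))) (unique G)

  key : Triple n → ℕ × ℕ × ℕ
  key t = lev (e₁ t) , lev (e₂ t) , lev (e₃ t)

  _≟k_ : DecidableEquality (ℕ × ℕ × ℕ)
  _≟k_ = Product.≡-dec ℕ._≟_ (Product.≡-dec ℕ._≟_ ℕ._≟_)

  -- `level` searches from `suc S`, because codegrees are at most n < q ^ suc S. There are 2 + S
  -- possible values, and `K` is the cube of this.
  levels : List ℕ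
  levels = upTo (2 + S)

  keys : List (ℕ × ℕ × ℕ)
  keys = cartesianProduct levels (cartesianProduct levels levels)

  keys-length : length keys ≡ K
  keys-length = trans (trans (length-cartesianProduct levels (cartesianProduct levels levels))
    (cong₂ _*_ upTo-length (trans (length-cartesianProduct levels levels) (cong₂ _*_ upTo-length upTo-length)))) (sym K≡)
    where
    upTo-length : length levels ≡ 2 + S
    upTo-length = length-upTo (2 + S)

  key∈keys : ∀ t → key t ∈ keys
  key∈keys t = ∈-cartesianProduct⁺ (lev∈ (e₁ t)) (∈-cartesianProduct⁺ (lev∈ (e₂ t)) (lev∈ (e₃ t)))
    where
    lev∈ : ∀ p → lev p ∈ levels
    lev∈ p = ∈-upTo⁺ (s≤s (level-≤ q (suc S) (cod p)))

  class : ∃[ κ ] (e G ≤ K * count (λ t → key t ≟k κ) O)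
  class =
    let κ , le = large-fibre _≟k_ key keys O (λ {t} _ → key∈keys t) (≤-trans K>0 (≤-reflexive (sym keys-length)))
    in κ , ≤-trans (≤-reflexive (sym (length-map turned (triples G)))) (≤-trans le (≤-reflexive (cong (_* count (λ t → key t ≟k κ) O) keys-length)))

  module Class (d₁ d₂ d₃ : ℕ) (big : e G ≤ K * count (λ t → key t ≟k (d₁ , d₂ , d₃)) O) where

    κ? : Decidable (λ t → key t ≡ (d₁ , d₂ , d₃))
    κ? t = key t ≟k (d₁ , d₂ , d₃)

    T : List (Triple n)
    T = filter κ? O

    open Parameters K r q (length T) K>0 r>0 large-q

    T-large : n * n * q ^ suc σ < K * length T
    T-large = ≤-trans dense big

    source : ∀ {t} → t ∈ T → ∃[ g ] (g ∈ triples G × t ≡ turned g)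
    source t∈ = ∈-map⁻ turned (proj₁ (∈-filter⁻ κ? {xs = O} t∈))

    T-key : ∀ {t} → t ∈ T → key t ≡ (d₁ , d₂ , d₃)
    T-key t∈ = proj₂ (∈-filter⁻ κ? {xs = O} t∈)

    lev₁ : ∀ {t} → t ∈ T → lev (e₁ t) ≡ d₁
    lev₁ t∈ = cong proj₁ (T-key t∈)

    lev₂ : ∀ {t} → t ∈ T → lev (e₂ t) ≡ d₂
    lev₂ t∈ = cong (proj₁ ∘ proj₂) (T-key t∈)

    lev₃ : ∀ {t} → t ∈ T → lev (e₃ t) ≡ d₃
    lev₃ t∈ = cong (proj₂ ∘ proj₂) (T-key t∈)

    oriented : Oriented G T
    oriented = record
      { uniqueT = Unique.filter⁺ κ? O!
      ; distinct = λ t∈ → let g , g∈ , t≡ = source t∈ in subst Distinct (sym t≡) (turned-distinct g∈)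
      ; sameSet = λ t∈ t'∈ → same (source t∈) (source t'∈)
      ; in-G = λ t∈ → let g , g∈ , t≡ = source t∈ in g , g∈ , subst (λ t → SameSet t g) (sym t≡) (turned-sameSet g) }
      where
      same : ∀ {t t'} → ∃[ g ] (g ∈ triples G × t ≡ turned g) → ∃[ g ] (g ∈ triples G × t' ≡ turned g) → SameSet t t' → t ≡ t'
      same (g , g∈ , refl) (g' , g'∈ , refl) s = cong turned (turned-injective g∈ g'∈ s)

    pair-in-G : ∀ {t p} → t ∈ T → p ∈ pairs t → ∃[ g ] (g ∈ triples G × p ∈ pairs g)
    pair-in-G t∈ p∈ with source t∈
    ... | g , g∈ , refl = g , g∈ , pairs-sameSet (turned-distinct g∈) (turned-sameSet g) p∈

    codegree-T : ∀ p → codegree T p ≤ cod p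
    codegree-T p = begin
      codegree T p ≤⟨ count-⊑ (λ t → p ∈ₚ? pairs t) (Sublist.filter-⊆ κ? O) ⟩
      codegree O p ≡⟨ count-map (λ t → p ∈ₚ? pairs t) turned (triples G) ⟩
      count (λ g → p ∈ₚ? pairs (turned g)) (triples G)
        ≤⟨ count-cong _ (λ g → p ∈ₚ? pairs g) (triples G) (λ {g} g∈ → pairs-sameSet (turned-distinct g∈) (turned-sameSet g)) ⟩
      cod p ∎
      where open ≤-Reasoning

    cod≤n : ∀ {t p} → p ∈ pairs t → cod p ≤ n
    cod≤n {y , x , z} (here refl) = codegree-≤ G y x
    cod≤n {y , x , z} (there (here refl)) = codegree-≤ G y z
    cod≤n {y , x , z} (there (there (here refl))) = codegree-≤ G x z

    lev-spec : ∀ {t p} → t ∈ T → p ∈ pairs t → q ^ lev p ≤ cod p × cod p < q ^ suc (lev p)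
    lev-spec {t} {p} t∈ p∈ = let g , g∈ , p∈g = pair-in-G t∈ p∈ in
      level-spec q (suc S) (cod p) (∈⇒count>0 (λ g → p ∈ₚ? pairs g) g∈ p∈g) (≤-trans (s≤s (cod≤n {t} p∈)) n<q^)

    codegree-bound : ∀ {t p d} → t ∈ T → p ∈ pairs t → lev p ≤ d → codegree T p ≤ q ^ suc d
    codegree-bound {p = p} t∈ p∈ le = ≤-trans (codegree-T p) (≤-trans (ℕ.<⇒≤ (proj₂ (lev-spec t∈ p∈))) (ℕ.^-monoʳ-≤ q {{>-nonZero q>0}} (s≤s le)))

    universe : (Triple n → Pair n) → List (Pair n)
    universe f = deduplicate _≟ₚ_ (map f T)

    universe! : ∀ f → Unique (universe f)
    universe! f = DecUnique.deduplicate-! _≟ₚ_ (map f T)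

    universe⁺ : ∀ f {t} → t ∈ T → f t ∈ universe f
    universe⁺ f t∈ = ∈-deduplicate⁺ _≟ₚ_ (∈-map⁺ f t∈)

    -- Levels are measured in `G`: upper bounds on codegrees pass to `T`, but lower bounds do not.
    -- So the codegrees are summed in `G`, and `big` leads back to `T` at the price of `K`.
    universe-size : ∀ f d → (∀ {t} → t ∈ T → f t ∈ pairs t × lev (f t) ≡ d) → length (universe f) * q ^ d ≤ 3 * (K * length T)
    universe-size f d spec = ≤-trans (sum-≥ cod (q ^ d) (universe f) (λ p∈ → large (∈-map⁻ f (∈-deduplicate⁻ _≟ₚ_ (map f T) p∈))))
      (≤-trans (codegree-sum G (universe! f)) (ℕ.*-monoʳ-≤ 3 big))
      where
      large : ∀ {p} → ∃[ t ] (t ∈ T × p ≡ f t) → q ^ d ≤ cod p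
      large (t , t∈ , refl) = let p∈ , l = spec t∈ in subst (λ l → q ^ l ≤ cod (f t)) l (proj₁ (lev-spec t∈ p∈))

    spec₁ : ∀ {t} → t ∈ T → e₁ t ∈ pairs t × lev (e₁ t) ≡ d₁
    spec₁ t∈ = here refl , lev₁ t∈

    spec₂ : ∀ {t} → t ∈ T → e₂ t ∈ pairs t × lev (e₂ t) ≡ d₂
    spec₂ t∈ = there (here refl) , lev₂ t∈

    spec₃ : ∀ {t} → t ∈ T → e₃ t ∈ pairs t × lev (e₃ t) ≡ d₃
    spec₃ t∈ = there (there (here refl)) , lev₃ t∈

    U₁ U₂ U₃ : List (Pair n)
    U₁ = universe e₁
    U₂ = universe e₂
    U₃ = universe e₃

    member : ∃[ t ] (t ∈ T)
    member with T in eq | T-large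
    ... | [] | lt = contradiction lt (λ lt → ℕ.n≮0 (≤-trans lt (≤-reflexive (ℕ.*-zeroʳ K))))
    ... | t ∷ _ | _ = t , here refl

    levels-ordered : d₁ ≤ d₂ × d₂ ≤ d₃
    levels-ordered with member
    ... | t , t∈ with source t∈
    ... | g , g∈ , t≡ =
      let o₁ , o₂ = subst (Ordered lev) (sym t≡) (turned-ordered g)
      in ≤-trans (≤-reflexive (sym (lev₁ t∈))) (≤-trans o₁ (≤-reflexive (lev₂ t∈))) ,
         ≤-trans (≤-reflexive (sym (lev₂ t∈))) (≤-trans o₂ (≤-reflexive (lev₃ t∈)))

    q^d₃≤n : q ^ d₃ ≤ n
    q^d₃≤n = let t , t∈ = member ; p∈ , l = spec₃ t∈ in
      ≤-trans (subst (λ l → q ^ l ≤ cod (e₃ t)) l (proj₁ (lev-spec t∈ p∈))) (cod≤n {t} p∈)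

    T-size : length T ≤ n * n * q ^ suc d₁
    T-size = begin
      length T ≤⟨ sum-fibres _≟ₚ_ e₁ U₁ T (universe⁺ e₁) ⟩
      sum (map (λ p → count (λ t → e₁ t ≟ₚ p) T) U₁) ≤⟨ sum-≤ _ (q ^ suc d₁) U₁ (λ p∈ → fibre (∈-map⁻ e₁ (∈-deduplicate⁻ _≟ₚ_ (map e₁ T) p∈))) ⟩
      length U₁ * q ^ suc d₁ ≤⟨ ℕ.*-monoˡ-≤ (q ^ suc d₁) (unique⇒length≤ (universe! e₁) (λ _ → ∈-cartesianProduct⁺ (∈-allFin _) (∈-allFin _))) ⟩
      length (cartesianProduct (allFin n) (allFin n)) * q ^ suc d₁
        ≡⟨ cong (_* q ^ suc d₁) (trans (length-cartesianProduct (allFin n) (allFin n)) (cong₂ _*_ (length-tabulate {n = n} id) (length-tabulate {n = n} id))) ⟩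
      n * n * q ^ suc d₁ ∎
      where
      open ≤-Reasoning
      fibre : ∀ {p} → ∃[ t ] (t ∈ T × p ≡ e₁ t) → count (λ t → e₁ t ≟ₚ p) T ≤ q ^ suc d₁
      fibre (t , t∈ , refl) = ≤-trans (count-cong (λ s → e₁ s ≟ₚ e₁ t) (λ s → e₁ t ∈ₚ? pairs s) T (λ _ eq → here (sym eq)))
        (codegree-bound t∈ (here refl) (≤-reflexive (lev₁ t∈)))

    -- There are at most n² pairs of the sparsest kind, each in at most `q ^ suc d₁` triples of `T`.
    -- If `d₁` were below σ, this would contradict the density even after losing K ≤ q.
    deep : σ ≤ d₁
    deep = ℕ.≮⇒≥ λ d₁<σ → ℕ.<⇒≱ T-large (begin
      K * length T ≤⟨ ℕ.*-mono-≤ K≤q T-size ⟩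
      q * (n * n * q ^ suc d₁) ≡⟨ rearrange q (n * n) (q ^ suc d₁) ⟩
      n * n * q ^ suc (suc d₁) ≤⟨ ℕ.*-monoʳ-≤ (n * n) (ℕ.^-monoʳ-≤ q {{>-nonZero q>0}} (s≤s d₁<σ)) ⟩
      n * n * q ^ suc σ ∎)
      where
      open ≤-Reasoning
      rearrange : ∀ a b c → a * (b * c) ≡ b * (a * c)
      rearrange = solve-∀
      K≤q : K ≤ q
      K≤q = ≤-trans (ℕ.m≤n*m K 576) 576K≤q

    d₁≤d₂ = proj₁ levels-ordered
    d₂≤d₃ = proj₂ levels-ordered

    immersion : ¬ ¬ ContainsSurfaceImmersion G
    immersion with d₃ ≤? d₂ + (r + r)
    ... | yes gap =
      let m , v₁ , v₂ , v₃ , p₁ , p₂ , p₃ , l₁ , l₂ , l₃ , size , few =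
            balanced-parameters n (length U₁) (length U₂) (length U₃) d₁ d₂ d₃ σ n>0 2≤σ T-large q^d₃≤n
              (universe-size e₁ d₁ spec₁) (universe-size e₂ d₂ spec₂) (universe-size e₃ d₃ spec₃) d₁≤d₂ d₂≤d₃ gap (≤-trans (≤-reflexive (sym σ≡)) deep)
      in λ none → none (balanced oriented (q ^ suc d₃) m U₁ U₂ U₃ v₁ v₂ v₃
           (λ t∈ p∈ → codegree-bound t∈ p∈ (level-bound t∈ p∈))
           (universe! e₁) (universe! e₂) (universe! e₃) (λ t∈ → universe⁺ e₁ t∈ , universe⁺ e₂ t∈ , universe⁺ e₃ t∈)
           p₁ p₂ p₃ l₁ l₂ l₃ size few)
      where
      level-bound : ∀ {t p} → t ∈ T → p ∈ pairs t → lev p ≤ d₃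
      level-bound t∈ (here refl) = ≤-trans (≤-reflexive (lev₁ t∈)) (≤-trans d₁≤d₂ d₂≤d₃)
      level-bound t∈ (there (here refl)) = ≤-trans (≤-reflexive (lev₂ t∈)) d₂≤d₃
      level-bound t∈ (there (there (here refl))) = ≤-reflexive (lev₃ t∈)
    ... | no gap =
      let far = ≤-trans (≤-reflexive (ℕ.+-suc d₂ (r + r))) (ℕ.≰⇒> gap)
          W , m , v , v>0 , room , l , size , few =
            unbalanced-parameters n (length U₃) d₂ d₃ σ n>0 2≤σ T-large q^d₃≤n (universe-size e₃ d₃ spec₃) far
      in Wheels.unbalanced oriented separated (q ^ σ) j r W (q ^ suc d₂) (q ^ (d₃ ∸ d₂)) (≤-reflexive (sym r≡)) n<s^j spoke-bound rim-bound
           (^-positive q (d₃ ∸ d₂) q>0) room m U₃ v (universe! e₃) (universe⁺ e₃) v>0 l size few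
      where
      d₂<d₃ : d₂ < d₃
      d₂<d₃ = ≤-trans (s≤s (ℕ.m≤m+n d₂ (r + r))) (ℕ.≰⇒> gap)
      spoke-level : ∀ {t p} → t ∈ T → p ∈ spokes t → lev p ≤ d₂
      spoke-level t∈ (here refl) = ≤-trans (≤-reflexive (lev₁ t∈)) d₁≤d₂
      spoke-level t∈ (there (here refl)) = ≤-reflexive (lev₂ t∈)
      spoke∈pairs : ∀ {p} t → p ∈ spokes t → p ∈ pairs t
      spoke∈pairs t (here e) = here e
      spoke∈pairs t (there (here e)) = there (here e)
      -- The level depends on the pair alone, so a rim pair, having a strictly higher level, is
      -- never a spoke of another triple.
      separated : ∀ {t t'} → t ∈ T → t' ∈ T → e₃ t ∉ spokes t'
      separated t∈ t'∈ e∈ = ℕ.<⇒≱ d₂<d₃ (≤-trans (≤-reflexive (sym (lev₃ t∈))) (spoke-level t'∈ e∈))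
      spoke-bound : ∀ {t p} → t ∈ T → p ∈ spokes t → codegree T p ≤ q ^ suc d₂
      spoke-bound {t} t∈ p∈ = codegree-bound t∈ (spoke∈pairs t p∈) (spoke-level t∈ p∈)
      rim-bound : ∀ {t} → t ∈ T → codegree T (e₃ t) ≤ q ^ (d₃ ∸ d₂) * q ^ suc d₂
      rim-bound t∈ = ≤-trans (codegree-bound t∈ (there (there (here refl))) (≤-reflexive (lev₃ t∈)))
        (≤-reflexive (trans (cong (q *_) (sym (^-∸-* q d₂≤d₃))) (rearrange q (q ^ (d₃ ∸ d₂)) (q ^ d₂))))
        where
        rearrange : ∀ a b c → a * (b * c) ≡ b * (a * c)
        rearrange = solve-∀
      n<s^j : n < (q ^ σ) ^ j
      n<s^j = begin-strict
        n <⟨ n<q^ ⟩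
        q ^ suc S ≤⟨ ℕ.^-monoʳ-≤ q {{>-nonZero q>0}} exponent ⟩
        q ^ (σ * j) ≡⟨ ℕ.^-*-assoc q σ j ⟨
        (q ^ σ) ^ j ∎
        where
        open ≤-Reasoning

  dense⇒immersion : ¬ ¬ ContainsSurfaceImmersion G
  dense⇒immersion = let (d₁ , d₂ , d₃) , big = class in Class.immersion d₁ d₂ d₃ big

-- The bound for a fixed exponent

power-saving : (c j r σ S K Q : ℕ) → 0 < c → j ≡ 2 * c + 2 → r ≡ suc j + suc j → σ ≡ 5 + (r + r) → S ≡ suc σ * c →
  K ≡ (2 + S) * ((2 + S) * (2 + S)) → Q ≡ 576 * K * r * r + 2 ^ S →
  ∀ n → Q ^ S ≤ n → (G : TripleSystem n) → ¬ ContainsSurfaceImmersion G → e G ^ c ≤ n ^ (2 * c + 1)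
power-saving c j r σ S K Q c>0 j≡ r≡ σ≡ S≡ K≡ Q≡ n Q^S≤n G none =
  decidable-stable (e G ^ c ≤? n ^ (2 * c + 1)) λ many →
    -- `q` is the integer part of the `S`-th root of `n`. As S = (σ + 1) c, the threshold n² q^(σ+1)
    -- is at most n^(2 + 1/c), so a violation of the bound makes `G` dense enough.
    let q , Q≤q , q^S≤n , n< = root Q S n (suc n) S>0 below Q^S≤n
        q>0 = ≤-trans Q>0 Q≤q
        n>0 = ≤-trans (^-positive q S q>0) q^S≤n
    in Classes.dense⇒immersion n>0 G q j r σ S K r≡ σ≡ K≡ exponent
         (≤-trans (≤-trans (ℕ.m≤m+n _ (2 ^ S)) (≤-reflexive (sym Q≡))) Q≤q)
         (≤-trans n< (next q>0 (≤-trans 2^S≤Q Q≤q)))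
         (ℕ.≰⇒> λ few → many (sparse few q^S≤n)) none
  where
  open ≤-Reasoning
  2^S≤Q : 2 ^ S ≤ Q
  2^S≤Q = ≤-trans (ℕ.m≤n+m (2 ^ S) _) (≤-reflexive (sym Q≡))
  Q>0 : 0 < Q
  Q>0 = ≤-trans (^-positive 2 S (s≤s z≤n)) 2^S≤Q
  S>0 : 0 < S
  S>0 = ≤-trans c>0 (≤-trans (ℕ.m≤m+n c (σ * c)) (≤-reflexive (sym S≡)))
  -- With j = 2 c + 2 this holds for every positive σ, which is why σ may be defined from `r` and
  -- thus from `j`.
  exponent : suc S ≤ σ * j
  exponent rewrite S≡ | j≡ | σ≡ = ≤-trans (ℕ.m≤m+n _ _) (≤-reflexive (sym (expand (4 + (r + r)) c)))
    where
    expand : ∀ σ c → suc σ * (2 * c + 2) ≡ suc (suc (suc σ) * c) + (σ * c + 2 * σ + 1)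
    expand = solve-∀
  below : n < suc n ^ S
  below = ≤-trans (≤-reflexive (sym (ℕ.^-identityʳ (suc n)))) (ℕ.^-monoʳ-≤ (suc n) S>0)
  -- Rounding the root down costs at most one level, by (q + 1)^S ≤ (2q)^S; this is the purpose of
  -- `2 ^ S` in `Q`.
  next : ∀ {q} → 0 < q → 2 ^ S ≤ q → suc q ^ S ≤ q ^ suc S
  next {q} q>0 le = begin
    suc q ^ S ≤⟨ ℕ.^-monoˡ-≤ S (ℕ.+-monoˡ-≤ q q>0) ⟩
    (q + q) ^ S ≡⟨ cong (λ z → (q + z) ^ S) (ℕ.+-identityʳ q) ⟨
    (2 * q) ^ S ≡⟨ ^-distribʳ-* 2 q S ⟩
    2 ^ S * q ^ S ≤⟨ ℕ.*-monoˡ-≤ (q ^ S) le ⟩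
    q ^ suc S ∎
  sparse : ∀ {q} → e G ≤ n * n * q ^ suc σ → q ^ S ≤ n → e G ^ c ≤ n ^ (2 * c + 1)
  sparse {q} few le = begin
    e G ^ c ≤⟨ ℕ.^-monoˡ-≤ c few ⟩
    (n * n * q ^ suc σ) ^ c ≡⟨ ^-distribʳ-* (n * n) (q ^ suc σ) c ⟩
    (n * n) ^ c * (q ^ suc σ) ^ c ≡⟨ cong₂ _*_ (^-distribʳ-* n n c) (trans (ℕ.^-*-assoc q (suc σ) c) (cong (q ^_) (sym S≡))) ⟩
    n ^ c * n ^ c * q ^ S ≤⟨ ℕ.*-monoʳ-≤ (n ^ c * n ^ c) le ⟩
    n ^ c * n ^ c * n ≡⟨ cong₂ _*_ (ℕ.^-distribˡ-+-* n c c) (ℕ.^-identityʳ n) ⟨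
    n ^ (c + c) * n ^ 1 ≡⟨ ℕ.^-distribˡ-+-* n (c + c) 1 ⟨
    n ^ (c + c + 1) ≡⟨ cong (λ z → n ^ (c + z + 1)) (ℕ.+-identityʳ c) ⟨
    n ^ (2 * c + 1) ∎

-- The existence of g tending to 0 is stated without real numbers: for every k the exponent 2 + 1/(k
-- + 1) is valid from some `N` on.
theorem1p4 : (k : ℕ) → ∃[ N ] ((n : ℕ) → N ≤ n → (G : TripleSystem n) →
    ¬ ContainsSurfaceImmersion G →
    e G ^ suc k ≤ n ^ (2 * suc k + 1))
theorem1p4 k = _ , power-saving (suc k) _ _ _ _ _ _ (s≤s z≤n) refl refl refl refl refl refl
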